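{- Let $n\geq 8$. Then $R(S_n(2,2),W_8)=2n-1$ if $n\not\equiv 0\pmod 4$, and $R(S_n(2,2),W_8)=2n$ if $n\equiv 0\pmod 4$.
   Context: All graphs are finite and simple. For graphs $G,H$, $R(G,H)$ is the smallest $N$ such that every graph $F$ of order $N$ either contains $G$ as a subgraph or has complement $\overline{F}$ containing $H$. $W_8$ is the wheel of order 9 (a hub joined to every vertex of a cycle $C_8$). $S_k$ is the star of order $k$. $S_n(2,2)$ is the tree of order $n$ obtained from $S_{n-4}$ by subdividing each of two chosen edges twice, i.e. a center adjacent to $n-7$ leaves together with two pendant paths of 3 edges each starting at the center. -}

module Defs where

open import Data.Nat using (ℕ; zero; suc; _∸_; _+_; _≤ᵇ_; _<_) renaming (_≡ᵇ_ to _==_)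
open import Data.Bool using (Bool; true; false; not; _∧_; _∨_; T)
open import Data.Bool.Properties using (∨-comm)
open import Data.Fin using (Fin; toℕ)
open import Data.Product using (Σ; _×_; _,_)
open import Data.Sum using (_⊎_)
open import Function.Definitions using (Injective)
open import Relation.Binary.PropositionalEquality using (_≡_; refl; cong; cong₂)
open import Relation.Nullary using (¬_)

record Graph (n : ℕ) : Set where
  field
    adj   : Fin n → Fin n → Bool
    sym   : ∀ u v → adj u v ≡ adj v u
    irrefl : ∀ u → adj u u ≡ false
open Graph public

complement : ∀ {n} → Graph n → Graph n
complement {n} F = record
  { adj = λ u v → not (toℕ u == toℕ v) ∧ not (adj F u v)
  ; sym = λ u v → cong₂ (λ a b → not a ∧ not b) (==-sym (toℕ u) (toℕ v)) (sym F u v)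
  ; irrefl = λ u → lem (toℕ u)
  }
  where
  ==-sym : ∀ a b → (a == b) ≡ (b == a)
  ==-sym zero zero = refl
  ==-sym zero (suc b) = refl
  ==-sym (suc a) zero = refl
  ==-sym (suc a) (suc b) = ==-sym a b
  lem : ∀ a {x : Bool} → (not (a == a) ∧ x) ≡ false
  lem zero = refl
  lem (suc a) = lem a

_⊆_ : ∀ {k n} → Graph k → Graph n → Set
_⊆_ {k} {n} G F =
  Σ (Fin k → Fin n) λ f → Injective _≡_ _≡_ f ×
    (∀ u v → T (adj G u v) → T (adj F (f u) (f v)))

RamseyProperty : ∀ {a b} → Graph a → Graph b → ℕ → Set
RamseyProperty G H N = (F : Graph N) → (G ⊆ F) ⊎ (H ⊆ complement F)

IsRamseyNumber : ∀ {a b} → Graph a → Graph b → ℕ → Set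
IsRamseyNumber G H N =
  RamseyProperty G H N × (∀ M → M < N → ¬ RamseyProperty G H M)

fromEdges : (n : ℕ) → (ℕ → ℕ → Bool) → Graph n
fromEdges n E = record
  { adj = λ u v → not (toℕ u == toℕ v) ∧ (E (toℕ u) (toℕ v) ∨ E (toℕ v) (toℕ u))
  ; sym = λ u v → cong₂ (λ a b → not a ∧ b) (==-sym (toℕ u) (toℕ v))
                        (∨-comm (E (toℕ u) (toℕ v)) (E (toℕ v) (toℕ u)))
  ; irrefl = λ u → lem (toℕ u)
  }
  where
  ==-sym : ∀ a b → (a == b) ≡ (b == a)
  ==-sym zero zero = refl
  ==-sym zero (suc b) = refl
  ==-sym (suc a) zero = refl
  ==-sym (suc a) (suc b) = ==-sym a b
  lem : ∀ a {x : Bool} → (not (a == a) ∧ x) ≡ false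
  lem zero = refl
  lem (suc a) = lem a

-- Wheel W_8 of order 9: hub 0, rim cycle 1 - 2 - ... - 8 - 1.
wheelEdges : ℕ → ℕ → Bool
wheelEdges u v =
  ((u == 0) ∧ (1 ≤ᵇ v) ∧ (v ≤ᵇ 8))
  ∨ ((1 ≤ᵇ u) ∧ (u ≤ᵇ 7) ∧ (v == suc u))
  ∨ ((u == 1) ∧ (v == 8))

W8 : Graph 9
W8 = fromEdges 9 wheelEdges

-- S_n(2,2) of order n (n ≥ 8): center 0 adjacent to leaves 1,...,n-7, plus
-- pendant paths 0 - (n-6) - (n-5) - (n-4) and 0 - (n-3) - (n-2) - (n-1).
spiderEdges : ℕ → ℕ → ℕ → Bool
spiderEdges n u v =
  ((u == 0) ∧ (1 ≤ᵇ v) ∧ (v ≤ᵇ (n ∸ 7)))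
  ∨ ((u == 0) ∧ (v == (n ∸ 6)))
  ∨ ((u == (n ∸ 6)) ∧ (v == (n ∸ 5)))
  ∨ ((u == (n ∸ 5)) ∧ (v == (n ∸ 4)))
  ∨ ((u == 0) ∧ (v == (n ∸ 3)))
  ∨ ((u == (n ∸ 3)) ∧ (v == (n ∸ 2)))
  ∨ ((u == (n ∸ 2)) ∧ (v == (n ∸ 1)))

S22 : (n : ℕ) → Graph n
S22 n = fromEdges n (spiderEdges n)

{-# OPTIONS --safe #-}

-- Lower bound.  A clique on n − 1 vertices together with at most n − 1 further vertices, or with n further
-- vertices that form a complete multipartite graph with parts of size 4 when 4 divides n, contains no
-- S_n(2,2): in the multipartite graph a spanning spider leaves exactly the three other vertices of the
-- part of its centre and one more vertex to be matched by two edges, but the three are independent.  The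
-- complement contains no W_8, since every rim vertex or every second one would lie in one part.
--
-- Upper bound.  Let F have no S_n(2,2) and its complement no W_8.  First, F has a vertex v of degree at
-- least n − 4 (if N = 2n − 1 and all degrees are at most n − 5, a counting argument ends the proof).  For
-- otherwise consider a neighbourhood A in the complement.  Vertices of small degree in A have many common
-- neighbours outside A, which gives a wheel with a hub in A; so some seven vertices have large degree in
-- A, and because R(C₄, K₃) = 7, four of them are cyclically joined by four further vertices of A.  Second,
-- try to attach two disjoint paths of two edges to the neighbours of v.  If this fails, the complement
-- contains all edges between some set Q of at least n vertices and four other vertices, so that each
-- vertex of Q has at most 3 non-neighbours in Q.  Third, such a Q contains S_n(2,2) unless F is complete
-- multipartite on Q with parts of size 4.  Then 4 divides n and N = 2n, any edge leaving Q gives a spider,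
-- and without one the complement has a W_8 or the other n vertices span a spider.
module Submission where

open import Defs renaming (sym to adj-sym)
open import Data.Bool using (Bool; true; false; not; _∧_; _∨_; T; T?)
open import Data.Bool.Properties using (T-∧; T-∨)
open import Data.Empty using (⊥; ⊥-elim)
open import Data.Fin using (Fin; zero; suc; toℕ; fromℕ<; punchOut)
open import Data.Fin.Patterns
import Data.Fin.Properties as Fin
open import Data.List using (List; []; _∷_; _++_; length; lookup)
open import Data.List.Properties using (length-++)
open import Data.List.Membership.Propositional using () renaming (_∈_ to _∈ˡ_)
import Data.List.Membership.Propositional.Properties as Membership
open import Data.List.Relation.Unary.All as All using (All; []; _∷_)
open import Data.List.Relation.Unary.All.Properties using (++⁺)
import Data.List.Relation.Unary.AllPairs.Properties as AllPairs
open import Data.List.Relation.Unary.Any as Any using (any?)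
open import Data.List.Relation.Unary.AllPairs using ([]; _∷_)
open import Data.List.Relation.Unary.Unique.Propositional using (Unique)
open import Data.Nat using (ℕ; zero; suc; _≤_; _<_; _+_; _*_; _∸_; _/_; _%_; z≤n; s≤s; _≤?_; _<?_; _≡ᵇ_; _≤ᵇ_;
  _<ᵇ_)
open import Data.Nat.Divisibility using (_∣_; divides; quotient; _∣0; ∣-refl; ∣m∣n⇒∣m+n; n∣m⇒m%n≡0; m%n≡0⇒n∣m;
  ∣m+n∣m⇒∣n; >⇒∤)
open import Data.Nat.DivMod using (m≡m%n+[m/n]*n; m%n<n; +-distrib-/-∣ʳ; m<n⇒m/n≡0; m*n/n≡m)
open import Data.Nat.Tactic.RingSolver using (solve-∀)
open import Data.Nat.Properties renaming (_≟_ to _≟ⁿ_)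
open import Data.Product using (∃; ∃₂; _×_; _,_; proj₁; proj₂)
open import Data.Product.Properties using (≡-dec)
open import Data.Sum using (_⊎_; inj₁; inj₂; [_,_]′)
import Data.Vec as Vec
open import Data.Vec.Properties using (lookup∘tabulate)
open import Data.Unit using (⊤; tt)
open import Function using (_∘_; id)
open import Function.Bundles using (Equivalence)
open import Function.Definitions using (Injective)
open import Relation.Binary.PropositionalEquality using
  (_≡_; _≢_; refl; sym; trans; cong; cong₂; subst; subst₂; ≢-sym)
open import Relation.Nullary using (¬_; Dec; yes; no; does; contradiction)
open import Relation.Nullary.Decidable using (_×-dec_; _⊎-dec_; ¬?; map′; decidable-stable; from-yes; _→-dec_;
  toWitness; True)

-- Linear arithmetic

-- Wheels are almost always excluded by one device: fix a hub and four alternate rim vertices, then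
-- fill the four gaps one at a time with common neighbours in the complement. Gaps with 1, 2, 3 and
-- 4 candidates suffice, and most small constants descend from these numbers. The counting behind
-- the large degree yields a degree above D whenever N ≥ 2D + 10. For N = 2n this reaches n - 4, for
-- N = 2n - 1 only n - 5; this lost unit is why the case of low degrees has to be treated at all. A
-- second obstacle is n = 8. A path through one of only four neighbours of v leaves three, while the
-- small side of a complete pair must have four vertices; either a fifth neighbour or v itself has
-- to step in. Extending v can also end with n - 1 vertices instead of n. Each of them then has at
-- most one non-neighbour in the set, so that a single edge leaving the set already produces a
-- spider. Divisibility by 4 enters the upper bound through one observation: the structure found on
-- Q is also found on every subset with at least n elements, so 4 divides every number from n to the
-- order of Q.

nth : List ℕ → ℕ → ℕ
nth []      _       = 0
nth (x ∷ _) zero    = x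
nth (_ ∷ l) (suc i) = nth l i

infixl 8 _⊕_
infixr 9 _⊛_
infix 6 _·_≼_

data Linear : Set where
  lit var : ℕ → Linear
  _⊕_ : Linear → Linear → Linear
  _⊛_ : ℕ → Linear → Linear

⟦_⟧ : Linear → List ℕ → ℕ
⟦ lit k ⟧ ρ = k
⟦ var i ⟧ ρ = nth ρ i
⟦ s ⊕ t ⟧ ρ = ⟦ s ⟧ ρ + ⟦ t ⟧ ρ
⟦ k ⊛ t ⟧ ρ = k * ⟦ t ⟧ ρ

dot : List ℕ → List ℕ → ℕ
dot []       _       = 0
dot (_ ∷ _)  []      = 0
dot (c ∷ cs) (x ∷ ρ) = c * x + dot cs ρ

add : List ℕ → List ℕ → List ℕ
add []       ds       = ds
add (c ∷ cs) []       = c ∷ cs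
add (c ∷ cs) (d ∷ ds) = c + d ∷ add cs ds

scale : ℕ → List ℕ → List ℕ
scale k []       = []
scale k (c ∷ cs) = k * c ∷ scale k cs

unit : ℕ → List ℕ
unit zero    = 1 ∷ []
unit (suc i) = 0 ∷ unit i

-- Entry 0 is the constant term; it meets the 1 prepended to the assignment.
coefficients : Linear → List ℕ
coefficients (lit k) = k ∷ []
coefficients (var i) = 0 ∷ unit i
coefficients (s ⊕ t) = add (coefficients s) (coefficients t)
coefficients (k ⊛ t) = scale k (coefficients t)

dot-add : ∀ cs ds ρ → dot (add cs ds) ρ ≡ dot cs ρ + dot ds ρ
dot-add []       ds       ρ       = refl
dot-add (c ∷ cs) []       ρ       = sym (+-identityʳ _)
dot-add (c ∷ cs) (d ∷ ds) []      = refl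
dot-add (c ∷ cs) (d ∷ ds) (x ∷ ρ)
  rewrite dot-add cs ds ρ | *-distribʳ-+ x c d = interchange (c * x) (d * x) (dot cs ρ) (dot ds ρ)
  where
  interchange : ∀ a b c d → a + b + (c + d) ≡ a + c + (b + d)
  interchange = solve-∀

dot-scale : ∀ k cs ρ → dot (scale k cs) ρ ≡ k * dot cs ρ
dot-scale k []       ρ       = sym (*-zeroʳ k)
dot-scale k (c ∷ cs) []      = sym (*-zeroʳ k)
dot-scale k (c ∷ cs) (x ∷ ρ)
  rewrite dot-scale k cs ρ | *-distribˡ-+ k (c * x) (dot cs ρ) = cong (_+ k * dot cs ρ) (*-assoc k c x)

dot-unit : ∀ i ρ → dot (unit i) ρ ≡ nth ρ i
dot-unit zero    []      = refl
dot-unit zero    (x ∷ ρ) = trans (+-identityʳ _) (*-identityˡ x)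
dot-unit (suc i) []      = refl
dot-unit (suc i) (x ∷ ρ) = dot-unit i ρ

dot-coefficients : ∀ t ρ → ⟦ t ⟧ ρ ≡ dot (coefficients t) (1 ∷ ρ)
dot-coefficients (lit k) ρ = sym (trans (+-identityʳ _) (*-identityʳ k))
dot-coefficients (var i) ρ = sym (dot-unit i ρ)
dot-coefficients (s ⊕ t) ρ = trans (cong₂ _+_ (dot-coefficients s ρ) (dot-coefficients t ρ))
  (sym (dot-add (coefficients s) (coefficients t) (1 ∷ ρ)))
dot-coefficients (k ⊛ t) ρ = trans (cong (k *_) (dot-coefficients t ρ))
  (sym (dot-scale k (coefficients t) (1 ∷ ρ)))

_⊑_ : List ℕ → List ℕ → Bool
[]       ⊑ _        = true
(c ∷ cs) ⊑ []       = (c ≤ᵇ 0) ∧ (cs ⊑ [])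
(c ∷ cs) ⊑ (d ∷ ds) = (c ≤ᵇ d) ∧ (cs ⊑ ds)

dot-mono : ∀ cs ds ρ → T (cs ⊑ ds) → dot cs ρ ≤ dot ds ρ
dot-mono []       ds       ρ       _ = z≤n
dot-mono (c ∷ cs) ds       []      _ = z≤n
dot-mono (c ∷ cs) []       (x ∷ ρ) h with Equivalence.to T-∧ h
... | c≤0 , cs⊑[] = +-mono-≤ (*-monoˡ-≤ x (≤ᵇ⇒≤ c 0 c≤0)) (dot-mono cs [] ρ cs⊑[])
dot-mono (c ∷ cs) (d ∷ ds) (x ∷ ρ) h with Equivalence.to T-∧ h
... | c≤d , cs⊑ds = +-mono-≤ (*-monoˡ-≤ x (≤ᵇ⇒≤ c d c≤d)) (dot-mono cs ds ρ cs⊑ds)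

-- k · s ≼ t is an inequality that enters a linear combination with the factor k.
data Weighted : Set where
  _·_≼_ : ℕ → Linear → Linear → Weighted

lefts rights : List Weighted → Linear
lefts  []               = lit 0
lefts  (k · s ≼ _ ∷ hs) = k ⊛ s ⊕ lefts hs
rights []               = lit 0
rights (k · _ ≼ t ∷ hs) = k ⊛ t ⊕ rights hs

-- Curried, so that a use of `refute` takes the proofs of the inequalities as ordinary further
-- arguments.
Refutation : List Weighted → List ℕ → Set → Set
Refutation []               ρ C = C
Refutation (k · s ≼ t ∷ hs) ρ C = ⟦ s ⟧ ρ ≤ ⟦ t ⟧ ρ → Refutation hs ρ C

opaque

  -- Farkas: a nonnegative combination of the hypotheses reads l ≤ r with r < l coefficientwise.  A use
  -- lists the quantities var 0, var 1, …, then the weighted hypotheses, then their proofs.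
  refute : ∀ ρ hs → {T (coefficients (lit 1 ⊕ rights hs) ⊑ coefficients (lefts hs))} → Refutation hs ρ ⊥
  refute ρ hs {r<l} = collect hs λ l≤r → <⇒≱ (r<l⇒ r<l) l≤r
    where
    r<l⇒ : T (coefficients (lit 1 ⊕ rights hs) ⊑ coefficients (lefts hs)) → ⟦ lit 1 ⊕ rights hs ⟧ ρ ≤ ⟦ lefts
      hs ⟧ ρ
    r<l⇒ h rewrite dot-coefficients (lit 1 ⊕ rights hs) ρ | dot-coefficients (lefts hs) ρ =
      dot-mono (coefficients (lit 1 ⊕ rights hs)) (coefficients (lefts hs)) (1 ∷ ρ) h
    collect : ∀ hs {C} → (⟦ lefts hs ⟧ ρ ≤ ⟦ rights hs ⟧ ρ → C) → Refutation hs ρ C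
    collect []               f   = f z≤n
    collect (k · s ≼ t ∷ hs) f h = collect hs λ hs≤ → f (+-mono-≤ (*-monoʳ-≤ k h) hs≤)

-- Finite sets and their cardinalities

-- Membership is a type rather than a Boolean, so that elements of intersections and differences
-- come with tuples of proofs to match on.
record Sub (N : ℕ) : Set₁ where
  constructor sub
  field
    holds : Fin N → Set
    dec   : ∀ x → Dec (holds x)
open Sub public

infix 4 _∈_ _∉_
_∈_ _∉_ : ∀ {N} → Fin N → Sub N → Set
x ∈ A = holds A x
x ∉ A = ¬ x ∈ A

infixl 7 _∩_
infixl 6 _∪_ _∖_

full : ∀ {N} → Sub N
full = sub (λ _ → ⊤) (λ _ → yes tt)

∁ : ∀ {N} → Sub N → Sub N
∁ A = sub (_∉ A) (λ x → ¬? (dec A x))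

_∩_ _∪_ : ∀ {N} → Sub N → Sub N → Sub N
A ∩ B = sub (λ x → x ∈ A × x ∈ B) (λ x → dec A x ×-dec dec B x)
A ∪ B = sub (λ x → x ∈ A ⊎ x ∈ B) (λ x → dec A x ⊎-dec dec B x)

_∖_ : ∀ {N} → Sub N → List (Fin N) → Sub N
A ∖ l = sub (λ x → x ∈ A × All (x ≢_) l) (λ x → dec A x ×-dec All.all? (λ y → ¬? (x Fin.≟ y)) l)

single : ∀ {N} → Fin N → Sub N
single y = sub (_≡ y) (Fin._≟ y)

indicator : Bool → ℕ
indicator true  = 1
indicator false = 0

count : ∀ {N} → (Fin N → Bool) → ℕ
count {zero}  p = 0
count {suc N} p = indicator (p zero) + count (p ∘ suc)

infix 8 #_

opaque

  -- Opaque, so that a cardinality stays an atom for the linear arithmetic and never unfolds into a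
  -- sum.
  #_ : ∀ {N} → Sub N → ℕ
  # A = count (does ∘ dec A)

-- Every inequality between cardinalities used below is an inequality between sums of indicators
-- that holds point by point.
count-+ : ∀ {N} (p q r s : Fin N → Bool) →
  (∀ x → indicator (p x) + indicator (q x) ≤ indicator (r x) + indicator (s x)) →
  count p + count q ≤ count r + count s
count-+ {zero}  p q r s h = z≤n
count-+ {suc N} p q r s h =
  (≮⇒≥ λ neg → refute (indicator (p zero) ∷ indicator (q zero) ∷ indicator (r zero) ∷ indicator (s zero) ∷
    count (p ∘ suc) ∷ count (q ∘ suc) ∷ count (r ∘ suc) ∷ count (s ∘ suc) ∷ [])
      (1 · var 0 ⊕ var 1 ≼ var 2 ⊕ var 3 ∷ 1 · var 4 ⊕ var 5 ≼ var 6 ⊕ var 7 ∷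
        1 · lit 1 ⊕ (var 2 ⊕ var 6 ⊕ (var 3 ⊕ var 7)) ≼ var 0 ⊕ var 4 ⊕ (var 1 ⊕ var 5) ∷ [])
      (h zero) (count-+ (p ∘ suc) (q ∘ suc) (r ∘ suc) (s ∘ suc) (h ∘ suc)) neg)

count-false : ∀ {N} → count {N} (λ _ → false) ≡ 0
count-false {zero}  = refl
count-false {suc N} = count-false {N}

count-true : ∀ {N} → count {N} (λ _ → true) ≡ N
count-true {zero}  = refl
count-true {suc N} = cong suc (count-true {N})

module _ {N : ℕ} where

  opaque
    unfolding #_

    #-full : # full {N} ≡ N
    #-full = count-true

    #-mono : (A B : Sub N) → (∀ x → x ∈ A → x ∈ B) → # A ≤ # B
    #-mono A B A⊆B = subst₂ _≤_ (+-identityʳ _) (+-identityʳ _)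
      (subst (λ e → # A + e ≤ # B + e) (count-false {N})
        (count-+ (does ∘ dec A) (λ _ → false) (does ∘ dec B) (λ _ → false) pointwise))
      where
      pointwise : ∀ x → indicator (does (dec A x)) + 0 ≤ indicator (does (dec B x)) + 0
      pointwise x with dec A x | dec B x
      ... | yes _ | yes _ = ≤-refl
      ... | yes a | no ¬b = contradiction (A⊆B x a) ¬b
      ... | no _  | yes _ = z≤n
      ... | no _  | no _  = z≤n

    #-∩-∪ : (A B : Sub N) → # A + # B ≤ # (A ∩ B) + # (A ∪ B)
    #-∩-∪ A B = count-+ (does ∘ dec A) (does ∘ dec B) (does ∘ dec (A ∩ B)) (does ∘ dec (A ∪ B)) pointwise
      where
      pointwise : ∀ x → indicator (does (dec A x)) + indicator (does (dec B x)) ≤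
                        indicator (does (dec (A ∩ B) x)) + indicator (does (dec (A ∪ B) x))
      pointwise x with does (dec A x) | does (dec B x)
      ... | true  | true  = ≤-refl
      ... | true  | false = ≤-refl
      ... | false | true  = ≤-refl
      ... | false | false = ≤-refl

    #-∪-∩ : (A B : Sub N) → # (A ∩ B) + # (A ∪ B) ≤ # A + # B
    #-∪-∩ A B = count-+ (does ∘ dec (A ∩ B)) (does ∘ dec (A ∪ B)) (does ∘ dec A) (does ∘ dec B) pointwise
      where
      pointwise : ∀ x → indicator (does (dec (A ∩ B) x)) + indicator (does (dec (A ∪ B) x)) ≤
                        indicator (does (dec A x)) + indicator (does (dec B x))
      pointwise x with does (dec A x) | does (dec B x)
      ... | true  | true  = ≤-refl
      ... | true  | false = ≤-refl
      ... | false | true  = ≤-refl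
      ... | false | false = ≤-refl

    #-empty : (A : Sub N) → (∀ x → x ∉ A) → # A ≡ 0
    #-empty A A⊆∅ = n≤0⇒n≡0 (subst (# A ≤_) (count-false {N})
      (#-mono A (sub (λ _ → ⊥) (λ _ → no id)) (λ x x∈A → A⊆∅ x x∈A)))

  #-∩-∁ : (A B : Sub N) → # A ≡ # (A ∩ B) + # (A ∩ ∁ B)
  #-∩-∁ A B = ≤-antisym A≤ ≤A
    where
    A≤ : # A ≤ # (A ∩ B) + # (A ∩ ∁ B)
    A≤ = ≮⇒≥ λ neg → refute (# A ∷ # (A ∩ B) ∷ # (A ∩ ∁ B) ∷ # ((A ∩ B) ∩ (A ∩ ∁ B)) ∷
      # ((A ∩ B) ∪ (A ∩ ∁ B)) ∷ [])
        (1 · var 3 ⊕ var 4 ≼ var 1 ⊕ var 2 ∷ 1 · var 0 ≼ var 4 ∷ 1 · lit 1 ⊕ (var 1 ⊕ var 2) ≼ var 0 ∷ [])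
        (#-∪-∩ (A ∩ B) (A ∩ ∁ B)) (#-mono A ((A ∩ B) ∪ (A ∩ ∁ B)) split) neg
      where
      split : ∀ x → x ∈ A → x ∈ A ∩ B ∪ A ∩ ∁ B
      split x x∈A with dec B x
      ... | yes x∈B = inj₁ (x∈A , x∈B)
      ... | no  x∉B = inj₂ (x∈A , x∉B)
    ≤A : # (A ∩ B) + # (A ∩ ∁ B) ≤ # A
    ≤A = ≮⇒≥ λ neg → refute (# A ∷ # (A ∩ B) ∷ # (A ∩ ∁ B) ∷ # ((A ∩ B) ∩ (A ∩ ∁ B)) ∷
      # ((A ∩ B) ∪ (A ∩ ∁ B)) ∷ [])
        (1 · var 1 ⊕ var 2 ≼ var 3 ⊕ var 4 ∷ 1 · var 3 ≼ lit 0 ∷ 1 · var 4 ≼ var 0 ∷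
          1 · lit 1 ⊕ var 0 ≼ var 1 ⊕ var 2 ∷ [])
        (#-∩-∪ (A ∩ B) (A ∩ ∁ B)) (≤-reflexive (#-empty ((A ∩ B) ∩ (A ∩ ∁ B))
          (λ x p → proj₂ (proj₂ p) (proj₂ (proj₁ p))))) (#-mono ((A ∩ B) ∪ (A ∩ ∁ B)) A join) neg
      where
      join : ∀ x → x ∈ A ∩ B ∪ A ∩ ∁ B → x ∈ A
      join x (inj₁ p) = proj₁ p
      join x (inj₂ p) = proj₁ p

  #-∁ : (A : Sub N) → N ≡ # A + # (∁ A)
  #-∁ A = trans (sym #-full) (trans (#-∩-∁ full A)
    (cong₂ _+_ (≤-antisym (#-mono (full ∩ A) A λ _ → proj₂) (#-mono A (full ∩ A) λ _ → tt ,_))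
               (≤-antisym (#-mono (full ∩ ∁ A) (∁ A) λ _ → proj₂) (#-mono (∁ A) (full ∩ ∁ A) λ _ → tt ,_))))

  #-disjoint : (A B C : Sub N) → (∀ x → x ∈ A → x ∈ C) → (∀ x → x ∈ B → x ∈ C) → (∀ x → x ∈ A → x ∉ B) →
    # A + # B ≤ # C
  #-disjoint A B C A⊆C B⊆C disjoint =
    (≮⇒≥ λ neg → refute (# A ∷ # B ∷ # C ∷ # (C ∩ A) ∷ # (C ∩ ∁ A) ∷ [])
        (1 · var 3 ⊕ var 4 ≼ var 2 ∷ 1 · var 0 ≼ var 3 ∷ 1 · var 1 ≼ var 4 ∷
          1 · lit 1 ⊕ var 2 ≼ var 0 ⊕ var 1 ∷ [])
        (≤-reflexive (sym (#-∩-∁ C A))) (#-mono A (C ∩ A) (λ x a → A⊆C x a , a))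
          (#-mono B (C ∩ ∁ A) (λ x b → B⊆C x b , λ a → disjoint x a b)) neg)

  #-∩ : (A B C : Sub N) → (∀ x → x ∈ A → x ∈ C) → (∀ x → x ∈ B → x ∈ C) → # A + # B ≤ # C + # (A ∩ B)
  #-∩ A B C A⊆C B⊆C =
    (≮⇒≥ λ neg → refute (# A ∷ # B ∷ # C ∷ # (A ∩ B) ∷ # (A ∪ B) ∷ [])
        (1 · var 0 ⊕ var 1 ≼ var 3 ⊕ var 4 ∷ 1 · var 4 ≼ var 2 ∷ 1 · lit 1 ⊕ (var 2 ⊕ var 3) ≼ var 0 ⊕ var 1 ∷
          [])
        (#-∩-∪ A B) (#-mono (A ∪ B) C either) neg)
    where
    either : ∀ x → x ∈ A ∪ B → x ∈ C
    either x (inj₁ a) = A⊆C x a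
    either x (inj₂ b) = B⊆C x b

  #-cover : (A B C : Sub N) → (∀ x → x ∈ C → x ∈ A ⊎ x ∈ B) → # C ≤ # A + # B
  #-cover A B C C⊆ =
    (≮⇒≥ λ neg → refute (# A ∷ # B ∷ # C ∷ # (A ∩ B) ∷ # (A ∪ B) ∷ [])
        (1 · var 3 ⊕ var 4 ≼ var 0 ⊕ var 1 ∷ 1 · var 2 ≼ var 4 ∷ 1 · lit 1 ⊕ (var 0 ⊕ var 1) ≼ var 2 ∷ [])
        (#-∪-∩ A B) (#-mono C (A ∪ B) C⊆) neg)

  opaque
    unfolding #_

    #-single : (x : Fin N) → # (single x) ≡ 1
    #-single x = count-single x
      where
      count-single : ∀ {M} (x : Fin M) → # (single x) ≡ 1
      count-single {suc M} zero    = cong suc (count-false {M})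
      count-single {suc M} (suc x) = count-single x

  #-∖ : (A : Sub N) (l : List (Fin N)) → # A ≤ # (A ∖ l) + length l
  #-∖ A []      = ≮⇒≥ λ neg → refute (# A ∷ # (A ∖ []) ∷ [])
      (1 · var 0 ≼ var 1 ∷ 1 · lit 1 ⊕ (var 1 ⊕ lit 0) ≼ var 0 ∷ [])
      (#-mono A (A ∖ []) (λ _ a → a , [])) neg
  #-∖ A (y ∷ l) =
    (≮⇒≥ λ neg → refute (# A ∷ # (A ∖ l) ∷ # (A ∖ (y ∷ l)) ∷ # (single y) ∷ length l ∷ [])
        (1 · var 0 ≼ var 1 ⊕ var 4 ∷ 1 · var 3 ≼ lit 1 ∷ 1 · var 1 ≼ var 3 ⊕ var 2 ∷
          1 · lit 1 ⊕ (var 2 ⊕ (lit 1 ⊕ var 4)) ≼ var 0 ∷ [])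
        (#-∖ A l) (≤-reflexive (#-single y)) (#-cover (single y) (A ∖ (y ∷ l)) (A ∖ l) either) neg)
    where
    either : ∀ x → x ∈ A ∖ l → x ∈ single y ⊎ x ∈ A ∖ (y ∷ l)
    either x (a , x∉l) with x Fin.≟ y
    ... | yes x≡y = inj₁ x≡y
    ... | no  x≢y = inj₂ (a , x≢y ∷ x∉l)

  opaque

    nonempty : (A : Sub N) → 1 ≤ # A → ∃ (_∈ A)
    nonempty A 1≤ with Fin.any? (dec A)
    ... | yes p = p
    ... | no ¬p = contradiction (#-empty A (λ x x∈A → ¬p (x , x∈A))) (λ eq → 1+n≰n (subst (1 ≤_) eq 1≤))

    pick : (A : Sub N) (l : List (Fin N)) → suc (length l) ≤ # A → ∃ λ x → x ∈ A × All (x ≢_) l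
    pick A l l<A = nonempty (A ∖ l)
      (≮⇒≥ λ neg → refute (# A ∷ # (A ∖ l) ∷ length l ∷ [])
          (1 · lit 1 ⊕ var 2 ≼ var 0 ∷ 1 · var 0 ≼ var 1 ⊕ var 2 ∷ 1 · lit 1 ⊕ var 1 ≼ lit 1 ∷ [])
          l<A (#-∖ A l) neg)

    #-unique : (A : Sub N) (l : List (Fin N)) → Unique l → All (_∈ A) l → length l ≤ # A
    #-unique A []      _            _           = z≤n
    #-unique A (x ∷ l) (x∉l ∷ uniq) (x∈A ∷ l⊆A) =
      (≮⇒≥ λ neg → refute (# A ∷ # (single x) ∷ # (A ∖ (x ∷ [])) ∷ length l ∷ [])
          (1 · var 3 ≼ var 2 ∷ 1 · lit 1 ≼ var 1 ∷ 1 · var 1 ⊕ var 2 ≼ var 0 ∷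
            1 · lit 1 ⊕ var 0 ≼ lit 1 ⊕ var 3 ∷ [])
          (#-unique (A ∖ (x ∷ [])) l uniq (All.zipWith (λ (x≢y , y∈A) → y∈A , ≢-sym x≢y ∷ []) (x∉l , l⊆A)))
            (≤-reflexive (sym (#-single x))) (#-disjoint (single x) (A ∖ (x ∷ [])) A (λ { _ refl → x∈A })
            (λ _ → proj₁) (λ { _ refl (_ , x≢x ∷ []) → x≢x refl })) neg)

    choose : (A : Sub N) (k : ℕ) → k ≤ # A → ∃ λ l → length l ≡ k × Unique l × All (_∈ A) l
    choose A zero    _ = [] , refl , [] , []
    choose A (suc k) k<A with choose A k (≤-trans (n≤1+n k) k<A)
    ... | l , refl , uniq , l⊆A with pick A l k<A
    ... | x , x∈A , x∉l = x ∷ l , refl , x∉l ∷ uniq , x∈A ∷ l⊆A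

    argmax : (w : Fin N → ℕ) (A : Sub N) → 1 ≤ # A → ∃ λ x → x ∈ A × (∀ y → y ∈ A → w y ≤ w x)
    argmax w A 1≤A with nonempty A 1≤A
    ... | x₀ , x₀∈A = climb bound x₀ x₀∈A (m≤m+n bound (w x₀))
      where
      total : ∀ {M} → (Fin M → ℕ) → ℕ
      total {zero}  f = 0
      total {suc M} f = f zero + total (f ∘ suc)
      ≤total : ∀ {M} (f : Fin M → ℕ) x → f x ≤ total f
      ≤total f zero    = m≤m+n _ _
      ≤total f (suc x) = ≤-trans (≤total (f ∘ suc) x) (m≤n+m _ _)
      bound : ℕ
      bound = total w
      below : ∀ x → w x ≤ bound
      below = ≤total w
      climb : ∀ fuel x → x ∈ A → bound ≤ fuel + w x → ∃ λ x → x ∈ A × (∀ y → y ∈ A → w y ≤ w x)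
      -- The invariant `bound ≤ fuel + w x` survives because each step upwards gains at least one;
      -- at fuel 0 the weight cannot grow any more.
      climb fuel x x∈A h with Fin.any? (λ y → dec A y ×-dec (w x <? w y))
      ... | no ¬p = x , x∈A , λ y y∈A → ≮⇒≥ λ lt → ¬p (y , y∈A , lt)
      climb zero       x x∈A h | yes (y , y∈A , lt) = contradiction (≤-trans (≤-trans lt (below y)) h) 1+n≰n
      climb (suc fuel) x x∈A h | yes (y , y∈A , lt) = climb fuel y y∈A
        (≮⇒≥ λ neg → refute (bound ∷ fuel ∷ w x ∷ w y ∷ [])
            (1 · var 0 ≼ lit 1 ⊕ var 1 ⊕ var 2 ∷ 1 · lit 1 ⊕ var 2 ≼ var 3 ∷
              1 · lit 1 ⊕ (var 1 ⊕ var 3) ≼ var 0 ∷ [])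
            h lt neg)

-- Copies of wheels and spiders

module _ {k n : ℕ} (G : Graph k) (F : Graph n) where

  any-Vec? : ∀ k {P : Vec.Vec (Fin n) k → Set} → (∀ v → Dec (P v)) → Dec (∃ P)
  any-Vec? zero    P? = map′ (Vec.[] ,_) (λ { (Vec.[] , p) → p }) (P? Vec.[])
  any-Vec? (suc k) P? = map′ (λ (x , v , p) → x Vec.∷ v , p) (λ { (x Vec.∷ v , p) → x , v , p })
    (Fin.any? λ x → any-Vec? k λ v → P? (x Vec.∷ v))

  -- Embeddings are searched for as vectors of values. Decidability is what permits the upper bound
  -- to be proved by contradiction.
  ⊆-dec : Dec (G ⊆ F)
  ⊆-dec = map′ (λ (v , inj , hom) → Vec.lookup v , (λ {x} {y} → inj x y) , hom)
               (λ (f , inj , hom) → Vec.tabulate f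
                 , (λ x y eq → inj (trans (sym (lookup∘tabulate f x)) (trans eq (lookup∘tabulate f y))))
                 , (λ u v e → subst₂ (λ a b → T (adj F a b)) (sym (lookup∘tabulate f u))
                   (sym (lookup∘tabulate f v)) (hom u v e)))
    (any-Vec? k λ v →
      Fin.all? (λ x → Fin.all? λ y → (Vec.lookup v x Fin.≟ Vec.lookup v y) →-dec (x Fin.≟ y)) ×-dec
      Fin.all? (λ x → Fin.all? λ y → T? (adj G x y) →-dec T? (adj F (Vec.lookup v x) (Vec.lookup v y))))

fromEdges-hom : ∀ {k n} (E : ℕ → ℕ → Bool) (F : Graph n) (f : Fin k → Fin n) →
  (∀ u v → T (E (toℕ u) (toℕ v)) → T (adj F (f u) (f v))) →
  ∀ u v → T (adj (fromEdges k E) u v) → T (adj F (f u) (f v))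
fromEdges-hom E F f hom u v e with Equivalence.to T-∨ (proj₂ (Equivalence.to T-∧ e))
... | inj₁ uv = hom u v uv
... | inj₂ vu = subst T (adj-sym F (f v) (f u)) (hom v u vu)

wheel-edges : List (Fin 9 × Fin 9)
wheel-edges =
  (0F , 1F) ∷ (0F , 2F) ∷ (0F , 3F) ∷ (0F , 4F) ∷ (0F , 5F) ∷ (0F , 6F) ∷ (0F , 7F) ∷ (0F , 8F) ∷
  (1F , 2F) ∷ (2F , 3F) ∷ (3F , 4F) ∷ (4F , 5F) ∷ (5F , 6F) ∷ (6F , 7F) ∷ (7F , 8F) ∷ (1F , 8F) ∷ []

-- Holds by evaluation of all 81 pairs; it reduces an embedding of the wheel to sixteen listed
-- facts.
wheel-edges-complete : ∀ u v → T (wheelEdges (toℕ u) (toℕ v)) → (u , v) ∈ˡ wheel-edges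
wheel-edges-complete = from-yes (Fin.all? λ u → Fin.all? λ v →
  T? (wheelEdges (toℕ u) (toℕ v)) →-dec any? ((u , v) ≟×_) wheel-edges)
  where _≟×_ = ≡-dec Fin._≟_ Fin._≟_

lookup-injective : ∀ {A : Set} {l : List A} → Unique l → Injective _≡_ _≡_ (lookup l)
lookup-injective (x∉l ∷ uniq) {zero}  {zero}  eq = refl
lookup-injective (x∉l ∷ uniq) {zero}  {suc j} eq = contradiction eq (All.lookup x∉l (Membership.∈-lookup j))
lookup-injective (x∉l ∷ uniq) {suc i} {zero}  eq = contradiction (sym eq)
  (All.lookup x∉l (Membership.∈-lookup i))
lookup-injective (x∉l ∷ uniq) {suc i} {suc j} eq = cong suc (lookup-injective uniq eq)

wheel-⊆ : ∀ {N} (H : Graph N) h c₁ c₂ c₃ c₄ c₅ c₆ c₇ c₈ → let c = c₁ ∷ c₂ ∷ c₃ ∷ c₄ ∷ c₅ ∷ c₆ ∷ c₇ ∷ c₈ ∷ [] in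
  Unique c → All (T ∘ adj H h) c →
  T (adj H c₁ c₂) → T (adj H c₂ c₃) → T (adj H c₃ c₄) → T (adj H c₄ c₅) →
  T (adj H c₅ c₆) → T (adj H c₆ c₇) → T (adj H c₇ c₈) → T (adj H c₁ c₈) → W8 ⊆ H
wheel-⊆ H h c₁ c₂ c₃ c₄ c₅ c₆ c₇ c₈ uniq spokes@(s₁ ∷ s₂ ∷ s₃ ∷ s₄ ∷ s₅ ∷ s₆ ∷ s₇ ∷ s₈ ∷ []) r₁ r₂ r₃ r₄ r₅ r₆
  r₇ r₈ =
  f , lookup-injective (All.map spoke≢ spokes ∷ uniq) ,
  fromEdges-hom wheelEdges H f λ u v e → All.lookup edges (wheel-edges-complete u v e)
  where
  f = lookup (h ∷ c₁ ∷ c₂ ∷ c₃ ∷ c₄ ∷ c₅ ∷ c₆ ∷ c₇ ∷ c₈ ∷ [])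
  spoke≢ : ∀ {x} → T (adj H h x) → h ≢ x
  spoke≢ hx refl = subst T (irrefl H h) hx
  edges : All (λ (u , v) → T (adj H (f u) (f v))) wheel-edges
  edges = s₁ ∷ s₂ ∷ s₃ ∷ s₄ ∷ s₅ ∷ s₆ ∷ s₇ ∷ s₈ ∷ r₁ ∷ r₂ ∷ r₃ ∷ r₄ ∷ r₅ ∷ r₆ ∷ r₇ ∷ r₈ ∷ []

-- Indexed by plain naturals to match the vertex numbers in `spiderEdges`; the default only makes
-- the function total.
at : ∀ {A : Set} → A → List A → ℕ → A
at d []      _       = d
at d (x ∷ l) zero    = x
at d (x ∷ l) (suc i) = at d l i

at-++ : ∀ {A : Set} (d : A) l r k → at d (l ++ r) (length l + k) ≡ at d r k
at-++ d []      r k = refl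
at-++ d (_ ∷ l) r k = at-++ d l r k

at-All : ∀ {A : Set} {P : A → Set} (d : A) l r → All P l → ∀ i → i < length l → P (at d (l ++ r) i)
at-All d (_ ∷ l) r (p ∷ ps) zero    _         = p
at-All d (_ ∷ l) r (p ∷ ps) (suc i) (s≤s i<l) = at-All d l r ps i i<l

at-∈ : ∀ {A : Set} (d : A) l i → i < length l → at d l i ∈ˡ l
at-∈ d (_ ∷ l) zero    _         = Any.here refl
at-∈ d (_ ∷ l) (suc i) (s≤s i<l) = Any.there (at-∈ d l i i<l)

at-injective : ∀ {A : Set} (d : A) l → Unique l → ∀ i j → i < length l → j < length l → at d l i ≡ at d l j →
  i ≡ j
at-injective d (_ ∷ l) _            zero    zero    _         _         eq = refl
at-injective d (_ ∷ l) (x∉l ∷ _)    zero    (suc j) _         (s≤s j<l) eq = contradiction eq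
  (All.lookup x∉l (at-∈ d l j j<l))
at-injective d (_ ∷ l) (x∉l ∷ _)    (suc i) zero    (s≤s i<l) _         eq = contradiction (sym eq)
  (All.lookup x∉l (at-∈ d l i i<l))
at-injective d (_ ∷ l) (_   ∷ uniq) (suc i) (suc j) (s≤s i<l) (s≤s j<l) eq = cong suc
  (at-injective d l uniq i j i<l j<l eq)

-- The list `c ∷ l ++ legs` follows the numbering of `spiderEdges` for n = 7 + m, where all
-- truncated subtractions compute: the centre at 0, the leaves at 1 to m, the legs from 1 + m on.
spider-⊆ : ∀ {N} m (F : Graph N) c l γ₁ z₁ y₁ γ₂ z₂ y₂ → let legs = γ₁ ∷ z₁ ∷ y₁ ∷ γ₂ ∷ z₂ ∷ y₂ ∷ [] in
  length l ≡ m → Unique (c ∷ l ++ legs) → All (T ∘ adj F c) l →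
  T (adj F c γ₁) → T (adj F γ₁ z₁) → T (adj F z₁ y₁) →
  T (adj F c γ₂) → T (adj F γ₂ z₂) → T (adj F z₂ y₂) → S22 (7 + m) ⊆ F
spider-⊆ m F c l γ₁ z₁ y₁ γ₂ z₂ y₂ refl uniq leaves e₁ e₂ e₃ e₄ e₅ e₆ =
  f , (λ {x} {y} eq → Fin.toℕ-injective (at-injective c (c ∷ l ++ legs) uniq (toℕ x) (toℕ y) (bound x)
    (bound y) eq)) ,
  fromEdges-hom (spiderEdges (7 + m)) F f hom
  where
  legs = γ₁ ∷ z₁ ∷ y₁ ∷ γ₂ ∷ z₂ ∷ y₂ ∷ []
  pos : ℕ → _
  pos = at c (c ∷ l ++ legs)
  f : Fin (7 + m) → _
  f i = pos (toℕ i)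
  bound : (i : Fin (7 + m)) → toℕ i < length (c ∷ l ++ legs)
  bound i = subst (toℕ i <_) (trans (+-comm 7 m) (trans (+-suc m 6) (cong suc (sym (length-++ l)))))
    (Fin.toℕ<n i)
  leg : ∀ k → pos (suc k + m) ≡ at c legs k
  leg k = trans (cong (at c (l ++ legs)) (+-comm k m)) (at-++ c l legs k)
  edge : ∀ i j {x y} → pos i ≡ x → pos j ≡ y → T (adj F x y) → T (adj F (pos i) (pos j))
  edge i j refl refl e = e
  case-∧ : ∀ u v i j → T (adj F (pos i) (pos j)) → T ((u ≡ᵇ i) ∧ (v ≡ᵇ j)) → T (adj F (pos u) (pos v))
  case-∧ u v i j ij h with Equivalence.to T-∧ h
  ... | u≡i , v≡j = subst₂ (λ a b → T (adj F (pos a) (pos b))) (sym (≡ᵇ⇒≡ u i u≡i)) (sym (≡ᵇ⇒≡ v j v≡j)) ij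
  case-∨ : ∀ u v i j {b} → T (adj F (pos i) (pos j)) → (T b → T (adj F (pos u) (pos v))) →
    T ((u ≡ᵇ i) ∧ (v ≡ᵇ j) ∨ b) → T (adj F (pos u) (pos v))
  case-∨ u v i j ij rest h with Equivalence.to (T-∨ {(u ≡ᵇ i) ∧ (v ≡ᵇ j)}) h
  ... | inj₁ uv = case-∧ u v i j ij uv
  ... | inj₂ b  = rest b
  case-leaf : ∀ u v {b} → (T b → T (adj F (pos u) (pos v))) →
    T ((u ≡ᵇ 0) ∧ (1 ≤ᵇ v) ∧ (v ≤ᵇ m) ∨ b) → T (adj F (pos u) (pos v))
  case-leaf zero    (suc v) rest h with Equivalence.to (T-∨ {suc v ≤ᵇ m}) h
  ... | inj₁ leaf = at-All c l legs leaves v (≤ᵇ⇒≤ (suc v) m leaf)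
  ... | inj₂ b    = rest b
  case-leaf zero    zero    rest h = rest h
  case-leaf (suc u) v       rest h = rest h
  hom : ∀ u v → T (spiderEdges (7 + m) (toℕ u) (toℕ v)) → T (adj F (f u) (f v))
  hom i j = case-leaf u v (case-∨ u v 0 (1 + m) (edge 0 (1 + m) refl (leg 0) e₁)
    (case-∨ u v (1 + m) (2 + m) (edge (1 + m) (2 + m) (leg 0) (leg 1) e₂)
    (case-∨ u v (2 + m) (3 + m) (edge (2 + m) (3 + m) (leg 1) (leg 2) e₃)
    (case-∨ u v 0 (4 + m) (edge 0 (4 + m) refl (leg 3) e₄)
    (case-∨ u v (4 + m) (5 + m) (edge (4 + m) (5 + m) (leg 3) (leg 4) e₅)
    (case-∧ u v (5 + m) (6 + m) (edge (5 + m) (6 + m) (leg 4) (leg 5) e₆)))))))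
    where u = toℕ i ; v = toℕ j

-- Wheels in the complement

elements : ∀ {N} → List (Fin N) → Sub N
elements l = sub (_∈ˡ l) (λ x → any? (x Fin.≟_) l)

≢-all : ∀ {N} {x : Fin N} {l} → ¬ x ∈ˡ l → All (x ≢_) l
≢-all {l = []}    _   = []
≢-all {l = y ∷ l} x∉l = (λ eq → x∉l (Any.here eq)) ∷ ≢-all (x∉l ∘ Any.there)

T-not⁺ : ∀ {a} → ¬ T a → T (not a)
T-not⁺ {true}  h = h tt
T-not⁺ {false} h = tt

T-not⁻ : ∀ {a} → T (not a) → ¬ T a
T-not⁻ {false} _ ()

-- G and B are adjacency in F and in its complement.
module Coloured {N : ℕ} (F : Graph N) where

  record G (u v : Fin N) : Set where
    constructor mkG
    field unG : T (adj F u v)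
  open G public

  record B (u v : Fin N) : Set where
    constructor mkB
    field unB : T (adj (complement F) u v)
  open B public

  g b : Fin N → Sub N
  g u = sub (G u) (λ x → map′ mkG unG (T? (adj F u x)))
  b u = sub (B u) (λ x → map′ mkB unB (T? (adj (complement F) u x)))

  opaque

    G-sym : ∀ {u x} → G u x → G x u
    G-sym {u} {x} (mkG e) = mkG (subst T (adj-sym F u x) e)

    B-sym : ∀ {u x} → B u x → B x u
    B-sym {u} {x} (mkB e) = mkB (subst T (adj-sym (complement F) u x) e)

    G-≢ : ∀ {u x} → G u x → u ≢ x
    G-≢ {u} (mkG e) refl = subst T (irrefl F u) e

    B-≢ : ∀ {u x} → B u x → u ≢ x
    B-≢ {u} (mkB e) refl = subst T (irrefl (complement F) u) e

    B⇒¬G : ∀ {u x} → B u x → ¬ G u x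
    B⇒¬G {u} {x} (mkB e) (mkG f) = T-not⁻ (proj₂ (Equivalence.to (T-∧ {not (toℕ u ≡ᵇ toℕ x)}) e)) f

    ¬G⇒B : ∀ {u x} → u ≢ x → ¬ G u x → B u x
    ¬G⇒B {u} {x} u≢x ¬Gux = mkB (Equivalence.from T-∧
      (T-not⁺ (u≢x ∘ Fin.toℕ-injective ∘ ≡ᵇ⇒≡ (toℕ u) (toℕ x)) , T-not⁺ (¬Gux ∘ mkG)))

    ¬B⇒G : ∀ {u x} → u ≢ x → ¬ B u x → G u x
    ¬B⇒G {u} {x} u≢x ¬Bux = decidable-stable (dec (g u) x) (λ ¬Gux → ¬Bux (¬G⇒B u≢x ¬Gux))

    #-split : (A : Sub N) (u : Fin N) → u ∉ A → # A ≡ # (A ∩ g u) + # (A ∩ b u)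
    #-split A u u∉A = trans (#-∩-∁ A (g u)) (cong (# (A ∩ g u) +_) (≤-antisym
      (#-mono (A ∩ ∁ (g u)) (A ∩ b u) λ x (x∈A , ¬Gux) → x∈A , ¬G⇒B (λ { refl → u∉A x∈A }) ¬Gux)
      (#-mono (A ∩ b u) (A ∩ ∁ (g u)) λ x (x∈A , Bux) → x∈A , B⇒¬G Bux)))

    #-split-∈ : (A : Sub N) (u : Fin N) → # A ≤ suc (# (A ∩ g u) + # (A ∩ b u))
    #-split-∈ A u = ≮⇒≥ λ neg → refute (# A ∷ # (A ∖ (u ∷ [])) ∷ # ((A ∖ (u ∷ [])) ∩ g u) ∷
      # ((A ∖ (u ∷ [])) ∩ b u) ∷ # (A ∩ g u) ∷ # (A ∩ b u) ∷ [])
        (1 · var 0 ≼ var 1 ⊕ lit 1 ∷ 1 · var 1 ≼ var 2 ⊕ var 3 ∷ 1 · var 2 ≼ var 4 ∷ 1 · var 3 ≼ var 5 ∷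
          1 · lit 1 ⊕ (lit 1 ⊕ (var 4 ⊕ var 5)) ≼ var 0 ∷ [])
        (#-∖ A (u ∷ [])) (≤-reflexive (#-split (A ∖ (u ∷ [])) u (λ { (_ , u≢u ∷ []) → u≢u refl })))
          (#-mono ((A ∖ (u ∷ [])) ∩ g u) (A ∩ g u) (λ _ ((a , _) , e) → a , e))
          (#-mono ((A ∖ (u ∷ [])) ∩ b u) (A ∩ b u) (λ _ ((a , _) , e) → a , e)) neg

    #-degrees : (u : Fin N) → N ≡ suc (# (g u) + # (b u))
    #-degrees u = trans (#-∁ (single u)) (cong₂ _+_ (#-single u)
      (trans (#-split (∁ (single u)) u (λ u≢u → u≢u refl))
      (cong₂ _+_ (≤-antisym (#-mono (∁ (single u) ∩ g u) (g u) λ _ → proj₂)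
                            (#-mono (g u) (∁ (single u) ∩ g u) λ x Gux → (λ { refl → G-≢ Gux refl }) , Gux))
                 (≤-antisym (#-mono (∁ (single u) ∩ b u) (b u) λ _ → proj₂)
                            (#-mono (b u) (∁ (single u) ∩ b u) λ x Bux → (λ { refl → B-≢ Bux refl }) ,
                              Bux)))))

  -- The candidates for a rim vertex between x and y in a wheel with hub h.
  link : Sub N → Fin N → Fin N → Fin N → Sub N
  link S h x y = ∁ S ∩ b h ∩ b x ∩ b y

module Wheelless {N : ℕ} (F : Graph N) (noWheel : ¬ (W8 ⊆ complement F)) where

  open Coloured F

  opaque

    no-wheel : ∀ h c₁ c₂ c₃ c₄ c₅ c₆ c₇ c₈ → let c = c₁ ∷ c₂ ∷ c₃ ∷ c₄ ∷ c₅ ∷ c₆ ∷ c₇ ∷ c₈ ∷ [] in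
      Unique c → All (B h) c → B c₁ c₂ → B c₂ c₃ → B c₃ c₄ → B c₄ c₅ → B c₅ c₆ → B c₆ c₇ → B c₇ c₈ → B c₁ c₈ →
        ⊥
    no-wheel h c₁ c₂ c₃ c₄ c₅ c₆ c₇ c₈ uniq spokes r₁ r₂ r₃ r₄ r₅ r₆ r₇ r₈ =
      noWheel (wheel-⊆ (complement F) h c₁ c₂ c₃ c₄ c₅ c₆ c₇ c₈ uniq (All.map unB spokes)
        (unB r₁) (unB r₂) (unB r₃) (unB r₄) (unB r₅) (unB r₆) (unB r₇) (unB r₈))

    -- The set S separates the two halves of the rim and thereby supplies the sixteen disequalities
    -- between them.
    no-alternating : (S : Sub N) (h x₁ x₂ x₃ x₄ y₁ y₂ y₃ y₄ : Fin N) →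
      let x = x₁ ∷ x₂ ∷ x₃ ∷ x₄ ∷ [] ; y = y₁ ∷ y₂ ∷ y₃ ∷ y₄ ∷ [] in
      Unique x → Unique y → All (_∈ S) x → All (_∉ S) y → All (B h) x → All (B h) y →
      B x₁ y₁ → B x₂ y₁ → B x₂ y₂ → B x₃ y₂ → B x₃ y₃ → B x₄ y₃ → B x₄ y₄ → B x₁ y₄ → ⊥
    no-alternating S h x₁ x₂ x₃ x₄ y₁ y₂ y₃ y₄
      ((x₁₂ ∷ x₁₃ ∷ x₁₄ ∷ []) ∷ (x₂₃ ∷ x₂₄ ∷ []) ∷ (x₃₄ ∷ []) ∷ [] ∷ [])
      ((y₁₂ ∷ y₁₃ ∷ y₁₄ ∷ []) ∷ (y₂₃ ∷ y₂₄ ∷ []) ∷ (y₃₄ ∷ []) ∷ [] ∷ [])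
      (∈₁ ∷ ∈₂ ∷ ∈₃ ∷ ∈₄ ∷ []) (∉₁ ∷ ∉₂ ∷ ∉₃ ∷ ∉₄ ∷ []) (s₁ ∷ s₂ ∷ s₃ ∷ s₄ ∷ []) (t₁ ∷ t₂ ∷ t₃ ∷ t₄ ∷ [])
      r₁₁ r₂₁ r₂₂ r₃₂ r₃₃ r₄₃ r₄₄ r₁₄ =
      no-wheel h x₁ y₁ x₂ y₂ x₃ y₃ x₄ y₄
        ((∈∉ ∈₁ ∉₁ ∷ x₁₂ ∷ ∈∉ ∈₁ ∉₂ ∷ x₁₃ ∷ ∈∉ ∈₁ ∉₃ ∷ x₁₄ ∷ ∈∉ ∈₁ ∉₄ ∷ []) ∷
         (≢-sym (∈∉ ∈₂ ∉₁) ∷ y₁₂ ∷ ≢-sym (∈∉ ∈₃ ∉₁) ∷ y₁₃ ∷ ≢-sym (∈∉ ∈₄ ∉₁) ∷ y₁₄ ∷ []) ∷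
         (∈∉ ∈₂ ∉₂ ∷ x₂₃ ∷ ∈∉ ∈₂ ∉₃ ∷ x₂₄ ∷ ∈∉ ∈₂ ∉₄ ∷ []) ∷
         (≢-sym (∈∉ ∈₃ ∉₂) ∷ y₂₃ ∷ ≢-sym (∈∉ ∈₄ ∉₂) ∷ y₂₄ ∷ []) ∷
         (∈∉ ∈₃ ∉₃ ∷ x₃₄ ∷ ∈∉ ∈₃ ∉₄ ∷ []) ∷ (≢-sym (∈∉ ∈₄ ∉₃) ∷ y₃₄ ∷ []) ∷ (∈∉ ∈₄ ∉₄ ∷ []) ∷ [] ∷ [])
        (s₁ ∷ t₁ ∷ s₂ ∷ t₂ ∷ s₃ ∷ t₃ ∷ s₄ ∷ t₄ ∷ [])
        r₁₁ (B-sym r₂₁) r₂₂ (B-sym r₃₂) r₃₃ (B-sym r₄₃) r₄₄ r₁₄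
      where
      ∈∉ : ∀ {x y} → x ∈ S → y ∉ S → x ≢ y
      ∈∉ x∈S y∉S refl = y∉S x∈S

    -- The rim vertices outside S are chosen greedily, in the order of the sizes of the links.
    no-links : (S : Sub N) (h x₁ x₂ x₃ x₄ : Fin N) → let x = x₁ ∷ x₂ ∷ x₃ ∷ x₄ ∷ [] in
      Unique x → All (_∈ S) x → All (B h) x →
      4 ≤ # link S h x₁ x₂ → 2 ≤ # link S h x₂ x₃ → 1 ≤ # link S h x₃ x₄ → 3 ≤ # link S h x₄ x₁ → ⊥
    no-links S h x₁ x₂ x₃ x₄ uniq ∈S spokes q₁₂ q₂₃ q₃₄ q₄₁
      with pick (link S h x₃ x₄) [] q₃₄
    ... | y₃ , (((∉₃ , t₃) , r₃₃) , r₄₃) , _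
      with pick (link S h x₂ x₃) (y₃ ∷ []) q₂₃
    ... | y₂ , (((∉₂ , t₂) , r₂₂) , r₃₂) , y₂₃ ∷ []
      with pick (link S h x₄ x₁) (y₂ ∷ y₃ ∷ []) q₄₁
    ... | y₄ , (((∉₄ , t₄) , r₄₄) , r₁₄) , y₄₂ ∷ y₄₃ ∷ []
      with pick (link S h x₁ x₂) (y₂ ∷ y₃ ∷ y₄ ∷ []) q₁₂
    ... | y₁ , (((∉₁ , t₁) , r₁₁) , r₂₁) , y₁₂ ∷ y₁₃ ∷ y₁₄ ∷ [] =
      no-alternating S h x₁ x₂ x₃ x₄ y₁ y₂ y₃ y₄ uniq
        ((y₁₂ ∷ y₁₃ ∷ y₁₄ ∷ []) ∷ (y₂₃ ∷ ≢-sym y₄₂ ∷ []) ∷ (≢-sym y₄₃ ∷ []) ∷ [] ∷ [])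
        ∈S (∉₁ ∷ ∉₂ ∷ ∉₃ ∷ ∉₄ ∷ []) spokes (t₁ ∷ t₂ ∷ t₃ ∷ t₄ ∷ []) r₁₁ r₂₁ r₂₂ r₃₂ r₃₃ r₄₃ r₄₄ r₁₄

-- R(C₄, K₃) ≤ 7.
no-C₄ : ∀ {N} (S : Sub N) (E : Fin N → Sub N) → (∀ {x y} → y ∈ E x → x ∈ E y) →
  (∀ {x y z} → x ∈ S → y ∈ S → z ∈ S → y ∈ E x ⊎ z ∈ E x ⊎ z ∈ E y) →
  (∀ x₁ x₂ x₃ x₄ → let x = x₁ ∷ x₂ ∷ x₃ ∷ x₄ ∷ [] in Unique x → All (_∈ S) x →
    x₂ ∈ E x₁ → x₃ ∈ E x₂ → x₄ ∈ E x₃ → x₁ ∈ E x₄ → ⊥) → # S < 7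
no-C₄ S E E-sym triple no-4-cycle = ≰⇒> λ 7≤S → start (nonempty S (≤-trans (s≤s z≤n) 7≤S)) 7≤S
  where
  module _ (x : Fin _) (x∈S : x ∈ S) where
    S′ = S ∖ (x ∷ [])
    Near = S′ ∩ E x
    Far = S′ ∩ ∁ (E x)

    -- Together with x an E-free pair would violate `triple`, so `Far` is a clique.
    far : ∀ {y z} → y ∈ Far → z ∈ Far → z ∈ E y
    far ((y∈ , _) , ¬y) ((z∈ , _) , ¬z) with triple x∈S y∈ z∈
    ... | inj₁ p = contradiction p ¬y
    ... | inj₂ (inj₁ p) = contradiction p ¬z
    ... | inj₂ (inj₂ p) = p

    four-far : ¬ 4 ≤ # Far
    four-far h with choose Far 4 h
    ... | a ∷ b ∷ c ∷ d ∷ [] , refl , uniq , fa@((a∈ , _) , _) ∷ fb@((b∈ , _) , _) ∷ fc@((c∈ , _) , _) ∷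
      fd@((d∈ , _) , _) ∷ [] =
      no-4-cycle a b c d uniq (a∈ ∷ b∈ ∷ c∈ ∷ d∈ ∷ []) (far fa fb) (far fb fc) (far fc fd) (far fd fa)

    -- Here x is the vertex of the 4-cycle opposite to p.
    two-common : ∀ {y z p} → y ∈ Near → z ∈ Near → p ∈ S → p ≢ x → p ≢ y → p ≢ z → y ≢ z → p ∈ E y → p ∈ E z →
      ⊥
    two-common ((y∈ , y≢x ∷ []) , xy) ((z∈ , z≢x ∷ []) , xz) p∈ p≢x p≢y p≢z y≢z yp zp =
      no-4-cycle x _ _ _
        ((≢-sym y≢x ∷ ≢-sym p≢x ∷ ≢-sym z≢x ∷ []) ∷ (≢-sym p≢y ∷ y≢z ∷ []) ∷ (p≢z ∷ []) ∷ [] ∷ [])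
        (x∈S ∷ y∈ ∷ p∈ ∷ z∈ ∷ []) xy yp (E-sym zp) (E-sym xz)

    near-matching : ∀ {y z w} → y ∈ Near → z ∈ Near → w ∈ Near → y ≢ z → w ≢ y → w ≢ z → z ∈ E y → w ∉ E y
    near-matching yn@((y∈ , y≢x ∷ []) , _) zn wn y≢z w≢y w≢z yz yw =
      two-common zn wn y∈ y≢x y≢z (≢-sym w≢y) (≢-sym w≢z) (E-sym yz) (E-sym yw)

    adjacent-pair : 3 ≤ # Near → ∃ λ a → ∃₂ λ b c → Unique (a ∷ b ∷ c ∷ []) × All (_∈ Near)
      (a ∷ b ∷ c ∷ []) × b ∈ E a
    adjacent-pair h with choose Near 3 h
    ... | a ∷ b ∷ c ∷ [] , refl , (ab ∷ ac ∷ []) ∷ (bc ∷ []) ∷ [] ∷ [] , na@((a∈ , _) , _) ∷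
      nb@((b∈ , _) , _) ∷ nc@((c∈ , _) , _) ∷ []
      with triple a∈ b∈ c∈
    ... | inj₁ e        = a , b , c , (ab ∷ ac ∷ []) ∷ (bc ∷ []) ∷ [] ∷ [] , na ∷ nb ∷ nc ∷ [] , e
    ... | inj₂ (inj₁ e) = a , c , b , (ac ∷ ab ∷ []) ∷ (≢-sym bc ∷ []) ∷ [] ∷ [] , na ∷ nc ∷ nb ∷ [] , e
    ... | inj₂ (inj₂ e) = b , c , a , (bc ∷ ≢-sym ab ∷ []) ∷ (≢-sym ac ∷ []) ∷ [] ∷ [] , nb ∷ nc ∷ na ∷ [] , e

    near-or : ∀ {a b c p} → a ∈ Near → b ∈ Near → c ∈ Near → a ≢ b → c ≢ a → c ≢ b → b ∈ E a → p ∈ S → p ∈ E a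
      ⊎ p ∈ E c
    near-or na nb nc a≢b c≢a c≢b ab p∈ with triple (proj₁ (proj₁ na)) (proj₁ (proj₁ nc)) p∈
    ... | inj₁ e = contradiction e (near-matching na nb nc a≢b c≢a c≢b ab)
    ... | inj₂ e = e

    -- Inside `Near` the edges form a matching. For an edge ab and two more vertices c and d, a
    -- further vertex p must be joined to a or c and to b or d; in each case two vertices of `Near`
    -- share p besides x.
    four-near : 7 ≤ # S → ¬ 4 ≤ # Near
    four-near 7≤S h with adjacent-pair (≤-trans (n≤1+n 3) h)
    ... | a , b , c , (ab ∷ ac ∷ []) ∷ (bc ∷ []) ∷ _ , na ∷ nb ∷ nc ∷ [] , e
      with pick Near (a ∷ b ∷ c ∷ []) h
    ... | d , nd , da ∷ db ∷ dc ∷ [] with pick S (x ∷ a ∷ b ∷ c ∷ d ∷ []) (≤-trans (n≤1+n 6) 7≤S)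
    ... | p , p∈ , px ∷ pa ∷ pb ∷ pc ∷ pd ∷ []
      with near-or na nb nc ab (≢-sym ac) (≢-sym bc) e p∈ | near-or nb na nd (≢-sym ab) db da (E-sym e) p∈
    ... | inj₁ ap | inj₁ bp = two-common na nb p∈ px pa pb ab ap bp
    ... | inj₁ ap | inj₂ dp = two-common na nd p∈ px pa pd (≢-sym da) ap dp
    ... | inj₂ cp | inj₁ bp = two-common nc nb p∈ px pc pb (≢-sym bc) cp bp
    ... | inj₂ cp | inj₂ dp = two-common nc nd p∈ px pc pd (≢-sym dc) cp dp

    -- For an edge ab and a third vertex c of `Near`, every vertex of `Far` is joined to c, since
    -- otherwise a and b would share it. So c and three vertices of the clique `Far` form a 4-cycle.
    three-three : 3 ≤ # Near → ¬ 3 ≤ # Far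
    three-three hn hf with adjacent-pair hn | choose Far 3 hf
    ... | a , b , c , (ab ∷ ac ∷ []) ∷ (bc ∷ []) ∷ _ , na ∷ nb ∷ nc ∷ [] , e
        | p ∷ q ∷ r ∷ [] , refl , (pq ∷ pr ∷ []) ∷ (qr ∷ []) ∷ [] ∷ [] , fp ∷ fq ∷ fr ∷ [] =
      no-4-cycle c p q r
        ((near≢far nc fp ∷ near≢far nc fq ∷ near≢far nc fr ∷ []) ∷ (pq ∷ pr ∷ []) ∷ (qr ∷ []) ∷ [] ∷ [])
        (proj₁ (proj₁ nc) ∷ proj₁ (proj₁ fp) ∷ proj₁ (proj₁ fq) ∷ proj₁ (proj₁ fr) ∷ [])
        (to-c fp) (far fp fq) (far fq fr) (E-sym (to-c fr))
      where
      near≢far : ∀ {y z} → y ∈ Near → z ∈ Far → y ≢ z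
      near≢far ny fz refl = proj₂ fz (proj₂ ny)
      to-c : ∀ {y} → y ∈ Far → y ∈ E c
      to-c f@((y∈ , y≢x ∷ []) , _)
        with near-or na nb nc ab (≢-sym ac) (≢-sym bc) e y∈ | near-or nb na nc (≢-sym ab) (≢-sym bc)
          (≢-sym ac) (E-sym e) y∈
      ... | inj₂ cy | _       = cy
      ... | inj₁ _  | inj₂ cy = cy
      ... | inj₁ ay | inj₁ by = ⊥-elim (two-common na nb y∈ y≢x (≢-sym (near≢far na f))
        (≢-sym (near≢far nb f)) ab ay by)

  start : ∃ (_∈ S) → 7 ≤ # S → ⊥
  start (x , x∈S) 7≤S with 3 ≤? # (Near x x∈S) | 3 ≤? # (Far x x∈S)
  ... | yes n | yes f = three-three x x∈S n f
  ... | no ¬n | _ = four-far x x∈S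
    (≮⇒≥ λ neg → refute (# (Near x x∈S) ∷ # (Far x x∈S) ∷ # S ∷ # (S ∖ (x ∷ [])) ∷ [])
        (1 · lit 1 ⊕ var 0 ≼ lit 3 ∷ 1 · var 2 ≼ var 3 ⊕ lit 1 ∷ 1 · var 3 ≼ var 0 ⊕ var 1 ∷
          1 · lit 7 ≼ var 2 ∷ 1 · lit 1 ⊕ var 1 ≼ lit 4 ∷ [])
        (≰⇒> ¬n) (#-∖ S (x ∷ [])) (≤-reflexive (#-∩-∁ (S ∖ (x ∷ [])) (E x))) 7≤S neg)
  ... | yes _ | no ¬f = four-near x x∈S 7≤S
    (≮⇒≥ λ neg → refute (# (Near x x∈S) ∷ # (Far x x∈S) ∷ # S ∷ # (S ∖ (x ∷ [])) ∷ [])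
        (1 · lit 1 ⊕ var 1 ≼ lit 3 ∷ 1 · var 2 ≼ var 3 ⊕ lit 1 ∷ 1 · var 3 ≼ var 0 ⊕ var 1 ∷
          1 · lit 7 ≼ var 2 ∷ 1 · lit 1 ⊕ var 0 ≼ lit 4 ∷ [])
        (≰⇒> ¬f) (#-∖ S (x ∷ [])) (≤-reflexive (#-∩-∁ (S ∖ (x ∷ [])) (E x))) 7≤S neg)

-- A vertex of large degree

#-pair : ∀ {N} (C X Y : Sub N) → # (C ∩ X) + # (C ∩ Y) ≤ # C + # (C ∩ X ∩ Y)
#-pair C X Y = ≮⇒≥ λ neg → refute (# (C ∩ X) ∷ # (C ∩ Y) ∷ # C ∷ # ((C ∩ X) ∩ (C ∩ Y)) ∷ # (C ∩ X ∩ Y) ∷ [])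
    (1 · var 0 ⊕ var 1 ≼ var 2 ⊕ var 3 ∷ 1 · var 3 ≼ var 4 ∷ 1 · lit 1 ⊕ (var 2 ⊕ var 4) ≼ var 0 ⊕ var 1 ∷ [])
    (#-∩ (C ∩ X) (C ∩ Y) C (λ _ → proj₁) (λ _ → proj₁))
      (#-mono ((C ∩ X) ∩ (C ∩ Y)) (C ∩ X ∩ Y) (λ _ (p , (_ , q)) → p , q)) neg

#-triple : ∀ {N} (C X Y Z : Sub N) → # (C ∩ X) + # (C ∩ Y) + # (C ∩ Z) ≤ 2 * # C + # (C ∩ X ∩ Y ∩ Z)
#-triple C X Y Z = ≮⇒≥ λ neg → refute (# (C ∩ X) ∷ # (C ∩ Y) ∷ # (C ∩ Z) ∷ # C ∷ # (C ∩ X ∩ Y) ∷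
  # ((C ∩ X ∩ Y) ∩ (C ∩ Z)) ∷ # (C ∩ X ∩ Y ∩ Z) ∷ [])
    (1 · var 0 ⊕ var 1 ≼ var 3 ⊕ var 4 ∷ 1 · var 4 ⊕ var 2 ≼ var 3 ⊕ var 5 ∷ 1 · var 5 ≼ var 6 ∷
      1 · lit 1 ⊕ (2 ⊛ var 3 ⊕ var 6) ≼ var 0 ⊕ var 1 ⊕ var 2 ∷ [])
    (#-pair C X Y) (#-∩ (C ∩ X ∩ Y) (C ∩ Z) C (λ _ → proj₁ ∘ proj₁) (λ _ → proj₁))
      (#-mono ((C ∩ X ∩ Y) ∩ (C ∩ Z)) (C ∩ X ∩ Y ∩ Z) (λ _ (p , (_ , q)) → p , q)) neg

#-Bonferroni : ∀ {N} (A X Y Z : Sub N) →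
  # (A ∩ X) + # (A ∩ Y) + # (A ∩ Z) + # (A ∩ X ∩ Y ∩ Z) ≤
  # A + # (A ∩ X ∩ Y) + # (A ∩ X ∩ Z) + # (A ∩ Y ∩ Z)
#-Bonferroni A X Y Z = ≮⇒≥ λ neg → refute (# P ∷ # Q ∷ # R ∷ # (A ∩ X ∩ Y ∩ Z) ∷ # A ∷ # (A ∩ X ∩ Y) ∷
  # (A ∩ X ∩ Z) ∷ # (A ∩ Y ∩ Z) ∷ # (P ∩ Q) ∷ # (P ∪ Q) ∷ # ((P ∪ Q) ∩ R) ∷ # ((P ∩ R) ∩ (Q ∩ R)) ∷
  # ((P ∩ R) ∪ (Q ∩ R)) ∷ # (P ∩ R) ∷ # (Q ∩ R) ∷ [])
    (1 · var 0 ⊕ var 1 ≼ var 8 ⊕ var 9 ∷ 1 · var 8 ≼ var 5 ∷ 1 · var 9 ⊕ var 2 ≼ var 4 ⊕ var 10 ∷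
      1 · var 10 ≼ var 12 ∷ 1 · var 11 ⊕ var 12 ≼ var 13 ⊕ var 14 ∷ 1 · var 3 ≼ var 11 ∷ 1 · var 13 ≼ var 6 ∷
      1 · var 14 ≼ var 7 ∷ 1 · lit 1 ⊕ (var 4 ⊕ var 5 ⊕ var 6 ⊕ var 7) ≼ var 0 ⊕ var 1 ⊕ var 2 ⊕ var 3 ∷ [])
    (#-∩-∪ P Q) (#-mono (P ∩ Q) (A ∩ X ∩ Y) (λ _ (p , (_ , q)) → p , q))
      (#-∩ (P ∪ Q) R A (λ { _ (inj₁ p) → proj₁ p ; _ (inj₂ p) → proj₁ p }) (λ _ → proj₁))
      (#-mono ((P ∪ Q) ∩ R) ((P ∩ R) ∪ (Q ∩ R)) (λ { _ (inj₁ p , r) → inj₁ (p , r) ; _ (inj₂ q , r) → inj₂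
      (q , r) })) (#-∪-∩ (P ∩ R) (Q ∩ R)) (#-mono (A ∩ X ∩ Y ∩ Z) ((P ∩ R) ∩ (Q ∩ R))
      (λ _ (((a , x) , y) , z) → ((a , x) , (a , z)) , ((a , y) , (a , z))))
      (#-mono (P ∩ R) (A ∩ X ∩ Z) (λ _ (p , (_ , q)) → p , q))
      (#-mono (Q ∩ R) (A ∩ Y ∩ Z) (λ _ (p , (_ , q)) → p , q)) neg
  where
  P = A ∩ X
  Q = A ∩ Y
  R = A ∩ Z

module LargeDegree {N : ℕ} (F : Graph N) (noWheel : ¬ (W8 ⊆ complement F)) where

  open Coloured F
  open Wheelless F noWheel

  module _ (D : ℕ) (1≤D : 1 ≤ D) (D≤N : 2 * D + 10 ≤ N) (low : ∀ x → # (g x) ≤ D) (hub : Fin N) where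

    A C : Sub N
    A = b hub
    C = ∁ A

    d e : Fin N → ℕ
    d x = # (A ∩ b x)
    e x = # (C ∩ b x)

    N≡ : N ≡ # A + # C
    N≡ = #-∁ A

    a-large : N ≤ # A + 1 + D
    a-large = ≮⇒≥ λ neg → refute (N ∷ # A ∷ # (g hub) ∷ D ∷ [])
        (1 · var 0 ≼ lit 1 ⊕ (var 2 ⊕ var 1) ∷ 1 · var 2 ≼ var 3 ∷
          1 · lit 1 ⊕ (var 1 ⊕ lit 1 ⊕ var 3) ≼ var 0 ∷ [])
        (≤-reflexive (#-degrees hub)) (low hub) neg

    degree : ∀ x → N ≤ d x + e x + 1 + D
    degree x = ≮⇒≥ λ neg → refute (N ∷ d x ∷ e x ∷ # (b x) ∷ # (b x ∩ A) ∷ # (b x ∩ C) ∷ # (g x) ∷ D ∷ [])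
        (1 · var 0 ≼ lit 1 ⊕ (var 6 ⊕ var 3) ∷ 1 · var 6 ≼ var 7 ∷ 1 · var 3 ≼ var 4 ⊕ var 5 ∷
          1 · var 4 ≼ var 1 ∷ 1 · var 5 ≼ var 2 ∷ 1 · lit 1 ⊕ (var 1 ⊕ var 2 ⊕ lit 1 ⊕ var 7) ≼ var 0 ∷ [])
        (≤-reflexive (#-degrees x)) (low x) (≤-reflexive (#-∩-∁ (b x) A))
          (#-mono (b x ∩ A) (A ∩ b x) (λ _ (u , w) → w , u))
          (#-mono (b x ∩ C) (C ∩ b x) (λ _ (u , w) → w , u)) neg

    -- Three light vertices have at least four common B-neighbours in C, while the numbers of common
    -- B-neighbours in A of the three pairs among three heavy vertices add up to at least 13.
    Heavy Light : Sub N
    Heavy = sub (λ x → # C + 3 * # A < 3 * d x + 7 + 3 * D) (λ x → _ <? _)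
    Light = ∁ Heavy

    light : ∀ {x} → x ∈ Light → 3 * d x + 7 + 3 * D ≤ # C + 3 * # A
    light = ≮⇒≥

    -- Four of them would be alternate rim vertices around the hub u, with the gaps filled from C:
    -- three light vertices share at least 3(N - 1 - D) - (|C| + 3|A| - 7 - 3D) - 2|C| = 4 vertices
    -- there.
    few-light : ∀ u → u ∈ A → u ∈ Light → # (A ∩ b u ∩ Light) ≤ 3
    few-light u u∈A ul = ≮⇒≥ λ 4≤ → four 4≤
      where
      big : ∀ x y → x ∈ Light → y ∈ Light → 4 ≤ # link A u x y
      big x y xl yl = ≮⇒≥ λ neg → refute (N ∷ # A ∷ # C ∷ D ∷ d u ∷ e u ∷ d x ∷ e x ∷ d y ∷ e y ∷
        # link A u x y ∷ [])
          (9 · var 1 ⊕ var 2 ≼ var 0 ∷ 3 · var 0 ≼ var 4 ⊕ var 5 ⊕ lit 1 ⊕ var 3 ∷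
            3 · var 0 ≼ var 6 ⊕ var 7 ⊕ lit 1 ⊕ var 3 ∷ 3 · var 0 ≼ var 8 ⊕ var 9 ⊕ lit 1 ⊕ var 3 ∷
            1 · 3 ⊛ var 4 ⊕ lit 7 ⊕ 3 ⊛ var 3 ≼ var 2 ⊕ 3 ⊛ var 1 ∷
            1 · 3 ⊛ var 6 ⊕ lit 7 ⊕ 3 ⊛ var 3 ≼ var 2 ⊕ 3 ⊛ var 1 ∷
            1 · 3 ⊛ var 8 ⊕ lit 7 ⊕ 3 ⊛ var 3 ≼ var 2 ⊕ 3 ⊛ var 1 ∷
            3 · var 5 ⊕ var 7 ⊕ var 9 ≼ 2 ⊛ var 2 ⊕ var 10 ∷ 3 · lit 1 ⊕ var 10 ≼ lit 4 ∷ [])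
          (≤-reflexive (sym N≡)) (degree u) (degree x) (degree y) (light ul) (light xl) (light yl)
            (#-triple C (b u) (b x) (b y)) neg
      four : ¬ 4 ≤ # (A ∩ b u ∩ Light)
      four h with choose (A ∩ b u ∩ Light) 4 h
      ... | x₁ ∷ x₂ ∷ x₃ ∷ x₄ ∷ [] , _ , uniq , ((a₁ , b₁) , l₁) ∷ ((a₂ , b₂) , l₂) ∷ ((a₃ , b₃) , l₃) ∷
        ((a₄ , b₄) , l₄) ∷ [] =
        no-links A u x₁ x₂ x₃ x₄ uniq (a₁ ∷ a₂ ∷ a₃ ∷ a₄ ∷ []) (b₁ ∷ b₂ ∷ b₃ ∷ b₄ ∷ [])
          (big x₁ x₂ l₁ l₂) (≤-trans (s≤s (s≤s z≤n)) (big x₂ x₃ l₂ l₃))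
          (≤-trans (s≤s z≤n) (big x₃ x₄ l₃ l₄)) (≤-trans (s≤s (s≤s (s≤s z≤n))) (big x₄ x₁ l₄ l₁))

    -- As |C| ≤ D + 1, at least N - 2 - 2D ≥ 8 of the B-neighbours of u lie in A, and at most three
    -- of these are light.
    many-heavy : ∀ u → u ∈ A → u ∈ Light → 5 ≤ # (A ∩ Heavy ∩ b u)
    many-heavy u u∈A ul = ≮⇒≥ λ neg → refute (N ∷ # A ∷ # C ∷ D ∷ d u ∷ e u ∷ # (A ∩ b u ∩ Light) ∷
      # (A ∩ b u ∩ Heavy) ∷ # (A ∩ Heavy ∩ b u) ∷ [])
        (1 · var 6 ≼ lit 3 ∷ 1 · var 4 ≼ var 7 ⊕ var 6 ∷ 1 · var 1 ⊕ var 2 ≼ var 0 ∷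
          1 · 2 ⊛ var 3 ⊕ lit 10 ≼ var 0 ∷ 1 · var 0 ≼ var 1 ⊕ lit 1 ⊕ var 3 ∷
          1 · var 0 ≼ var 4 ⊕ var 5 ⊕ lit 1 ⊕ var 3 ∷ 1 · var 5 ≼ var 2 ∷ 1 · var 7 ≼ var 8 ∷
          1 · lit 1 ⊕ var 8 ≼ lit 5 ∷ [])
        (few-light u u∈A ul) (≤-reflexive (#-∩-∁ (A ∩ b u) Heavy)) (≤-reflexive (sym N≡)) D≤N a-large
          (degree u) (#-mono (C ∩ b u) C (λ _ → proj₁))
          (#-mono (A ∩ b u ∩ Heavy) (A ∩ Heavy ∩ b u) (λ _ ((p , q) , r) → (p , r) , q)) neg

    -- Otherwise A, having at least D + 9 ≥ 10 vertices, contains four light ones. Each has five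
    -- B-neighbours among at most six heavy vertices, so any two share four, and a wheel around
    -- `hub` closes.
    seven-heavy : 7 ≤ # (A ∩ Heavy)
    seven-heavy = ≮⇒≥ λ few → four few (choose (A ∩ Light) 4
      (≮⇒≥ λ neg → refute (N ∷ # A ∷ D ∷ # (A ∩ Heavy) ∷ # (A ∩ Light) ∷ [])
        (1 · var 1 ≼ var 3 ⊕ var 4 ∷ 1 · lit 1 ⊕ var 3 ≼ lit 7 ∷ 1 · var 0 ≼ var 1 ⊕ lit 1 ⊕ var 2 ∷
          1 · 2 ⊛ var 2 ⊕ lit 10 ≼ var 0 ∷ 1 · lit 1 ≼ var 2 ∷ 1 · lit 1 ⊕ var 4 ≼ lit 4 ∷ [])
        (≤-reflexive (#-∩-∁ A Heavy)) few a-large D≤N 1≤D neg))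
      where
      module _ (few : # (A ∩ Heavy) < 7) where
        big : ∀ x y → x ∈ A × x ∈ Light → y ∈ A × y ∈ Light → 4 ≤ # link Light hub x y
        big x y (xa , xl) (ya , yl) = ≮⇒≥ λ neg → refute
          (# (A ∩ Heavy) ∷ # (A ∩ Heavy ∩ b x) ∷ # (A ∩ Heavy ∩ b y) ∷ # (A ∩ Heavy ∩ b x ∩ b y) ∷
          # link Light hub x y ∷ [])
            (1 · lit 1 ⊕ var 0 ≼ lit 7 ∷ 1 · lit 5 ≼ var 1 ∷ 1 · lit 5 ≼ var 2 ∷
              1 · var 1 ⊕ var 2 ≼ var 0 ⊕ var 3 ∷ 1 · var 3 ≼ var 4 ∷ 1 · lit 1 ⊕ var 4 ≼ lit 4 ∷ [])
            few (many-heavy x xa xl) (many-heavy y ya yl) (#-pair (A ∩ Heavy) (b x) (b y))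
              (#-mono (A ∩ Heavy ∩ b x ∩ b y) (link Light hub x y)
              (λ _ (((p , q) , r) , s) → (((λ ¬q → ¬q q) , p) , r) , s)) neg
        four : ¬ (∃ λ l → length l ≡ 4 × Unique l × All (_∈ (A ∩ Light)) l)
        four (x₁ ∷ x₂ ∷ x₃ ∷ x₄ ∷ [] , _ , uniq , p₁@(a₁ , l₁) ∷ p₂@(a₂ , l₂) ∷ p₃@(a₃ , l₃) ∷ p₄@(a₄ , l₄) ∷
          []) =
          no-links Light hub x₁ x₂ x₃ x₄ uniq (l₁ ∷ l₂ ∷ l₃ ∷ l₄ ∷ []) (a₁ ∷ a₂ ∷ a₃ ∷ a₄ ∷ [])
            (big x₁ x₂ p₁ p₂) (≤-trans (s≤s (s≤s z≤n)) (big x₂ x₃ p₂ p₃))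
            (≤-trans (s≤s z≤n) (big x₃ x₄ p₃ p₄)) (≤-trans (s≤s (s≤s (s≤s z≤n))) (big x₄ x₁ p₄ p₁))

    q : Fin N → Fin N → ℕ
    q x y = # (A ∩ b x ∩ b y)

    q-sym : ∀ x y → q x y ≤ q y x
    q-sym x y = #-mono (A ∩ b x ∩ b y) (A ∩ b y ∩ b x) (λ _ ((p , r) , s) → (p , s) , r)

    -- The three thresholds give d x + d y + d z ≥ |C| + 3|A| - 6 - 3D. Bonferroni subtracts |A|,
    -- and |C| + 2|A| ≥ 2N - 1 - D turns the rest into 2N - 7 - 4D ≥ 13.
    q-triple : ∀ {x y z} → x ∈ Heavy → y ∈ Heavy → z ∈ Heavy →
      13 + # (A ∩ b x ∩ b y ∩ b z) ≤ q x y + q x z + q y z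
    q-triple {x} {y} {z} xh yh zh = ≮⇒≥ λ neg → refute
      (N ∷ # A ∷ # C ∷ D ∷ d x ∷ d y ∷ d z ∷ q x y ∷ q x z ∷ q y z ∷ # (A ∩ b x ∩ b y ∩ b z) ∷ [])
        (3 · var 0 ≼ var 1 ⊕ var 2 ∷ 6 · 2 ⊛ var 3 ⊕ lit 10 ≼ var 0 ∷ 3 · var 0 ≼ var 1 ⊕ lit 1 ⊕ var 3 ∷
          1 · lit 1 ⊕ (var 2 ⊕ 3 ⊛ var 1) ≼ 3 ⊛ var 4 ⊕ lit 7 ⊕ 3 ⊛ var 3 ∷
          1 · lit 1 ⊕ (var 2 ⊕ 3 ⊛ var 1) ≼ 3 ⊛ var 5 ⊕ lit 7 ⊕ 3 ⊛ var 3 ∷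
          1 · lit 1 ⊕ (var 2 ⊕ 3 ⊛ var 1) ≼ 3 ⊛ var 6 ⊕ lit 7 ⊕ 3 ⊛ var 3 ∷
          3 · var 4 ⊕ var 5 ⊕ var 6 ⊕ var 10 ≼ var 1 ⊕ var 7 ⊕ var 8 ⊕ var 9 ∷
          3 · lit 1 ⊕ (var 7 ⊕ var 8 ⊕ var 9) ≼ lit 13 ⊕ var 10 ∷ [])
        (≤-reflexive N≡) D≤N a-large xh yh zh (#-Bonferroni A (b x) (b y) (b z)) neg

    module _ {x₁ x₂ x₃ x₄ : Fin N} (uniq : Unique (x₁ ∷ x₂ ∷ x₃ ∷ x₄ ∷ [])) (∈A : All (_∈ A) (x₁ ∷ x₂ ∷ x₃ ∷ x₄ ∷ [])) where

      private
        xs : List (Fin N)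
        xs = x₁ ∷ x₂ ∷ x₃ ∷ x₄ ∷ []
        S : Sub N
        S = elements xs

      -- A common B-neighbour of x and y differs from both, so only z and w can be lost.
      q-link : ∀ {x y z w} → All (_∈ˡ (x ∷ y ∷ z ∷ w ∷ [])) xs → q x y ≤ # link S hub x y + 2
      q-link {x} {y} {z} {w} xs⊆ = ≮⇒≥ λ neg → refute
        (q x y ∷ # ((A ∩ b x ∩ b y) ∖ (z ∷ w ∷ [])) ∷ # link S hub x y ∷ [])
          (1 · var 0 ≼ var 1 ⊕ lit 2 ∷ 1 · var 1 ≼ var 2 ∷ 1 · lit 1 ⊕ (var 2 ⊕ lit 2) ≼ var 0 ∷ [])
          (#-∖ (A ∩ b x ∩ b y) (z ∷ w ∷ [])) (#-mono ((A ∩ b x ∩ b y) ∖ (z ∷ w ∷ [])) (link S hub x y) into)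
            neg
        where
        into : ∀ v → v ∈ (A ∩ b x ∩ b y) ∖ (z ∷ w ∷ []) → v ∈ link S hub x y
        into v (((a , bx) , by) , v≢z ∷ v≢w ∷ []) = (((λ v∈ → out (All.lookup xs⊆ v∈)) , a) , bx) , by
          where
          out : ¬ v ∈ˡ (x ∷ y ∷ z ∷ w ∷ [])
          out (Any.here refl) = B-≢ bx refl
          out (Any.there (Any.here refl)) = B-≢ by refl
          out (Any.there (Any.there (Any.here refl))) = v≢z refl
          out (Any.there (Any.there (Any.there (Any.here refl)))) = v≢w refl

      -- After the loss of two candidates per gap the demands 4, 2, 1, 3 of `no-links` are still
      -- met.
      6535-cycle : 6 ≤ q x₁ x₂ → 5 ≤ q x₂ x₃ → 3 ≤ q x₃ x₄ → 5 ≤ q x₄ x₁ → ⊥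
      6535-cycle h₁₂ h₂₃ h₃₄ h₄₁ = no-links S hub x₁ x₂ x₃ x₄ uniq (in₁ ∷ in₂ ∷ in₃ ∷ in₄ ∷ []) ∈A
        (≮⇒≥ λ neg → refute (q x₁ x₂ ∷ # link S hub x₁ x₂ ∷ [])
            (1 · lit 6 ≼ var 0 ∷ 1 · var 0 ≼ var 1 ⊕ lit 2 ∷ 1 · lit 1 ⊕ var 1 ≼ lit 4 ∷ [])
            h₁₂ (q-link {x₁} {x₂} {x₃} {x₄} (in₁ ∷ in₂ ∷ in₃ ∷ in₄ ∷ [])) neg)
        (≮⇒≥ λ neg → refute (q x₂ x₃ ∷ # link S hub x₂ x₃ ∷ [])
            (1 · lit 5 ≼ var 0 ∷ 1 · var 0 ≼ var 1 ⊕ lit 2 ∷ 1 · lit 1 ⊕ var 1 ≼ lit 2 ∷ [])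
            h₂₃ (q-link {x₂} {x₃} {x₄} {x₁} (in₄ ∷ in₁ ∷ in₂ ∷ in₃ ∷ [])) neg)
        (≮⇒≥ λ neg → refute (q x₃ x₄ ∷ # link S hub x₃ x₄ ∷ [])
            (1 · lit 3 ≼ var 0 ∷ 1 · var 0 ≼ var 1 ⊕ lit 2 ∷ 1 · lit 1 ⊕ var 1 ≼ lit 1 ∷ [])
            h₃₄ (q-link {x₃} {x₄} {x₁} {x₂} (in₃ ∷ in₄ ∷ in₁ ∷ in₂ ∷ [])) neg)
        (≮⇒≥ λ neg → refute (q x₄ x₁ ∷ # link S hub x₄ x₁ ∷ [])
            (1 · lit 5 ≼ var 0 ∷ 1 · var 0 ≼ var 1 ⊕ lit 2 ∷ 1 · lit 1 ⊕ var 1 ≼ lit 3 ∷ [])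
            h₄₁ (q-link {x₄} {x₁} {x₂} {x₃} (in₂ ∷ in₃ ∷ in₄ ∷ in₁ ∷ [])) neg)
        where
        in₁ : ∀ {A : Set} {x y z w : A} → x ∈ˡ (x ∷ y ∷ z ∷ w ∷ [])
        in₁ = Any.here refl
        in₂ : ∀ {A : Set} {x y z w : A} → y ∈ˡ (x ∷ y ∷ z ∷ w ∷ [])
        in₂ = Any.there (Any.here refl)
        in₃ : ∀ {A : Set} {x y z w : A} → z ∈ˡ (x ∷ y ∷ z ∷ w ∷ [])
        in₃ = Any.there (Any.there (Any.here refl))
        in₄ : ∀ {A : Set} {x y z w : A} → w ∈ˡ (x ∷ y ∷ z ∷ w ∷ [])
        in₄ = Any.there (Any.there (Any.there (Any.here refl)))

    rotate : ∀ {w x y z : Fin N} → Unique (w ∷ x ∷ y ∷ z ∷ []) → Unique (x ∷ y ∷ z ∷ w ∷ [])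
    rotate ((wx ∷ wy ∷ wz ∷ []) ∷ (xy ∷ xz ∷ []) ∷ (yz ∷ []) ∷ [] ∷ []) =
      (xy ∷ xz ∷ ≢-sym wx ∷ []) ∷ (yz ∷ ≢-sym wy ∷ []) ∷ (≢-sym wz ∷ []) ∷ [] ∷ []

    rotate-∈ : ∀ {w x y z : Fin N} → All (_∈ A) (w ∷ x ∷ y ∷ z ∷ []) → All (_∈ A) (x ∷ y ∷ z ∷ w ∷ [])
    rotate-∈ (w ∷ x ∷ y ∷ z ∷ []) = x ∷ y ∷ z ∷ w ∷ []

    -- A single side with six common neighbours, or the diagonal x₁x₃ with six, reduces to
    -- `6535-cycle`. If all of them have exactly or at most five, the bound 13 makes triple
    -- intersections so small that a careful greedy choice works.
    5555-cycle : ∀ x₁ x₂ x₃ x₄ → Unique (x₁ ∷ x₂ ∷ x₃ ∷ x₄ ∷ []) → All (_∈ (A ∩ Heavy))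
      (x₁ ∷ x₂ ∷ x₃ ∷ x₄ ∷ []) →
      5 ≤ q x₁ x₂ → 5 ≤ q x₂ x₃ → 5 ≤ q x₃ x₄ → 5 ≤ q x₄ x₁ → ⊥
    5555-cycle x₁ x₂ x₃ x₄ uniq@((x₁₂ ∷ x₁₃ ∷ x₁₄ ∷ []) ∷ (x₂₃ ∷ x₂₄ ∷ []) ∷ (x₃₄ ∷ []) ∷ [] ∷ [])
      ((a₁ , h₁) ∷ (a₂ , h₂) ∷ (a₃ , h₃) ∷ (a₄ , h₄) ∷ []) q₁₂ q₂₃ q₃₄ q₄₁ =
      cases (6 ≤? q x₁ x₂) (6 ≤? q x₂ x₃) (6 ≤? q x₃ x₄) (6 ≤? q x₄ x₁) (6 ≤? q x₁ x₃)
      where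
      three : ∀ {k} → 5 ≤ k → 3 ≤ k
      three = ≤-trans (s≤s (s≤s (s≤s z≤n)))
      ∈A : All (_∈ A) (x₁ ∷ x₂ ∷ x₃ ∷ x₄ ∷ [])
      ∈A = a₁ ∷ a₂ ∷ a₃ ∷ a₄ ∷ []
      -- At least 13 - 5 - 5 = 3 common neighbours of x₁ and x₂ are not B-adjacent to x₃. Taking y₁
      -- among them makes it differ from y₂ and y₃ for free, so y₂ has only four vertices to avoid.
      thin : q x₁ x₂ < 6 → q x₂ x₃ < 6 → q x₁ x₃ < 6 → ⊥
      thin l₁₂ l₂₃ l₁₃ = greedy₁ (pick ((A ∩ b x₁ ∩ b x₂) ∩ ∁ (b x₃)) (x₃ ∷ x₄ ∷ [])
          (≮⇒≥ λ neg → refute (# (A ∩ b x₁ ∩ b x₂ ∩ b x₃) ∷ # ((A ∩ b x₁ ∩ b x₂) ∩ ∁ (b x₃)) ∷ q x₁ x₂ ∷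
            q x₁ x₃ ∷ q x₂ x₃ ∷ [])
              (1 · var 2 ≼ var 0 ⊕ var 1 ∷ 1 · lit 13 ⊕ var 0 ≼ var 2 ⊕ var 3 ⊕ var 4 ∷
                1 · lit 1 ⊕ var 3 ≼ lit 6 ∷ 1 · lit 1 ⊕ var 4 ≼ lit 6 ∷ 1 · lit 1 ⊕ var 1 ≼ lit 3 ∷ [])
              (≤-reflexive (#-∩-∁ (A ∩ b x₁ ∩ b x₂) (b x₃))) (q-triple h₁ h₂ h₃) l₁₃ l₂₃ neg))
          (pick (A ∩ b x₃ ∩ b x₄) (x₁ ∷ x₂ ∷ []) (three q₃₄))
        where
        Choice : Sub N → List (Fin N) → Set
        Choice S l = ∃ λ y → y ∈ S × All (y ≢_) l
        ∉l : ∀ {y l} → All (y ≢_) l → ¬ y ∈ˡ l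
        ∉l y≢ y∈ = All.lookup y≢ y∈ refl
        greedy₃ : ∀ {y₁ y₃ y₄} → (y₁ ∈ (A ∩ b x₁ ∩ b x₂) ∩ ∁ (b x₃)) × All (y₁ ≢_) (x₃ ∷ x₄ ∷ []) →
          y₃ ∈ A ∩ b x₃ ∩ b x₄ × All (y₃ ≢_) (x₁ ∷ x₂ ∷ []) →
          y₄ ∈ A ∩ b x₄ ∩ b x₁ × All (y₄ ≢_) (x₂ ∷ x₃ ∷ y₁ ∷ y₃ ∷ []) → ¬ Choice (A ∩ b x₂ ∩ b x₃)
            (x₁ ∷ x₄ ∷ y₃ ∷ y₄ ∷ [])
        greedy₃ {y₁} {y₃} {y₄} ((((t₁ , r₁₁) , r₂₁) , ¬r₃₁) , y₁≢x₃ ∷ y₁≢x₄ ∷ [])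
          (((t₃ , r₃₃) , r₄₃) , y₃≢x₁ ∷ y₃≢x₂ ∷ [])
          (((t₄ , r₄₄) , r₁₄) , y₄≢x₂ ∷ y₄≢x₃ ∷ y₄≢y₁ ∷ y₄≢y₃ ∷ [])
            (y₂ , ((t₂ , r₂₂) , r₃₂) , y₂≢x₁ ∷ y₂≢x₄ ∷ y₂≢y₃ ∷ y₂≢y₄ ∷ []) =
          no-alternating (elements (x₁ ∷ x₂ ∷ x₃ ∷ x₄ ∷ [])) hub x₁ x₂ x₃ x₄ y₁ y₂ y₃ y₄ uniq
            (((λ { refl → ¬r₃₁ r₃₂ }) ∷ (λ { refl → ¬r₃₁ r₃₃ }) ∷ ≢-sym y₄≢y₁ ∷ []) ∷ (y₂≢y₃ ∷ y₂≢y₄ ∷ []) ∷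
              (≢-sym y₄≢y₃ ∷ []) ∷ [] ∷ [])
            (Any.here refl ∷ Any.there (Any.here refl) ∷ Any.there (Any.there (Any.here refl)) ∷
              Any.there (Any.there (Any.there (Any.here refl))) ∷ [])
            (∉l (≢-sym (B-≢ r₁₁) ∷ ≢-sym (B-≢ r₂₁) ∷ y₁≢x₃ ∷ y₁≢x₄ ∷ []) ∷
             ∉l (y₂≢x₁ ∷ ≢-sym (B-≢ r₂₂) ∷ ≢-sym (B-≢ r₃₂) ∷ y₂≢x₄ ∷ []) ∷
             ∉l (y₃≢x₁ ∷ y₃≢x₂ ∷ ≢-sym (B-≢ r₃₃) ∷ ≢-sym (B-≢ r₄₃) ∷ []) ∷
             ∉l (≢-sym (B-≢ r₁₄) ∷ y₄≢x₂ ∷ y₄≢x₃ ∷ ≢-sym (B-≢ r₄₄) ∷ []) ∷ [])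
            ∈A (t₁ ∷ t₂ ∷ t₃ ∷ t₄ ∷ []) r₁₁ r₂₁ r₂₂ r₃₂ r₃₃ r₄₃ r₄₄ r₁₄
        greedy₁ : Choice ((A ∩ b x₁ ∩ b x₂) ∩ ∁ (b x₃)) (x₃ ∷ x₄ ∷ []) → ¬ Choice (A ∩ b x₃ ∩ b x₄)
          (x₁ ∷ x₂ ∷ [])
        greedy₁ (y₁ , p₁) (y₃ , p₃) = greedy₂ (pick (A ∩ b x₄ ∩ b x₁) (x₂ ∷ x₃ ∷ y₁ ∷ y₃ ∷ []) q₄₁)
          where
          greedy₂ : ¬ Choice (A ∩ b x₄ ∩ b x₁) (x₂ ∷ x₃ ∷ y₁ ∷ y₃ ∷ [])
          greedy₂ (y₄ , p₄) = greedy₃ p₁ p₃ p₄ (pick (A ∩ b x₂ ∩ b x₃) (x₁ ∷ x₄ ∷ y₃ ∷ y₄ ∷ []) q₂₃)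
      cases : Dec (6 ≤ q x₁ x₂) → Dec (6 ≤ q x₂ x₃) → Dec (6 ≤ q x₃ x₄) → Dec (6 ≤ q x₄ x₁) → Dec
        (6 ≤ q x₁ x₃) → ⊥
      cases (yes h) _ _ _ _ = 6535-cycle uniq ∈A h q₂₃ (three q₃₄) q₄₁
      cases _ (yes h) _ _ _ = 6535-cycle (rotate uniq) (rotate-∈ ∈A) h q₃₄ (three q₄₁) q₁₂
      cases _ _ (yes h) _ _ = 6535-cycle (rotate (rotate uniq)) (rotate-∈ (rotate-∈ ∈A)) h q₄₁ (three q₁₂) q₂₃
      cases _ _ _ (yes h) _ = 6535-cycle (rotate (rotate (rotate uniq))) (rotate-∈ (rotate-∈ (rotate-∈ ∈A))) h
        q₁₂ (three q₂₃) q₃₄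
      -- The cycle is rerouted as x₁x₃x₂x₄ along the good diagonal; the other diagonal x₂x₄ has at
      -- least 13 - 5 - 5 = 3 common neighbours.
      cases (no ¬h₁₂) (no _) (no _) (no ¬h₄₁) (yes h) =
        6535-cycle ((x₁₃ ∷ x₁₂ ∷ x₁₄ ∷ []) ∷ (≢-sym x₂₃ ∷ x₃₄ ∷ []) ∷ (x₂₄ ∷ []) ∷ [] ∷ [])
          (a₁ ∷ a₃ ∷ a₂ ∷ a₄ ∷ []) h
          (≤-trans q₂₃ (q-sym x₂ x₃))
          (≮⇒≥ λ neg → refute (q x₁ x₂ ∷ q x₁ x₄ ∷ q x₄ x₁ ∷ q x₂ x₄ ∷ # (A ∩ b x₁ ∩ b x₂ ∩ b x₄) ∷ [])
              (1 · lit 13 ⊕ var 4 ≼ var 0 ⊕ var 1 ⊕ var 3 ∷ 1 · lit 1 ⊕ var 0 ≼ lit 6 ∷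
                1 · lit 1 ⊕ var 2 ≼ lit 6 ∷ 1 · var 1 ≼ var 2 ∷ 1 · lit 1 ⊕ var 3 ≼ lit 3 ∷ [])
              (q-triple h₁ h₂ h₄) (≰⇒> ¬h₁₂) (≰⇒> ¬h₄₁) (q-sym x₁ x₄) neg)
          q₄₁
      cases (no ¬h₁₂) (no ¬h₂₃) (no _) (no _) (no ¬h₁₃) = thin (≰⇒> ¬h₁₂) (≰⇒> ¬h₂₃) (≰⇒> ¬h₁₃)

    -- Join two heavy vertices if they share five B-neighbours in A. Three unjoined pairs would add
    -- up to at most 12 < 13, so no three heavy vertices are independent.
    low-degrees-impossible : ⊥
    low-degrees-impossible = <⇒≱ (no-C₄ (A ∩ Heavy) E (λ {x} {y} h → ≤-trans h (q-sym x y)) triple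
      (λ x₁ x₂ x₃ x₄ uniq ∈S → 5555-cycle x₁ x₂ x₃ x₄ uniq ∈S)) seven-heavy
      where
      E : Fin N → Sub N
      E x = sub (λ y → 5 ≤ q x y) (λ y → 5 ≤? q x y)
      triple : ∀ {x y z} → x ∈ A ∩ Heavy → y ∈ A ∩ Heavy → z ∈ A ∩ Heavy → y ∈ E x ⊎ z ∈ E x ⊎ z ∈ E y
      triple {x} {y} {z} (_ , xh) (_ , yh) (_ , zh) = cases (5 ≤? q x y) (5 ≤? q x z) (5 ≤? q y z)
        where
        cases : Dec (5 ≤ q x y) → Dec (5 ≤ q x z) → Dec (5 ≤ q y z) → y ∈ E x ⊎ z ∈ E x ⊎ z ∈ E y
        cases (yes h) _ _ = inj₁ h
        cases _ (yes h) _ = inj₂ (inj₁ h)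
        cases _ _ (yes h) = inj₂ (inj₂ h)
        cases (no ¬xy) (no ¬xz) (no ¬yz) = ⊥-elim (refute
          (q x y ∷ q x z ∷ q y z ∷ # (A ∩ b x ∩ b y ∩ b z) ∷ [])
            (1 · lit 13 ⊕ var 3 ≼ var 0 ⊕ var 1 ⊕ var 2 ∷ 1 · lit 1 ⊕ var 0 ≼ lit 5 ∷
              1 · lit 1 ⊕ var 1 ≼ lit 5 ∷ 1 · lit 1 ⊕ var 2 ≼ lit 5 ∷ [])
            (q-triple xh yh zh) (≰⇒> ¬xy) (≰⇒> ¬xz) (≰⇒> ¬yz))

  large-degree : ∀ D → 1 ≤ D → 2 * D + 10 ≤ N → ∃ λ v → D < # (g v)
  large-degree D 1≤D D≤N with Fin.any? (λ v → D <? # (g v))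
  ... | yes p = p
  ... | no ¬p = ⊥-elim (low-degrees-impossible D 1≤D D≤N (λ x → ≮⇒≥ λ lt → ¬p (x , lt))
    (proj₁ (nonempty full (≤-trans (≤-trans (m≤n+m 1 (2 * D + 9))
      (≤-trans (≤-reflexive (+-assoc (2 * D) 9 1)) D≤N)) (≤-reflexive (sym #-full))))))

-- Spiders, and sets that are completely joined in the complement.
-- Throughout n = 7 + m, so that no truncated subtraction occurs.

module Treeless {N : ℕ} (F : Graph N) (m : ℕ) (noTree : ¬ (S22 (7 + m) ⊆ F)) where

  open Coloured F

  no-tree : ∀ c γ₁ z₁ y₁ γ₂ z₂ y₂ (L : Sub N) → let legs = γ₁ ∷ z₁ ∷ y₁ ∷ γ₂ ∷ z₂ ∷ y₂ ∷ [] in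
    Unique (c ∷ legs) → G c γ₁ → G γ₁ z₁ → G z₁ y₁ → G c γ₂ → G γ₂ z₂ → G z₂ y₂ →
    (∀ x → x ∈ L → G c x × All (x ≢_) legs) → m ≤ # L → ⊥
  no-tree c γ₁ z₁ y₁ γ₂ z₂ y₂ L (c∉legs ∷ uniq) e₁ e₂ e₃ e₄ e₅ e₆ leaves m≤ with choose L m m≤
  ... | l , l≡m , l-uniq , l⊆L = noTree (spider-⊆ m F c l γ₁ z₁ y₁ γ₂ z₂ y₂ l≡m
    (++⁺ (All.map (λ {x} x∈ → G-≢ (proj₁ (leaves x x∈))) l⊆L) c∉legs ∷
     AllPairs.++⁺ l-uniq uniq (All.map (λ {x} x∈ → proj₂ (leaves x x∈)) l⊆L))
    (All.map (λ {x} x∈ → unG (proj₁ (leaves x x∈))) l⊆L)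
    (unG e₁) (unG e₂) (unG e₃) (unG e₄) (unG e₅) (unG e₆))

subset : ∀ {N} (A : Sub N) k → k ≤ # A → ∃ λ C → # C ≡ k × (∀ x → x ∈ C → x ∈ A)
subset A k k≤A with choose A k k≤A
... | l , refl , uniq , l⊆A = elements l ,
  ≤-antisym (≮⇒≥ λ neg → refute (# elements l ∷ # (elements l ∖ l) ∷ length l ∷ [])
      (1 · var 0 ≼ var 1 ⊕ var 2 ∷ 1 · var 1 ≼ lit 0 ∷ 1 · lit 1 ⊕ var 2 ≼ var 0 ∷ [])
      (#-∖ (elements l) l) (≤-reflexive (#-empty (elements l ∖ l)
        (λ x (x∈l , x∉l) → All.lookup x∉l x∈l refl))) neg)
            (#-unique (elements l) l uniq (All.tabulate id)) ,
  λ x x∈l → All.lookup l⊆A x∈l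

module Blocks {N : ℕ} (F : Graph N) (noWheel : ¬ (W8 ⊆ complement F)) where

  open Coloured F
  open Wheelless F noWheel

  Complete : Sub N → Sub N → Set
  Complete X Q = ∀ {x q} → x ∈ X → q ∈ Q → B x q

  -- Every vertex of Q fits into every gap of the rim, so four of them fill all gaps.
  no-four : ∀ (Q : Sub N) h x₁ x₂ x₃ x₄ → let x = x₁ ∷ x₂ ∷ x₃ ∷ x₄ ∷ [] in
    Unique x → All (B h) x → All (λ y → ∀ {q} → q ∈ Q → B y q) x → (∀ {q} → q ∈ Q → B h q) → ¬ 4 ≤ # Q
  no-four Q h x₁ x₂ x₃ x₄ uniq spokes complete@(c₁ ∷ c₂ ∷ c₃ ∷ c₄ ∷ []) hQ 4≤Q =
    no-links (∁ Q) h x₁ x₂ x₃ x₄ uniq (All.map (λ c q → B-≢ (c q) refl) complete) spokes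
      (big c₁ c₂) (≤-trans (s≤s (s≤s z≤n)) (big c₂ c₃))
      (≤-trans (s≤s z≤n) (big c₃ c₄)) (≤-trans (s≤s (s≤s (s≤s z≤n))) (big c₄ c₁))
    where
    big : ∀ {x y} → (∀ {q} → q ∈ Q → B x q) → (∀ {q} → q ∈ Q → B y q) → 4 ≤ # link (∁ Q) h x y
    big {x} {y} cx cy = ≤-trans 4≤Q (#-mono Q (link (∁ Q) h x y)
      (λ q q∈ → (((λ ¬q → ¬q q∈) , hQ q∈) , cx q∈) , cy q∈))

  -- A path of three vertices inside Q compensates for a missing fourth x: three vertices x leave
  -- three gaps, filled by the path and by two single vertices of Q.
  no-path : ∀ (Q : Sub N) h x₁ x₂ x₃ q₁ q q₂ → Unique (x₁ ∷ x₂ ∷ x₃ ∷ []) → All (B h) (x₁ ∷ x₂ ∷ x₃ ∷ []) →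
    All (λ y → ∀ {q} → q ∈ Q → B y q) (h ∷ x₁ ∷ x₂ ∷ x₃ ∷ []) → q₁ ∈ Q → q ∈ Q → q₂ ∈ Q → q₁ ≢ q₂ → B q q₁ → B
      q q₂ → ¬ 5 ≤ # Q
  no-path Q h x₁ x₂ x₃ q₁ q q₂ ((x₁₂ ∷ x₁₃ ∷ []) ∷ (x₂₃ ∷ []) ∷ _) (s₁ ∷ s₂ ∷ s₃ ∷ [])
    (hQ ∷ c₁ ∷ c₂ ∷ c₃ ∷ []) ∈₁ ∈₀ ∈₂ q₁≢q₂ qq₁ qq₂ 5≤Q
    with pick Q (q₁ ∷ q ∷ q₂ ∷ []) (≤-trans (n≤1+n 4) 5≤Q)
  ... | q₃ , ∈₃ , q₃₁ ∷ q₃₀ ∷ q₃₂ ∷ [] with pick Q (q₁ ∷ q ∷ q₂ ∷ q₃ ∷ []) 5≤Q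
  ... | q₄ , ∈₄ , q₄₁ ∷ q₄₀ ∷ q₄₂ ∷ q₄₃ ∷ [] =
    no-wheel h x₁ q₁ q q₂ x₂ q₃ x₃ q₄
      ((B-≢ (c₁ ∈₁) ∷ B-≢ (c₁ ∈₀) ∷ B-≢ (c₁ ∈₂) ∷ x₁₂ ∷ B-≢ (c₁ ∈₃) ∷ x₁₃ ∷ B-≢ (c₁ ∈₄) ∷ []) ∷
       (≢-sym (B-≢ qq₁) ∷ q₁≢q₂ ∷ ≢-sym (B-≢ (c₂ ∈₁)) ∷ ≢-sym q₃₁ ∷ ≢-sym (B-≢ (c₃ ∈₁)) ∷ ≢-sym q₄₁ ∷ []) ∷
       (B-≢ qq₂ ∷ ≢-sym (B-≢ (c₂ ∈₀)) ∷ ≢-sym q₃₀ ∷ ≢-sym (B-≢ (c₃ ∈₀)) ∷ ≢-sym q₄₀ ∷ []) ∷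
       (≢-sym (B-≢ (c₂ ∈₂)) ∷ ≢-sym q₃₂ ∷ ≢-sym (B-≢ (c₃ ∈₂)) ∷ ≢-sym q₄₂ ∷ []) ∷
       (B-≢ (c₂ ∈₃) ∷ x₂₃ ∷ B-≢ (c₂ ∈₄) ∷ []) ∷ (≢-sym (B-≢ (c₃ ∈₃)) ∷ ≢-sym q₄₃ ∷ []) ∷ (B-≢ (c₃ ∈₄) ∷ []) ∷
         [] ∷ [])
      (s₁ ∷ hQ ∈₁ ∷ hQ ∈₀ ∷ hQ ∈₂ ∷ s₂ ∷ hQ ∈₃ ∷ s₃ ∷ hQ ∈₄ ∷ [])
      (c₁ ∈₁) (B-sym qq₁) qq₂ (B-sym (c₂ ∈₂)) (c₂ ∈₃) (B-sym (c₃ ∈₃)) (c₃ ∈₄) (c₁ ∈₄)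

  -- This is `no-four` with the sides exchanged: q is the hub, the missed vertices are on the rim
  -- and X fills the gaps.
  few-misses : ∀ {X Q} → Complete X Q → 4 ≤ # X → ∀ {q} → q ∈ Q → # (Q ∩ b q) ≤ 3
  few-misses {X} {Q} complete 4≤X {q} q∈ = ≮⇒≥ λ 4≤ → four (choose (Q ∩ b q) 4 4≤)
    where
    four : ¬ ∃ λ l → length l ≡ 4 × Unique l × All (_∈ (Q ∩ b q)) l
    four (x₁ ∷ x₂ ∷ x₃ ∷ x₄ ∷ [] , _ , uniq , all) = no-four X q x₁ x₂ x₃ x₄ uniq (All.map proj₂ all)
      (All.map (λ (p∈ , _) {_} x∈ → B-sym (complete x∈ p∈)) all) (λ x∈ → B-sym (complete x∈ q∈)) 4≤X

  Attached : Sub N → Sub N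
  Attached X = sub (λ z → ∃ λ x → x ∈ X × G z x) (λ z → Fin.any? (λ x → dec X x ×-dec dec (g z) x))

  -- The hypothesis `isolated` records the failure to find a leg: an edge of Z at an attached vertex
  -- would prolong an edge from X to a path.
  module _ (X Z : Sub N) (disjoint : ∀ {x} → x ∈ X → x ∉ Z)
           (isolated : ∀ {z z′} → z ∈ Z → z′ ∈ Z → z ∈ Attached X → ¬ G z z′) where

    near far : Sub N
    near = Z ∩ Attached X
    far  = Z ∩ ∁ (Attached X)

    near-complete : ∀ {z z′} → z ∈ near → z′ ∈ Z → z ≢ z′ → B z z′
    near-complete (z∈ , za) z′∈ z≢z′ = ¬G⇒B z≢z′ (isolated z∈ z′∈ za)

    far-complete : Complete X far
    far-complete x∈ (q∈ , ¬qa) = ¬G⇒B (λ { refl → disjoint x∈ q∈ }) (λ e → ¬qa (_ , x∈ , G-sym e))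

    near-far : Complete near far
    near-far zn@(_ , za) (q∈ , ¬qa) = near-complete zn q∈ (λ { refl → ¬qa za })

    -- Two such vertices a and c would give a wheel with hub a. If `far` has four vertices, they
    -- fill the gaps between c and three vertices of X. Otherwise `near` has five vertices, four of
    -- them on the rim, and each gap can use three further vertices of Z and at least |X| - 3 ≥ 1 of
    -- X.
    few-near : 4 ≤ # X → 8 ≤ # Z → (∀ {z x x′} → z ∈ Z → x ∈ X → x′ ∈ X → x ≢ x′ → G z x → ¬ G z x′)
      → # near ≤ 1
    few-near 4≤X 8≤Z single-neighbour = ≮⇒≥ λ 2≤ → by-far 2≤ (4 ≤? # far)
      where
      misses : ∀ {z} → z ∈ Z → # X ≤ # (X ∩ b z) + 1
      misses {z} z∈ = ≮⇒≥ λ neg → refute (# X ∷ # (X ∩ g z) ∷ # (X ∩ b z) ∷ [])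
          (1 · var 0 ≼ var 1 ⊕ var 2 ∷ 1 · var 1 ≼ lit 1 ∷ 1 · lit 1 ⊕ (var 2 ⊕ lit 1) ≼ var 0 ∷ [])
          (≤-reflexive (#-split X z (λ z∈X → disjoint z∈X z∈))) one neg
        where
        one : # (X ∩ g z) ≤ 1
        one = ≮⇒≥ λ 2≤ → two (choose (X ∩ g z) 2 2≤)
          where
          two : ¬ ∃ λ l → length l ≡ 2 × Unique l × All (_∈ (X ∩ g z)) l
          two (x ∷ x′ ∷ [] , _ , (x≢x′ ∷ []) ∷ _ , (x∈ , e) ∷ (x′∈ , e′) ∷ []) = single-neighbour z∈ x∈ x′∈
            x≢x′ e e′
      by-far : 2 ≤ # near → Dec (4 ≤ # far) → ⊥
      by-far 2≤ (yes 4≤far) with choose near 2 2≤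
      ... | a ∷ c ∷ [] , _ , (a≢c ∷ []) ∷ _ , an ∷ cn ∷ []
        with choose (X ∩ b a) 3 (≮⇒≥ λ neg → refute (# X ∷ # (X ∩ b a) ∷ [])
            (1 · var 0 ≼ var 1 ⊕ lit 1 ∷ 1 · lit 4 ≼ var 0 ∷ 1 · lit 1 ⊕ var 1 ≼ lit 3 ∷ [])
            (misses (proj₁ an)) 4≤X neg)
      ... | x₁ ∷ x₂ ∷ x₃ ∷ [] , _ , uniq , (∈₁ , s₁) ∷ (∈₂ , s₂) ∷ (∈₃ , s₃) ∷ [] =
        no-four far a c x₁ x₂ x₃ ((c≢ ∈₁ ∷ c≢ ∈₂ ∷ c≢ ∈₃ ∷ []) ∷ uniq)
          (near-complete an (proj₁ cn) a≢c ∷ s₁ ∷ s₂ ∷ s₃ ∷ [])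
          (near-far cn ∷ far-complete ∈₁ ∷ far-complete ∈₂ ∷ far-complete ∈₃ ∷ []) (near-far an) 4≤far
        where
        c≢ : ∀ {x} → x ∈ X → c ≢ x
        c≢ x∈ refl = disjoint x∈ (proj₁ cn)
      by-far 2≤ (no ¬4≤far) with choose near 5 (≮⇒≥ λ neg → refute (# Z ∷ # near ∷ # far ∷ [])
          (1 · var 0 ≼ var 1 ⊕ var 2 ∷ 1 · lit 8 ≼ var 0 ∷ 1 · lit 1 ⊕ var 2 ≼ lit 4 ∷
            1 · lit 1 ⊕ var 1 ≼ lit 5 ∷ [])
          (≤-reflexive (#-∩-∁ Z (Attached X))) 8≤Z (≰⇒> ¬4≤far) neg)
      ... | a ∷ l@(z₁ ∷ z₂ ∷ z₃ ∷ z₄ ∷ []) , _ , a∉l@(a₁ ∷ a₂ ∷ a₃ ∷ a₄ ∷ []) ∷ uniq , an ∷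
        ns@(n₁ ∷ n₂ ∷ n₃ ∷ n₄ ∷ []) =
        no-links (elements l) a z₁ z₂ z₃ z₄ uniq (All.tabulate id)
          (near-complete an (proj₁ n₁) a₁ ∷ near-complete an (proj₁ n₂) a₂ ∷ near-complete an (proj₁ n₃) a₃ ∷
            near-complete an (proj₁ n₄) a₄ ∷ [])
          (big (Any.here refl) (Any.there (Any.here refl)))
          (≤-trans (s≤s (s≤s z≤n)) (big (Any.there (Any.here refl)) (Any.there (Any.there (Any.here refl)))))
          (≤-trans (s≤s z≤n) (big (Any.there (Any.there (Any.here refl)))
            (Any.there (Any.there (Any.there (Any.here refl))))))
          (≤-trans (s≤s (s≤s (s≤s z≤n))) (big (Any.there (Any.there (Any.there (Any.here refl))))
            (Any.here refl)))
        where
        W : Sub N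
        W = Z ∖ (a ∷ l)
        big : ∀ {x y} → x ∈ˡ l → y ∈ˡ l → 4 ≤ # link (elements l) a x y
        big {x} {y} x∈l y∈l = ≮⇒≥ λ neg → refute (# Z ∷ # W ∷ # X ∷ # (X ∩ b a) ∷ # (X ∩ b x) ∷ # (X ∩ b y) ∷
          # (X ∩ b a ∩ b x ∩ b y) ∷ # link (elements l) a x y ∷ [])
            (1 · var 0 ≼ var 1 ⊕ lit 5 ∷ 1 · lit 8 ≼ var 0 ∷ 1 · var 2 ≼ var 3 ⊕ lit 1 ∷
              1 · var 2 ≼ var 4 ⊕ lit 1 ∷ 1 · var 2 ≼ var 5 ⊕ lit 1 ∷
              1 · var 3 ⊕ var 4 ⊕ var 5 ≼ 2 ⊛ var 2 ⊕ var 6 ∷ 1 · lit 4 ≼ var 2 ∷ 1 · var 1 ⊕ var 6 ≼ var 7 ∷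
              1 · lit 1 ⊕ var 7 ≼ lit 4 ∷ [])
            (#-∖ Z (a ∷ l)) 8≤Z (misses (proj₁ an)) (misses (proj₁ xn)) (misses (proj₁ yn))
              (#-triple X (b a) (b x) (b y)) 4≤X (#-disjoint W (X ∩ b a ∩ b x ∩ b y) (link (elements l) a x y)
              W⊆ X⊆ (λ _ (w∈ , _) (((x∈ , _) , _) , _) → disjoint x∈ w∈)) neg
          where
          xn = All.lookup ns x∈l
          yn = All.lookup ns y∈l
          W⊆ : ∀ w → w ∈ W → w ∈ link (elements l) a x y
          W⊆ w (w∈ , w≢a ∷ w∉l) = (((λ w∈l → All.lookup w∉l w∈l refl) , near-complete an w∈ (≢-sym w≢a))
            , near-complete xn w∈ (≢-sym (All.lookup w∉l x∈l))) ,
              near-complete yn w∈ (≢-sym (All.lookup w∉l y∈l))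
          X⊆ : ∀ w → w ∈ X ∩ b a ∩ b x ∩ b y → w ∈ link (elements l) a x y
          X⊆ w (((w∈ , ba) , bx) , by) = (((λ w∈l → disjoint w∈ (proj₁ (All.lookup ns w∈l))) , ba) , bx) , by

    -- Of five, one would be the hub and four lie on the rim, with the four remaining vertices of Z
    -- in the gaps.
    near-bound : 9 ≤ # Z → # near ≤ 4
    near-bound 9≤Z = ≮⇒≥ λ 5≤ → five (choose near 5 5≤)
      where
      five : ¬ ∃ λ l → length l ≡ 5 × Unique l × All (_∈ near) l
      five (a ∷ l@(z₁ ∷ z₂ ∷ z₃ ∷ z₄ ∷ []) , _ , a∉l@(a₁ ∷ a₂ ∷ a₃ ∷ a₄ ∷ []) ∷ uniq , an ∷ n₁ ∷ n₂ ∷ n₃ ∷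
        n₄ ∷ []) =
        no-four (Z ∖ (a ∷ l)) a z₁ z₂ z₃ z₄ uniq
          (near-complete an (proj₁ n₁) a₁ ∷ near-complete an (proj₁ n₂) a₂ ∷ near-complete an (proj₁ n₃) a₃ ∷
            near-complete an (proj₁ n₄) a₄ ∷ [])
          (out n₁ (Any.there (Any.here refl)) ∷ out n₂ (Any.there (Any.there (Any.here refl))) ∷
           out n₃ (Any.there (Any.there (Any.there (Any.here refl)))) ∷
             out n₄ (Any.there (Any.there (Any.there (Any.there (Any.here refl))))) ∷ [])
          (out an (Any.here refl))
          (≮⇒≥ λ neg → refute (# Z ∷ # (Z ∖ (a ∷ l)) ∷ [])
              (1 · var 0 ≼ var 1 ⊕ lit 5 ∷ 1 · lit 9 ≼ var 0 ∷ 1 · lit 1 ⊕ var 1 ≼ lit 4 ∷ [])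
              (#-∖ Z (a ∷ l)) 9≤Z neg)
        where
        out : ∀ {z} → z ∈ near → z ∈ˡ (a ∷ l) → ∀ {q} → q ∈ Z ∖ (a ∷ l) → B z q
        out zn z∈l (q∈ , q∉) = near-complete zn q∈ (≢-sym (All.lookup q∉ z∈l))

-- Attaching two paths to the neighbours of a vertex

module Extension {N : ℕ} (F : Graph N) (m : ℕ) (1≤m : 1 ≤ m)
  (noTree : ¬ (S22 (7 + m) ⊆ F)) (noWheel : ¬ (W8 ⊆ complement F)) where

  open Coloured F
  open Wheelless F noWheel
  open Blocks F noWheel
  open Treeless F m noTree

  -- `Thin` is one vertex short of n and pays for it with at most one miss per vertex; `thicken`
  -- turns it into a `Block`.
  Block Thin : Set₁
  Block = ∃₂ λ Q X → 7 + m ≤ # Q × 4 ≤ # X × Complete X Q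
  Thin  = ∃₂ λ Q X → 6 + m ≤ # Q × 4 ≤ # X × Complete X Q × (∀ {q} → q ∈ Q → # (Q ∩ b q) ≤ 1)

  module _ (v : Fin N) (Γ : Sub N) (Γ⊆ : ∀ x → x ∈ Γ → G v x) where

    Z : Sub N
    Z = ∁ Γ ∖ (v ∷ [])

    v∉Γ : v ∉ Γ
    v∉Γ v∈ = G-≢ (Γ⊆ v v∈) refl

    apart : ∀ {x z} → x ∈ Γ → z ∈ Z → x ≢ z
    apart x∈ (z∉ , _) refl = z∉ x∈

    Path : Fin N → Fin N → Fin N → Set
    Path γ z y = γ ∈ Γ × z ∈ Z × y ∈ Z × G γ z × G z y

    Path? : Dec (∃ λ γ → ∃₂ (Path γ))
    Path? = Fin.any? λ γ → Fin.any? λ z → Fin.any? λ y →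
      dec Γ γ ×-dec dec Z z ×-dec dec Z y ×-dec dec (g γ) z ×-dec dec (g z) y

    module OnePath (2+m≤Γ : 2 + m ≤ # Γ) {γ z y} (γ∈ : γ ∈ Γ) (z∈ : z ∈ Z) (y∈ : y ∈ Z) (γz : G γ z) (zy : G z y) where

      Γ′ Z′ : Sub N
      Γ′ = Γ ∖ (γ ∷ [])
      Z′ = Z ∖ (z ∷ y ∷ [])

      -- Every leg vertex is listed in `l` or lies in Z, so Γ without `l` still supplies m leaves.
      -- The length of `l` is the price of a path: 2 if q and r lie in Z, 3 if one of them lies in
      -- Γ.
      no-second : ∀ p q r l → length l + m ≤ # Γ → p ∈ Γ′ → (q ∈ Γ′ × q ∈ˡ l) ⊎ q ∈ Z′ → (r ∈ Γ′ × r ∈ˡ l) ⊎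
        r ∈ Z′ →
        γ ∈ˡ l → p ∈ˡ l → p ≢ r → G p q → ¬ G q r
      no-second p q r l l+m≤Γ p∈ q∈ r∈ γ∈l p∈l p≢r pq qr with fresh (inj₁ (p∈ , p∈l)) | fresh q∈ | fresh r∈
        where
        fresh : ∀ {x} → (x ∈ Γ′ × x ∈ˡ l) ⊎ x ∈ Z′ → (x ≢ v × x ≢ γ × x ≢ z × x ≢ y) × (x ∈ˡ l ⊎ x ∈ Z)
        fresh (inj₁ ((x∈ , x≢γ ∷ []) , x∈l)) = ((λ { refl → v∉Γ x∈ }) , x≢γ , apart x∈ z∈ , apart x∈ y∈) ,
          inj₁ x∈l
        fresh (inj₂ (x∈@(_ , x≢v ∷ []) , x≢z ∷ x≢y ∷ [])) = (x≢v , ≢-sym (apart γ∈ x∈) , x≢z , x≢y) , inj₂ x∈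
      ... | (pv , pγ , pz , py) , p-in | (qv , qγ , qz , qy) , q-in | (rv , rγ , rz , ry) , r-in =
        no-tree v γ z y p q r (Γ ∖ l)
          ((G-≢ (Γ⊆ γ γ∈) ∷ ≢v z∈ ∷ ≢v y∈ ∷ ≢-sym pv ∷ ≢-sym qv ∷ ≢-sym rv ∷ []) ∷
           (G-≢ γz ∷ apart γ∈ y∈ ∷ ≢-sym pγ ∷ ≢-sym qγ ∷ ≢-sym rγ ∷ []) ∷
           (G-≢ zy ∷ ≢-sym pz ∷ ≢-sym qz ∷ ≢-sym rz ∷ []) ∷ (≢-sym py ∷ ≢-sym qy ∷ ≢-sym ry ∷ []) ∷
           (G-≢ pq ∷ p≢r ∷ []) ∷ (G-≢ qr ∷ []) ∷ [] ∷ [])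
          (Γ⊆ γ γ∈) γz zy (Γ⊆ p (proj₁ p∈)) pq qr
          (λ x (x∈ , x∉l) → Γ⊆ x x∈ , All.map (avoid x∈ x∉l)
            (inj₁ γ∈l ∷ inj₂ z∈ ∷ inj₂ y∈ ∷ p-in ∷ q-in ∷ r-in ∷ []))
          (≮⇒≥ λ neg → refute (m ∷ # Γ ∷ # (Γ ∖ l) ∷ length l ∷ [])
              (1 · var 3 ⊕ var 0 ≼ var 1 ∷ 1 · var 1 ≼ var 2 ⊕ var 3 ∷ 1 · lit 1 ⊕ var 2 ≼ var 0 ∷ [])
              l+m≤Γ (#-∖ Γ l) neg)
        where
        ≢v : ∀ {x} → x ∈ Z → v ≢ x
        ≢v (_ , x≢v ∷ []) = ≢-sym x≢v
        avoid : ∀ {x} → x ∈ Γ → All (x ≢_) l → ∀ {w} → w ∈ˡ l ⊎ w ∈ Z → x ≢ w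
        avoid x∈ x∉l (inj₁ w∈l) = All.lookup x∉l w∈l
        avoid x∈ x∉l (inj₂ w∈)  = apart x∈ w∈

      isolated : ∀ {a a′} → a ∈ Z′ → a′ ∈ Z′ → a ∈ Attached Γ′ → ¬ G a a′
      isolated a∈ a′∈ (x , x∈ , ax) = no-second x _ _ (γ ∷ x ∷ []) 2+m≤Γ x∈ (inj₂ a∈) (inj₂ a′∈)
        (Any.here refl) (Any.there (Any.here refl)) (apart (proj₁ x∈) (proj₁ a′∈)) (G-sym ax)

      single-neighbour : 3 + m ≤ # Γ → ∀ {a x x′} → a ∈ Z′ → x ∈ Γ′ → x′ ∈ Γ′ → x ≢ x′ → G a x → ¬ G a x′
      single-neighbour 3+m≤Γ {a} {x} {x′} a∈ x∈ x′∈ x≢x′ ax = no-second x a x′ (γ ∷ x ∷ x′ ∷ []) 3+m≤Γ x∈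
        (inj₂ a∈)
        (inj₁ (x′∈ , Any.there (Any.there (Any.here refl)))) (Any.here refl) (Any.there (Any.here refl)) x≢x′
          (G-sym ax)

      no-detour : 3 + m ≤ # Γ → ∀ {a x x′} → a ∈ Z′ → x ∈ Γ′ → x′ ∈ Γ′ → G x′ x → ¬ G x a
      no-detour 3+m≤Γ {a} {x} {x′} a∈ x∈ x′∈ = no-second x′ x a (γ ∷ x′ ∷ x ∷ []) 3+m≤Γ x′∈
        (inj₁ (x∈ , Any.there (Any.there (Any.here refl)))) (inj₂ a∈) (Any.here refl)
          (Any.there (Any.here refl)) (apart (proj₁ x′∈) (proj₁ a∈))

      disjoint : ∀ {x} → x ∈ Γ′ → x ∉ Z′
      disjoint x∈ x∈Z = apart (proj₁ x∈) (proj₁ x∈Z) refl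

      -- At most one vertex a is attached. If it exists and x is its neighbour, then x has no
      -- neighbour x′ in Γ′, as x′xa would be a second path. So x can be the hub in `no-path`, and
      -- no vertex of `far′` has two misses.
      block-or-thin : 3 + m ≤ # Γ → 5 ≤ # Γ → 9 + m ≤ # Z → Block ⊎ Thin
      block-or-thin 3+m≤Γ 5≤Γ 9+m≤Z = cases (1 ≤? # near′)
        where
        near′ far′ : Sub N
        near′ = near Γ′ Z′ disjoint isolated
        far′  = far Γ′ Z′ disjoint isolated
        4≤Γ′ : 4 ≤ # Γ′
        4≤Γ′ = ≮⇒≥ λ neg → refute (# Γ ∷ # Γ′ ∷ [])
            (1 · var 0 ≼ var 1 ⊕ lit 1 ∷ 1 · lit 5 ≼ var 0 ∷ 1 · lit 1 ⊕ var 1 ≼ lit 4 ∷ [])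
            (#-∖ Γ (γ ∷ [])) 5≤Γ neg
        7+m≤Z′ : 7 + m ≤ # Z′
        7+m≤Z′ = ≮⇒≥ λ neg → refute (m ∷ # Z ∷ # Z′ ∷ [])
            (1 · var 1 ≼ var 2 ⊕ lit 2 ∷ 1 · lit 9 ⊕ var 0 ≼ var 1 ∷ 1 · lit 1 ⊕ var 2 ≼ lit 7 ⊕ var 0 ∷ [])
            (#-∖ Z (z ∷ y ∷ [])) 9+m≤Z neg
        near≤1 : # near′ ≤ 1
        near≤1 = few-near Γ′ Z′ disjoint isolated 4≤Γ′ (≤-trans (+-monoʳ-≤ 7 1≤m) 7+m≤Z′)
          (single-neighbour 3+m≤Γ)
        split : # Z′ ≡ # near′ + # far′
        split = #-∩-∁ Z′ (Attached Γ′)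
        cases : Dec (1 ≤ # near′) → Block ⊎ Thin
        cases (no ¬1≤) = inj₁ (far′ , Γ′ ,
          (≮⇒≥ λ neg → refute (m ∷ # Z′ ∷ # near′ ∷ # far′ ∷ [])
              (1 · var 1 ≼ var 2 ⊕ var 3 ∷ 1 · lit 1 ⊕ var 2 ≼ lit 1 ∷ 1 · lit 7 ⊕ var 0 ≼ var 1 ∷
                1 · lit 1 ⊕ var 3 ≼ lit 7 ⊕ var 0 ∷ [])
              (≤-reflexive split) (≰⇒> ¬1≤) 7+m≤Z′ neg)
          , 4≤Γ′ , far-complete Γ′ Z′ disjoint isolated)
        cases (yes 1≤) = thin (nonempty near′ 1≤)
          where
          6+m≤far : 6 + m ≤ # far′
          6+m≤far = ≮⇒≥ λ neg → refute (m ∷ # Z′ ∷ # near′ ∷ # far′ ∷ [])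
              (1 · var 1 ≼ var 2 ⊕ var 3 ∷ 1 · var 2 ≼ lit 1 ∷ 1 · lit 7 ⊕ var 0 ≼ var 1 ∷
                1 · lit 1 ⊕ var 3 ≼ lit 6 ⊕ var 0 ∷ [])
              (≤-reflexive split) near≤1 7+m≤Z′ neg
          thin : ∃ (_∈ near′) → Block ⊎ Thin
          thin (a , a∈ , x , x∈ , ax) = inj₂ (far′ , Γ′ , 6+m≤far , 4≤Γ′ , complete ,
            λ q∈ → ≮⇒≥ λ 2≤ → two q∈ (choose _ 2 2≤)
            (choose (Γ′ ∖ (x ∷ [])) 3 (≮⇒≥ λ neg → refute (# Γ′ ∷ # (Γ′ ∖ (x ∷ [])) ∷ [])
                (1 · var 0 ≼ var 1 ⊕ lit 1 ∷ 1 · lit 4 ≼ var 0 ∷ 1 · lit 1 ⊕ var 1 ≼ lit 3 ∷ [])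
                (#-∖ Γ′ (x ∷ [])) 4≤Γ′ neg)))
            where
            complete : Complete Γ′ far′
            complete = far-complete Γ′ Z′ disjoint isolated
            spoke : ∀ {x′} → x′ ∈ Γ′ ∖ (x ∷ []) → B x x′
            spoke (x′∈ , x′≢x ∷ []) = ¬G⇒B (≢-sym x′≢x) (λ e → no-detour 3+m≤Γ a∈ x∈ x′∈ (G-sym e) (G-sym ax))
            two : ∀ {q} → q ∈ far′ → (∃ λ l → length l ≡ 2 × Unique l × All (_∈ (far′ ∩ b q)) l) →
              ¬ (∃ λ l → length l ≡ 3 × Unique l × All (_∈ (Γ′ ∖ (x ∷ []))) l)
            two q∈ (q₁ ∷ q₂ ∷ [] , _ , (q₁≢q₂ ∷ []) ∷ _ , (∈₁ , e₁) ∷ (∈₂ , e₂) ∷ [])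
              (x₁ ∷ x₂ ∷ x₃ ∷ [] , _ , uniq , p₁ ∷ p₂ ∷ p₃ ∷ []) =
              no-path far′ x x₁ x₂ x₃ q₁ _ q₂ uniq (spoke p₁ ∷ spoke p₂ ∷ spoke p₃ ∷ [])
                (complete x∈ ∷ complete (proj₁ p₁) ∷ complete (proj₁ p₂) ∷ complete (proj₁ p₃) ∷ []) ∈₁ q∈ ∈₂
                  q₁≢q₂ e₁ e₂
                (≤-trans (m≤m+n 5 (1 + m)) 6+m≤far)

      -- If v has no neighbour in Z it replaces γ on the small side, which then keeps |Γ| vertices.
      -- This settles n = 8 when Γ has only four.
      module _ (vZ : ∀ {x} → x ∈ Z → B v x) where

        X : Sub N
        X = Γ′ ∪ single v

        X-disjoint : ∀ {x} → x ∈ X → x ∉ Z′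
        X-disjoint (inj₁ x∈) = disjoint x∈
        X-disjoint (inj₂ refl) ((_ , v≢v ∷ []) , _) = v≢v refl

        ¬Gv : ∀ {a} → a ∈ Z′ → ¬ G a v
        ¬Gv a∈ av = B⇒¬G (vZ (proj₁ a∈)) (G-sym av)

        X-isolated : ∀ {a a′} → a ∈ Z′ → a′ ∈ Z′ → a ∈ Attached X → ¬ G a a′
        X-isolated a∈ a′∈ (x , inj₁ x∈ , ax) = isolated a∈ a′∈ (x , x∈ , ax)
        X-isolated a∈ a′∈ (x , inj₂ refl , ax) = contradiction ax (¬Gv a∈)

        near-X far-X : Sub N
        near-X = near X Z′ X-disjoint X-isolated
        far-X  = far X Z′ X-disjoint X-isolated

        split-X : # Z′ ≡ # near-X + # far-X
        split-X = #-∩-∁ Z′ (Attached X)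

        complete-X : Complete X far-X
        complete-X = far-complete X Z′ X-disjoint X-isolated

        Γ<X : # Γ ≤ # X
        Γ<X = ≮⇒≥ λ neg → refute (# X ∷ # Γ′ ∷ # Γ ∷ # (single v) ∷ [])
            (1 · var 2 ≼ var 1 ⊕ lit 1 ∷ 1 · var 1 ⊕ var 3 ≼ var 0 ∷ 1 · lit 1 ≼ var 3 ∷
              1 · lit 1 ⊕ var 0 ≼ var 2 ∷ [])
            (#-∖ Γ (γ ∷ [])) (#-disjoint Γ′ (single v) X (λ _ → inj₁) (λ _ → inj₂)
              (λ { _ x∈ refl → v∉Γ (proj₁ x∈) })) (≤-reflexive (sym (#-single v))) neg

        block : 3 + m ≤ # Γ → 10 + m ≤ # Z → Block
        block 3+m≤Γ 10+m≤Z = far-X , X ,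
          (≮⇒≥ λ neg → refute (m ∷ # Z′ ∷ # near-X ∷ # far-X ∷ [])
              (1 · var 1 ≼ var 2 ⊕ var 3 ∷ 1 · var 2 ≼ lit 1 ∷ 1 · lit 8 ⊕ var 0 ≼ var 1 ∷
                1 · lit 1 ⊕ var 3 ≼ lit 7 ⊕ var 0 ∷ [])
              (≤-reflexive split-X) (few-near X Z′ X-disjoint X-isolated 4≤X (≤-trans (m≤m+n 8 m) 8+m≤Z′)
                X-single) 8+m≤Z′ neg)
          , 4≤X , complete-X
          where
          X-single : ∀ {a x x′} → a ∈ Z′ → x ∈ X → x′ ∈ X → x ≢ x′ → G a x → ¬ G a x′
          X-single a∈ (inj₁ x∈) (inj₁ x′∈) x≢x′ ax ax′ = single-neighbour 3+m≤Γ a∈ x∈ x′∈ x≢x′ ax ax′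
          X-single a∈ (inj₂ refl) _ _ ax _ = ¬Gv a∈ ax
          X-single a∈ _ (inj₂ refl) _ _ ax′ = ¬Gv a∈ ax′
          4≤X : 4 ≤ # X
          4≤X = ≤-trans (≤-trans (+-monoʳ-≤ 3 1≤m) 3+m≤Γ) Γ<X
          8+m≤Z′ : 8 + m ≤ # Z′
          8+m≤Z′ = ≮⇒≥ λ neg → refute (m ∷ # Z ∷ # Z′ ∷ [])
              (1 · var 1 ≼ var 2 ⊕ lit 2 ∷ 1 · lit 10 ⊕ var 0 ≼ var 1 ∷ 1 · lit 1 ⊕ var 2 ≼ lit 8 ⊕ var 0 ∷
                [])
              (#-∖ Z (z ∷ y ∷ [])) 10+m≤Z neg

        -- Compared with `near-bound`, the vertex v takes the place of one attached vertex on the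
        -- rim.
        near-X≤3 : 8 ≤ # Z′ → # near-X ≤ 3
        near-X≤3 8≤Z′ = ≮⇒≥ λ 4≤ → four (choose near-X 4 4≤)
          where
          four : ¬ ∃ λ l → length l ≡ 4 × Unique l × All (_∈ near-X) l
          four (a ∷ l@(z₁ ∷ z₂ ∷ z₃ ∷ []) , _ , (a₁ ∷ a₂ ∷ a₃ ∷ []) ∷ (z₁₂ ∷ z₁₃ ∷ []) ∷ (z₂₃ ∷ []) ∷ _ , an ∷
            n₁ ∷ n₂ ∷ n₃ ∷ []) =
            no-four (Z′ ∖ (a ∷ l)) a z₁ z₂ z₃ v ((z₁₂ ∷ z₁₃ ∷ ≢v n₁ ∷ []) ∷ (z₂₃ ∷ ≢v n₂ ∷ []) ∷
              (≢v n₃ ∷ []) ∷ [] ∷ [])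
              (complete an (proj₁ n₁) a₁ ∷ complete an (proj₁ n₂) a₂ ∷ complete an (proj₁ n₃) a₃ ∷
                B-sym (vZ (proj₁ (proj₁ an))) ∷ [])
              (out n₁ (Any.there (Any.here refl)) ∷ out n₂ (Any.there (Any.there (Any.here refl))) ∷
               out n₃ (Any.there (Any.there (Any.there (Any.here refl)))) ∷ (λ q∈ → vZ (proj₁ (proj₁ q∈))) ∷
                 [])
              (out an (Any.here refl))
              (≮⇒≥ λ neg → refute (# Z′ ∷ # (Z′ ∖ (a ∷ l)) ∷ [])
                  (1 · var 0 ≼ var 1 ⊕ lit 4 ∷ 1 · lit 8 ≼ var 0 ∷ 1 · lit 1 ⊕ var 1 ≼ lit 4 ∷ [])
                  (#-∖ Z′ (a ∷ l)) 8≤Z′ neg)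
            where
            complete : ∀ {z z′} → z ∈ near-X → z′ ∈ Z′ → z ≢ z′ → B z z′
            complete = near-complete X Z′ X-disjoint X-isolated
            ≢v : ∀ {x} → x ∈ near-X → x ≢ v
            ≢v (((_ , x≢v ∷ []) , _) , _) = x≢v
            out : ∀ {z} → z ∈ near-X → z ∈ˡ (a ∷ l) → ∀ {q} → q ∈ Z′ ∖ (a ∷ l) → B z q
            out zn z∈l (q∈ , q∉) = complete zn q∈ (≢-sym (All.lookup q∉ z∈l))

    module NoPath (no-path′ : ¬ ∃ λ γ → ∃₂ (Path γ)) where

      disjoint : ∀ {x} → x ∈ Γ → x ∉ Z
      disjoint x∈ z∈ = apart x∈ z∈ refl

      isolated : ∀ {z z′} → z ∈ Z → z′ ∈ Z → z ∈ Attached Γ → ¬ G z z′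
      isolated z∈ z′∈ (x , x∈ , zx) zz′ = no-path′ (x , _ , _ , x∈ , z∈ , z′∈ , G-sym zx , zz′)

      near′ far′ : Sub N
      near′ = near Γ Z disjoint isolated
      far′  = far Γ Z disjoint isolated

      split : # Z ≡ # near′ + # far′
      split = #-∩-∁ Z (Attached Γ)

      complete : Complete Γ far′
      complete = far-complete Γ Z disjoint isolated

      block : 3 + m ≤ # Γ → 9 + m ≤ # Z → 5 ≤ # Γ ⊎ (∀ {x} → x ∈ Z → B v x) → Block
      block 3+m≤Γ 9+m≤Z spare = cases (3 ≤? # near′) (Fin.any? λ w → dec Z w ×-dec dec (g v) w)
        where
        4≤Γ : 4 ≤ # Γ
        4≤Γ = ≤-trans (+-monoʳ-≤ 3 1≤m) 3+m≤Γ
        near≤4 : # near′ ≤ 4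
        near≤4 = near-bound Γ Z disjoint isolated (≤-trans (m≤m+n 9 m) 9+m≤Z)
        4≤far : 4 ≤ # far′
        4≤far = ≮⇒≥ λ neg → refute (m ∷ # Z ∷ # near′ ∷ # far′ ∷ [])
            (1 · var 1 ≼ var 2 ⊕ var 3 ∷ 1 · var 2 ≼ lit 4 ∷ 1 · lit 9 ⊕ var 0 ≼ var 1 ∷
              1 · lit 1 ⊕ var 3 ≼ lit 4 ∷ [])
            (≤-reflexive split) near≤4 9+m≤Z neg
        cases : Dec (3 ≤ # near′) → Dec (∃ λ w → w ∈ Z × G v w) → Block
        cases (no ¬3≤) _ = far′ , Γ ,
          (≮⇒≥ λ neg → refute (m ∷ # Z ∷ # near′ ∷ # far′ ∷ [])
              (1 · var 1 ≼ var 2 ⊕ var 3 ∷ 1 · lit 1 ⊕ var 2 ≼ lit 3 ∷ 1 · lit 9 ⊕ var 0 ≼ var 1 ∷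
                1 · lit 1 ⊕ var 3 ≼ lit 7 ⊕ var 0 ∷ [])
              (≤-reflexive split) (≰⇒> ¬3≤) 9+m≤Z neg)
          , 4≤Γ , complete
        -- The sides are swapped: `far′` becomes the small side, while Γ, v and the attached
        -- vertices add up to (3 + m) + 1 + 3 = 7 + m.
        cases (yes 3≤) (no ¬w) = Γ ∪ single v ∪ near′ , far′ ,
          (≮⇒≥ λ neg → refute (m ∷ # Γ ∷ # (single v) ∷ # near′ ∷ # (Γ ∪ single v) ∷
            # (Γ ∪ single v ∪ near′) ∷ [])
              (1 · lit 3 ⊕ var 0 ≼ var 1 ∷ 1 · lit 1 ≼ var 2 ∷ 1 · lit 3 ≼ var 3 ∷ 1 · var 1 ⊕ var 2 ≼ var 4 ∷
                1 · var 4 ⊕ var 3 ≼ var 5 ∷ 1 · lit 1 ⊕ var 5 ≼ lit 7 ⊕ var 0 ∷ [])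
              3+m≤Γ (≤-reflexive (sym (#-single v))) 3≤
                (#-disjoint Γ (single v) (Γ ∪ single v) (λ _ → inj₁) (λ _ → inj₂) (λ { _ x∈ refl → v∉Γ x∈ }))
                (#-disjoint (Γ ∪ single v) near′ (Γ ∪ single v ∪ near′) (λ _ → inj₁) (λ _ → inj₂)
                (λ { _ (inj₁ x∈) (z∈ , _) → apart x∈ z∈ refl ; _ (inj₂ refl) ((_ , v≢v ∷ []) , _) → v≢v refl
                })) neg)
          , 4≤far , λ q∈ x∈ → B-sym (side x∈ q∈)
          where
          side : Complete (Γ ∪ single v ∪ near′) far′
          side (inj₁ (inj₁ x∈))   q∈ = complete x∈ q∈
          side (inj₁ (inj₂ refl)) q∈@(q∈Z@(_ , q≢v ∷ []) , _) = ¬G⇒B (≢-sym q≢v) (λ vq → ¬w (_ , q∈Z , vq))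
          side (inj₂ x∈)          q∈ = near-far Γ Z disjoint isolated x∈ q∈
        -- Two attached vertices other than w become the middles of legs whose other vertices lie in
        -- Γ. The legs consume four vertices of Γ, one more than 3 + m can spare, and w makes up for
        -- it as a leaf.
        cases (yes 3≤) (yes (w , w∈ , vw)) = ⊥-elim (tree (choose (near′ ∖ (w ∷ [])) 2
            (≮⇒≥ λ neg → refute (# near′ ∷ # (near′ ∖ (w ∷ [])) ∷ [])
                (1 · var 0 ≼ var 1 ⊕ lit 1 ∷ 1 · lit 3 ≼ var 0 ∷ 1 · lit 1 ⊕ var 1 ≼ lit 2 ∷ [])
                (#-∖ near′ (w ∷ [])) 3≤ neg)))
          where
          5≤Γ : 5 ≤ # Γ
          5≤Γ = [ id , (λ vZ → contradiction vw (B⇒¬G (vZ w∈))) ]′ spare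
          -- Two B-neighbours in Γ and two further attached vertices would be rim vertices around
          -- the hub a, with `far′` in the gaps.
          one : ∀ {a} → a ∈ near′ → # (Γ ∩ b a) ≤ 1
          one {a} a∈ = ≮⇒≥ λ 2≤ → two (choose (near′ ∖ (a ∷ [])) 2
            (≮⇒≥ λ neg → refute (# near′ ∷ # (near′ ∖ (a ∷ [])) ∷ [])
              (1 · var 0 ≼ var 1 ⊕ lit 1 ∷ 1 · lit 3 ≼ var 0 ∷ 1 · lit 1 ⊕ var 1 ≼ lit 2 ∷ [])
              (#-∖ near′ (a ∷ [])) 3≤ neg))
            (choose (Γ ∩ b a) 2 2≤)
            where
            two : (∃ λ l → length l ≡ 2 × Unique l × All (_∈ (near′ ∖ (a ∷ []))) l) → ¬ ∃ λ l → length
              l ≡ 2 × Unique l × All (_∈ (Γ ∩ b a)) l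
            two (c ∷ d ∷ [] , _ , (c≢d ∷ []) ∷ _ , (c∈ , c≢a ∷ []) ∷ (d∈ , d≢a ∷ []) ∷ [])
              (x₁ ∷ x₂ ∷ [] , _ , uniq , (∈₁ , s₁) ∷ (∈₂ , s₂) ∷ []) =
              no-four far′ a c d x₁ x₂ ((c≢d ∷ ≢-sym (apart ∈₁ (proj₁ c∈)) ∷ ≢-sym (apart ∈₂ (proj₁ c∈)) ∷ [])
                ∷ (≢-sym (apart ∈₁ (proj₁ d∈)) ∷ ≢-sym (apart ∈₂ (proj₁ d∈)) ∷ []) ∷ uniq)
                (near-complete Γ Z disjoint isolated a∈ (proj₁ c∈) (≢-sym c≢a) ∷
                  near-complete Γ Z disjoint isolated a∈ (proj₁ d∈) (≢-sym d≢a) ∷ s₁ ∷ s₂ ∷ [])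
                (near-far Γ Z disjoint isolated c∈ ∷ near-far Γ Z disjoint isolated d∈ ∷ complete ∈₁ ∷
                  complete ∈₂ ∷ [])
                (near-far Γ Z disjoint isolated a∈) 4≤far
          four-G : ∀ {a} → a ∈ near′ → 4 ≤ # (Γ ∩ g a)
          four-G {a} a∈ = ≮⇒≥ λ neg → refute (# Γ ∷ # (Γ ∩ g a) ∷ # (Γ ∩ b a) ∷ [])
              (1 · var 0 ≼ var 1 ⊕ var 2 ∷ 1 · var 2 ≼ lit 1 ∷ 1 · lit 5 ≼ var 0 ∷ 1 · lit 1 ⊕ var 1 ≼ lit 4 ∷
                [])
              (≤-reflexive (#-split Γ a (λ a∈Γ → apart a∈Γ (proj₁ a∈) refl))) (one a∈) 5≤Γ neg
          tree : ¬ ∃ λ l → length l ≡ 2 × Unique l × All (_∈ (near′ ∖ (w ∷ []))) l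
          tree (a ∷ c ∷ [] , _ , (a≢c ∷ []) ∷ _ , (a∈ , a≢w ∷ []) ∷ (c∈ , c≢w ∷ []) ∷ [])
            with choose (Γ ∩ g a) 2 (≤-trans (m≤m+n 2 2) (four-G a∈))
          ... | γ₁ ∷ γ₂ ∷ [] , _ , (γ₁₂ ∷ []) ∷ _ , (∈₁ , e₁) ∷ (∈₂ , e₂) ∷ []
            with pick (Γ ∩ g c) (γ₁ ∷ γ₂ ∷ []) (≤-trans (m≤m+n 3 1) (four-G c∈))
          ... | γ₃ , (∈₃ , e₃) , γ₃₁ ∷ γ₃₂ ∷ []
            with pick (Γ ∩ g c) (γ₁ ∷ γ₂ ∷ γ₃ ∷ []) (four-G c∈)
          ... | γ₄ , (∈₄ , e₄) , γ₄₁ ∷ γ₄₂ ∷ γ₄₃ ∷ [] =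
            no-tree v γ₁ a γ₂ γ₃ c γ₄ (Γ ∪ single w ∖ (γ₁ ∷ γ₂ ∷ γ₃ ∷ γ₄ ∷ []))
              ((G-≢ (Γ⊆ _ ∈₁) ∷ ≢v a∈ ∷ G-≢ (Γ⊆ _ ∈₂) ∷ G-≢ (Γ⊆ _ ∈₃) ∷ ≢v c∈ ∷ G-≢ (Γ⊆ _ ∈₄) ∷ []) ∷
               (apart ∈₁ (proj₁ a∈) ∷ γ₁₂ ∷ ≢-sym γ₃₁ ∷ apart ∈₁ (proj₁ c∈) ∷ ≢-sym γ₄₁ ∷ []) ∷
               (≢-sym (apart ∈₂ (proj₁ a∈)) ∷ ≢-sym (apart ∈₃ (proj₁ a∈)) ∷ a≢c ∷
                 ≢-sym (apart ∈₄ (proj₁ a∈)) ∷ []) ∷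
               (≢-sym γ₃₂ ∷ apart ∈₂ (proj₁ c∈) ∷ ≢-sym γ₄₂ ∷ []) ∷ (apart ∈₃ (proj₁ c∈) ∷ ≢-sym γ₄₃ ∷ []) ∷
               (≢-sym (apart ∈₄ (proj₁ c∈)) ∷ []) ∷ [] ∷ [])
              (Γ⊆ _ ∈₁) (G-sym e₁) e₂ (Γ⊆ _ ∈₃) (G-sym e₃) e₄
              leaves
              (≮⇒≥ λ neg → refute (m ∷ # Γ ∷ # (single w) ∷ # (Γ ∪ single w) ∷
                # (Γ ∪ single w ∖ (γ₁ ∷ γ₂ ∷ γ₃ ∷ γ₄ ∷ [])) ∷ [])
                  (1 · lit 3 ⊕ var 0 ≼ var 1 ∷ 1 · lit 1 ≼ var 2 ∷ 1 · var 1 ⊕ var 2 ≼ var 3 ∷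
                    1 · var 3 ≼ var 4 ⊕ lit 4 ∷ 1 · lit 1 ⊕ var 4 ≼ var 0 ∷ [])
                  3+m≤Γ (≤-reflexive (sym (#-single w)))
                    (#-disjoint Γ (single w) (Γ ∪ single w) (λ _ → inj₁) (λ _ → inj₂)
                    (λ { _ x∈ refl → apart x∈ w∈ refl })) (#-∖ (Γ ∪ single w) (γ₁ ∷ γ₂ ∷ γ₃ ∷ γ₄ ∷ [])) neg)
            where
            ≢v : ∀ {x} → x ∈ near′ → v ≢ x
            ≢v ((_ , x≢v ∷ []) , _) = ≢-sym x≢v
            leaves : ∀ x → x ∈ Γ ∪ single w ∖ (γ₁ ∷ γ₂ ∷ γ₃ ∷ γ₄ ∷ []) → G v x × All (x ≢_)
              (γ₁ ∷ a ∷ γ₂ ∷ γ₃ ∷ c ∷ γ₄ ∷ [])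
            leaves x (inj₁ x∈ , x₁ ∷ x₂ ∷ x₃ ∷ x₄ ∷ []) = Γ⊆ x x∈ , x₁ ∷ apart x∈ (proj₁ a∈) ∷ x₂ ∷ x₃ ∷
              apart x∈ (proj₁ c∈) ∷ x₄ ∷ []
            leaves x (inj₂ refl , x₁ ∷ x₂ ∷ x₃ ∷ x₄ ∷ []) = vw , x₁ ∷ ≢-sym a≢w ∷ x₂ ∷ x₃ ∷ ≢-sym c≢w ∷ x₄ ∷
              []

-- All degrees at most n − 5

module LowDegree {N : ℕ} (F : Graph N) (m : ℕ) (2≤m : 2 ≤ m) (N≡ : 13 + 2 * m ≡ N)
  (noTree : ¬ (S22 (7 + m) ⊆ F)) (noWheel : ¬ (W8 ⊆ complement F)) where

  open Coloured F
  open Wheelless F noWheel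
  open Blocks F noWheel
  open Extension F m (≤-trans (n≤1+n 1) 2≤m) noTree noWheel

  module _ (low : ∀ x → # (g x) ≤ 2 + m) where

    module _ (Q X : Sub N) (complete : Complete X Q) (5+m≤Q : 5 + m ≤ # Q) (4≤X : 4 ≤ # X) where

      -- Of its at most 2 + m neighbours, q spends at least |Q| - 4 inside Q, by `few-misses`.
      few-out : ∀ {q} → q ∈ Q → # Q + # (∁ Q ∩ g q) ≤ 6 + m
      few-out {q} q∈ = ≮⇒≥ λ neg → refute (m ∷ # Q ∷ # (g q) ∷ # (g q ∩ Q) ∷ # (g q ∩ ∁ Q) ∷ # (Q ∩ g q) ∷
        # (∁ Q ∩ g q) ∷ # (Q ∩ b q) ∷ [])
          (1 · var 2 ≼ lit 2 ⊕ var 0 ∷ 1 · var 3 ⊕ var 4 ≼ var 2 ∷ 1 · var 7 ≼ lit 3 ∷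
            1 · var 1 ≼ lit 1 ⊕ (var 5 ⊕ var 7) ∷ 1 · var 5 ≼ var 3 ∷ 1 · var 6 ≼ var 4 ∷
            1 · lit 1 ⊕ (lit 6 ⊕ var 0) ≼ var 1 ⊕ var 6 ∷ [])
          (low q) (≤-reflexive (sym (#-∩-∁ (g q) Q))) (few-misses {X} {Q} complete 4≤X q∈) (#-split-∈ Q q)
            (#-mono (Q ∩ g q) (g q ∩ Q) (λ _ (u , w) → w , u))
            (#-mono (∁ Q ∩ g q) (g q ∩ ∁ Q) (λ _ (u , w) → w , u)) neg

      many-outside : ∀ x → 10 + m ≤ # (b x ∩ ∁ Q) + # Q
      many-outside x = ≮⇒≥ λ neg → refute (N ∷ m ∷ # (g x) ∷ # (b x) ∷ # (b x ∩ Q) ∷ # (b x ∩ ∁ Q) ∷ # Q ∷ [])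
          (1 · lit 13 ⊕ 2 ⊛ var 1 ≼ var 0 ∷ 1 · var 0 ≼ lit 1 ⊕ (var 2 ⊕ var 3) ∷ 1 · var 2 ≼ lit 2 ⊕ var 1 ∷
            1 · var 3 ≼ var 4 ⊕ var 5 ∷ 1 · var 4 ≼ var 6 ∷ 1 · lit 1 ⊕ (var 5 ⊕ var 6) ≼ lit 10 ⊕ var 1 ∷ [])
          (≤-reflexive N≡) (≤-reflexive (#-degrees x)) (low x) (≤-reflexive (#-∩-∁ (b x) Q))
            (#-mono (b x ∩ Q) Q (λ _ → proj₂)) neg

      -- Now `few-out` leaves no edge between Q and the rest. A vertex x of X has (10 + m) - (6 + m)
      -- = 4 B-neighbours outside Q, which with Q form a wheel around x.
      large : ¬ 6 + m ≤ # Q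
      large 6+m≤Q with nonempty X (≤-trans (s≤s z≤n) 4≤X)
      ... | x , x∈ with choose (b x ∩ ∁ Q) 4
                 (+-cancelʳ-≤ (# Q) 4 (# (b x ∩ ∁ Q)) (≤-trans (+-monoʳ-≤ 4 Q≤) (many-outside x)))
        where
        Q≤ : # Q ≤ 6 + m
        Q≤ with nonempty Q (≤-trans (s≤s z≤n) 6+m≤Q)
        ... | q , q∈ = ≤-trans (m≤m+n _ _) (few-out q∈)
      ... | p₁ ∷ p₂ ∷ p₃ ∷ p₄ ∷ [] , _ , uniq , all =
        no-four Q x p₁ p₂ p₃ p₄ uniq (All.map proj₁ all) (All.map (λ (_ , p∉) {_} q∈ → out p∉ q∈) all)
          (complete x∈) (≤-trans (m≤m+n 4 (2 + m)) 6+m≤Q)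
        where
        out : ∀ {p q} → p ∉ Q → q ∈ Q → B p q
        out {p} {q} p∉ q∈ = ¬G⇒B (λ { refl → p∉ q∈ }) λ pq → <⇒≱
          (≤-trans (s≤s 6+m≤Q) (≤-reflexive (+-comm 1 (# Q))))
          (≤-trans (+-monoʳ-≤ (# Q) (≤-trans (≤-reflexive (sym (#-single p)))
            (#-mono (single p) (∁ Q ∩ g q) (λ { _ refl → p∉ , G-sym pq })))) (few-out q∈))

      module _ (x : Fin N) (x∈ : x ∈ X) (Q<6+m : # Q < 6 + m) where

        P : Sub N
        P = b x ∩ ∁ Q

        w : Fin N → ℕ
        w p = # (Q ∩ g p)

        5≤P : 5 ≤ # P
        5≤P = ≮⇒≥ λ neg → refute (m ∷ # P ∷ # Q ∷ [])
            (1 · lit 10 ⊕ var 0 ≼ var 1 ⊕ var 2 ∷ 1 · lit 1 ⊕ var 2 ≼ lit 6 ⊕ var 0 ∷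
              1 · lit 1 ⊕ var 1 ≼ lit 5 ∷ [])
            (many-outside x) Q<6+m neg

        drop : ∀ l k {_ : True (k + length l ≤? 5)} → k ≤ # (P ∖ l)
        drop l k {h} = +-cancelʳ-≤ (length l) k (# (P ∖ l)) (≤-trans (toWitness h) (≤-trans 5≤P (#-∖ P l)))

        -- With |Q| ≥ 5 + m a vertex of Q has at most one neighbour outside Q.
        separate : ∀ {p p′} → p ∈ P → p′ ∈ P → p ≢ p′ → ∀ q → q ∈ Q ∩ g p → q ∉ Q ∩ g p′
        separate {p} {p′} (_ , p∉) (_ , p′∉) p≢p′ q (q∈ , pq) (_ , p′q) = ⊥-elim
          (refute (m ∷ # Q ∷ # (∁ Q ∩ g q) ∷ [])
            (1 · var 1 ⊕ var 2 ≼ lit 6 ⊕ var 0 ∷ 1 · lit 5 ⊕ var 0 ≼ var 1 ∷ 1 · lit 2 ≼ var 2 ∷ [])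
            (few-out q∈) 5+m≤Q (#-unique (∁ Q ∩ g q) (p ∷ p′ ∷ []) ((p≢p′ ∷ []) ∷ [] ∷ [])
              ((p∉ , G-sym pq) ∷ (p′∉ , G-sym p′q) ∷ [])))

        sum≤ : ∀ {p₀ p₁ p₂ p₃} → Unique (p₀ ∷ p₁ ∷ p₂ ∷ p₃ ∷ []) → All (_∈ P) (p₀ ∷ p₁ ∷ p₂ ∷ p₃ ∷ []) → w
          p₀ + w p₁ + (w p₂ + w p₃) ≤ # Q
        sum≤ {p₀} {p₁} {p₂} {p₃} ((n₀₁ ∷ n₀₂ ∷ n₀₃ ∷ []) ∷ (n₁₂ ∷ n₁₃ ∷ []) ∷ (n₂₃ ∷ []) ∷ _)
          (∈₀ ∷ ∈₁ ∷ ∈₂ ∷ ∈₃ ∷ []) =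
          (≮⇒≥ λ neg → refute (w p₀ ∷ w p₁ ∷ w p₂ ∷ w p₃ ∷ # (W p₀ ∪ W p₁) ∷ # (W p₂ ∪ W p₃) ∷ # Q ∷ [])
              (1 · var 0 ⊕ var 1 ≼ var 4 ∷ 1 · var 2 ⊕ var 3 ≼ var 5 ∷ 1 · var 4 ⊕ var 5 ≼ var 6 ∷
                1 · lit 1 ⊕ var 6 ≼ var 0 ⊕ var 1 ⊕ (var 2 ⊕ var 3) ∷ [])
              (#-disjoint (W p₀) (W p₁) (W p₀ ∪ W p₁) (λ _ → inj₁) (λ _ → inj₂) (separate ∈₀ ∈₁ n₀₁))
                (#-disjoint (W p₂) (W p₃) (W p₂ ∪ W p₃) (λ _ → inj₁) (λ _ → inj₂) (separate ∈₂ ∈₃ n₂₃))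
                (#-disjoint (W p₀ ∪ W p₁) (W p₂ ∪ W p₃) Q in-Q in-Q
                (λ { q (inj₁ u) (inj₁ t) → separate ∈₀ ∈₂ n₀₂ q u t ; q (inj₁ u) (inj₂ t) → separate ∈₀ ∈₃ n₀₃
                q u t ; q (inj₂ u) (inj₁ t) → separate ∈₁ ∈₂ n₁₂ q u t ; q (inj₂ u) (inj₂ t) → separate ∈₁ ∈₃
                n₁₃ q u t })) neg)
          where
          W : Fin N → Sub N
          W p = Q ∩ g p
          in-Q : ∀ {p p′} q → q ∈ W p ∪ W p′ → q ∈ Q
          in-Q q (inj₁ u) = proj₁ u
          in-Q q (inj₂ u) = proj₁ u

        -- The pair spoils at most half of Q, and |Q| ≥ 7 leaves four.
        big-link : ∀ {p p′} → p ∈ P → p′ ∈ P → 2 * (w p + w p′) ≤ # Q → 4 ≤ # link (∁ Q) x p p′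
        big-link {p} {p′} (_ , p∉) (_ , p′∉) h = ≮⇒≥ λ neg → refute
          (m ∷ # Q ∷ w p ∷ w p′ ∷ # (Q ∩ b p) ∷ # (Q ∩ b p′) ∷ # (Q ∩ b p ∩ b p′) ∷ # link (∁ Q) x p p′ ∷ [])
            (1 · 2 ⊛ (var 2 ⊕ var 3) ≼ var 1 ∷ 2 · var 1 ≼ var 2 ⊕ var 4 ∷ 2 · var 1 ≼ var 3 ⊕ var 5 ∷
              2 · var 4 ⊕ var 5 ≼ var 1 ⊕ var 6 ∷ 1 · lit 5 ⊕ var 0 ≼ var 1 ∷ 1 · lit 2 ≼ var 0 ∷
              2 · var 6 ≼ var 7 ∷ 2 · lit 1 ⊕ var 7 ≼ lit 4 ∷ [])
            h (≤-reflexive (#-split Q p p∉)) (≤-reflexive (#-split Q p′ p′∉)) (#-pair Q (b p) (b p′)) 5+m≤Q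
              2≤m (#-mono (Q ∩ b p ∩ b p′) (link (∁ Q) x p p′)
              (λ _ ((q∈ , bp) , bp′) → (((λ ¬q → ¬q q∈) , complete x∈ q∈) , bp) , bp′)) neg

        -- The outside neighbour with the most G-neighbours in Q is dropped, and the next two are
        -- kept apart on the rim; this bounds the G-neighbours of consecutive ones by half of Q.
        small : ⊥
        small with argmax w P (≤-trans (s≤s z≤n) 5≤P)
        ... | p₀ , ∈₀ , max₀ with argmax w (P ∖ (p₀ ∷ [])) (drop (p₀ ∷ []) 1)
        ... | p₁ , (∈₁ , n₁₀ ∷ []) , max₁ with argmax w (P ∖ (p₀ ∷ p₁ ∷ [])) (drop (p₀ ∷ p₁ ∷ []) 1)
        ... | p₂ , (∈₂ , n₂₀ ∷ n₂₁ ∷ []) , max₂ with choose (P ∖ (p₀ ∷ p₁ ∷ p₂ ∷ [])) 2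
          (drop (p₀ ∷ p₁ ∷ p₂ ∷ []) 2)
        ... | p₃ ∷ p₄ ∷ [] , _ , (n₃₄ ∷ []) ∷ _ , (∈₃ , n₃₀ ∷ n₃₁ ∷ n₃₂ ∷ []) ∷ (∈₄ , n₄₀ ∷ n₄₁ ∷ n₄₂ ∷ []) ∷
          [] =
          no-links (∁ Q) x p₁ p₃ p₂ p₄
            ((≢-sym n₃₁ ∷ ≢-sym n₂₁ ∷ ≢-sym n₄₁ ∷ []) ∷ (n₃₂ ∷ n₃₄ ∷ []) ∷ (≢-sym n₄₂ ∷ []) ∷ [] ∷ [])
            (proj₂ ∈₁ ∷ proj₂ ∈₃ ∷ proj₂ ∈₂ ∷ proj₂ ∈₄ ∷ []) (proj₁ ∈₁ ∷ proj₁ ∈₃ ∷ proj₁ ∈₂ ∷ proj₁ ∈₄ ∷ [])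
            (big-link ∈₁ ∈₃ (first ∈₃ n₃₀ n₃₁ n₃₂))
            (≤-trans (s≤s (s≤s z≤n)) (big-link ∈₃ ∈₂
              (≤-trans (*-monoʳ-≤ 2 (≤-reflexive (+-comm (w p₃) (w p₂)))) (second ∈₃ n₃₀ n₃₁ n₃₂))))
            (≤-trans (s≤s z≤n) (big-link ∈₂ ∈₄ (second ∈₄ n₄₀ n₄₁ n₄₂)))
            (≤-trans (s≤s (s≤s (s≤s z≤n))) (big-link ∈₄ ∈₁
              (≤-trans (*-monoʳ-≤ 2 (≤-reflexive (+-comm (w p₄) (w p₁)))) (first ∈₄ n₄₀ n₄₁ n₄₂))))
          where
          total : ∀ {p} → p ∈ P → p ≢ p₀ → p ≢ p₁ → p ≢ p₂ → w p₀ + w p₁ + (w p₂ + w p) ≤ # Q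
          total p∈ pn₀ pn₁ pn₂ = sum≤ ((≢-sym n₁₀ ∷ ≢-sym n₂₀ ∷ ≢-sym pn₀ ∷ []) ∷
            (≢-sym n₂₁ ∷ ≢-sym pn₁ ∷ []) ∷ (≢-sym pn₂ ∷ []) ∷ [] ∷ []) (∈₀ ∷ ∈₁ ∷ ∈₂ ∷ p∈ ∷ [])
          first : ∀ {p} → p ∈ P → p ≢ p₀ → p ≢ p₁ → p ≢ p₂ → 2 * (w p₁ + w p) ≤ # Q
          first {p} p∈ pn₀ pn₁ pn₂ = ≮⇒≥ λ neg → refute (w p₀ ∷ w p₁ ∷ w p₂ ∷ w p ∷ # Q ∷ [])
              (1 · var 0 ⊕ var 1 ⊕ (var 2 ⊕ var 3) ≼ var 4 ∷ 1 · var 1 ≼ var 0 ∷ 1 · var 3 ≼ var 2 ∷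
                1 · lit 1 ⊕ var 4 ≼ 2 ⊛ (var 1 ⊕ var 3) ∷ [])
              (total p∈ pn₀ pn₁ pn₂) (max₀ p₁ ∈₁) (max₂ p (p∈ , pn₀ ∷ pn₁ ∷ [])) neg
          second : ∀ {p} → p ∈ P → p ≢ p₀ → p ≢ p₁ → p ≢ p₂ → 2 * (w p₂ + w p) ≤ # Q
          second {p} p∈ pn₀ pn₁ pn₂ = ≮⇒≥ λ neg → refute (w p₀ ∷ w p₁ ∷ w p₂ ∷ w p ∷ # Q ∷ [])
              (1 · var 0 ⊕ var 1 ⊕ (var 2 ⊕ var 3) ≼ var 4 ∷ 1 · var 2 ≼ var 0 ∷ 1 · var 3 ≼ var 1 ∷
                1 · lit 1 ⊕ var 4 ≼ 2 ⊛ (var 2 ⊕ var 3) ∷ [])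
              (total p∈ pn₀ pn₁ pn₂) (max₀ p₂ ∈₂) (max₁ p (p∈ , pn₀ ∷ [])) neg

      impossible : ⊥
      impossible with 6 + m ≤? # Q | nonempty X (≤-trans (s≤s z≤n) 4≤X)
      ... | yes h | _ = large h
      ... | no ¬h | x , x∈ = small x x∈ (≰⇒> ¬h)

    -- Z has at least 10 + m vertices. Removing z, y and three attached vertices, or just four
    -- attached ones if no path exists, leaves the required 5 + m.
    no-vertex : ∀ v → ¬ 2 + m ≤ # (g v)
    no-vertex v 2+m≤Γ = cases (Path? v (g v) Γ⊆)
      where
      Γ⊆ : ∀ x → x ∈ g v → G v x
      Γ⊆ _ = id
      vZ : ∀ {x} → x ∈ Z v (g v) Γ⊆ → B v x
      vZ (¬vx , x≢v ∷ []) = ¬G⇒B (≢-sym x≢v) ¬vx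
      10+m≤Z : 10 + m ≤ # (Z v (g v) Γ⊆)
      10+m≤Z = ≮⇒≥ λ neg → refute (m ∷ N ∷ # (g v) ∷ # (∁ (g v)) ∷ # (Z v (g v) Γ⊆) ∷ [])
          (1 · lit 13 ⊕ 2 ⊛ var 0 ≼ var 1 ∷ 1 · var 1 ≼ var 2 ⊕ var 3 ∷ 1 · var 2 ≼ lit 2 ⊕ var 0 ∷
            1 · var 3 ≼ var 4 ⊕ lit 1 ∷ 1 · lit 1 ⊕ var 4 ≼ lit 10 ⊕ var 0 ∷ [])
          (≤-reflexive N≡) (≤-reflexive (#-∁ (g v))) (low v) (#-∖ (∁ (g v)) (v ∷ [])) neg
      4≤Γ : 4 ≤ # (g v)
      4≤Γ = ≤-trans (+-monoʳ-≤ 2 2≤m) 2+m≤Γ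
      cases : Dec _ → ⊥
      cases (yes (γ , z , y , γ∈ , z∈ , y∈ , γz , zy)) = impossible (far-X vZ) (X vZ) (complete-X vZ)
        (≮⇒≥ λ neg → refute (m ∷ # (Z v (g v) Γ⊆) ∷ # Z′ ∷ # (near-X vZ) ∷ # (far-X vZ) ∷ [])
            (1 · lit 10 ⊕ var 0 ≼ var 1 ∷ 1 · var 1 ≼ var 2 ⊕ lit 2 ∷ 1 · var 3 ≼ lit 3 ∷
              1 · var 2 ≼ var 3 ⊕ var 4 ∷ 1 · lit 1 ⊕ var 4 ≼ lit 5 ⊕ var 0 ∷ [])
            10+m≤Z (#-∖ (Z v (g v) Γ⊆) (z ∷ y ∷ [])) (near-X≤3 vZ 8≤Z′) (≤-reflexive (split-X vZ)) neg)
        (≤-trans 4≤Γ (Γ<X vZ))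
        where
        open OnePath v (g v) Γ⊆ 2+m≤Γ γ∈ z∈ y∈ γz zy
        8≤Z′ : 8 ≤ # Z′
        8≤Z′ = ≮⇒≥ λ neg → refute (m ∷ # (Z v (g v) Γ⊆) ∷ # Z′ ∷ [])
            (1 · lit 10 ⊕ var 0 ≼ var 1 ∷ 1 · var 1 ≼ var 2 ⊕ lit 2 ∷ 1 · lit 1 ⊕ var 2 ≼ lit 8 ∷ [])
            10+m≤Z (#-∖ (Z v (g v) Γ⊆) (z ∷ y ∷ [])) neg
      cases (no ¬p) = impossible far′ (g v) complete
        (≮⇒≥ λ neg → refute (m ∷ # (Z v (g v) Γ⊆) ∷ # near′ ∷ # far′ ∷ [])
            (1 · lit 10 ⊕ var 0 ≼ var 1 ∷ 1 · var 2 ≼ lit 4 ∷ 1 · var 1 ≼ var 2 ⊕ var 3 ∷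
              1 · lit 1 ⊕ var 3 ≼ lit 5 ⊕ var 0 ∷ [])
            10+m≤Z (near-bound (g v) (Z v (g v) Γ⊆) disjoint isolated
              (≤-trans (m≤m+n 9 (1 + m)) (≤-trans (≤-reflexive (+-suc 9 m)) 10+m≤Z))) (≤-reflexive split) neg)
        4≤Γ
        where open NoPath v (g v) Γ⊆ ¬p

-- Almost complete sets

module Dense {N : ℕ} (F : Graph N) (m : ℕ) (1≤m : 1 ≤ m) (noTree : ¬ (S22 (7 + m) ⊆ F)) where

  open Coloured F
  open Treeless F m noTree

  -- Once the legs absorb whatever c misses, all remaining vertices of Q can serve as leaves.
  spanning : ∀ (Q : Sub N) c γ₁ z₁ y₁ γ₂ z₂ y₂ → let legs = γ₁ ∷ z₁ ∷ y₁ ∷ γ₂ ∷ z₂ ∷ y₂ ∷ [] in 7 + m ≤ # Q →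
    Unique (c ∷ legs) → G c γ₁ → G γ₁ z₁ → G z₁ y₁ → G c γ₂ → G γ₂ z₂ → G z₂ y₂ →
    (∀ {x} → x ∈ Q → B c x → x ∈ˡ legs) → ⊥
  spanning Q c γ₁ z₁ y₁ γ₂ z₂ y₂ 7+m≤Q uniq e₁ e₂ e₃ e₄ e₅ e₆ covered =
    no-tree c γ₁ z₁ y₁ γ₂ z₂ y₂ (Q ∖ (c ∷ legs)) uniq e₁ e₂ e₃ e₄ e₅ e₆
      (λ { x (x∈ , x≢c ∷ x∉) → ¬B⇒G (≢-sym x≢c) (λ cx → All.lookup x∉ (covered x∈ cx) refl) , x∉ })
      (≮⇒≥ λ neg → refute (m ∷ # Q ∷ # (Q ∖ (c ∷ legs)) ∷ [])
          (1 · lit 7 ⊕ var 0 ≼ var 1 ∷ 1 · var 1 ≼ var 2 ⊕ lit 7 ∷ 1 · lit 1 ⊕ var 2 ≼ var 0 ∷ [])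
          7+m≤Q (#-∖ Q (c ∷ legs)) neg)
    where
    legs : List (Fin N)
    legs = γ₁ ∷ z₁ ∷ y₁ ∷ γ₂ ∷ z₂ ∷ y₂ ∷ []

  module _ (Q : Sub N) (7+m≤Q : 7 + m ≤ # Q) (misses : ∀ {q} → q ∈ Q → # (Q ∩ b q) ≤ 3) where

    no-four-misses : ∀ {c x₁ x₂ x₃ x₄} → c ∈ Q → Unique (x₁ ∷ x₂ ∷ x₃ ∷ x₄ ∷ []) → ¬ All (_∈ (Q ∩ b c))
      (x₁ ∷ x₂ ∷ x₃ ∷ x₄ ∷ [])
    no-four-misses {c} c∈ uniq all = <⇒≱ (s≤s (misses c∈)) (#-unique (Q ∩ b c) _ uniq all)

    -- One leg would contain the edge u₁u₂ and the other u₃, which covers all that c misses. As c is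
    -- itself one of at most three misses of each u, the set W of at least four vertices offers each
    -- of them two neighbours.
    no-edge-missed : ∀ {c u₁ u₂} → c ∈ Q → 3 ≤ # (Q ∩ b c) → u₁ ∈ Q ∩ b c → u₂ ∈ Q ∩ b c → ¬ G u₁ u₂
    no-edge-missed {c} {u₁} {u₂} c∈ 3≤ u₁∈@(_ , cu₁) u₂∈@(_ , cu₂) u₁u₂ with pick (Q ∩ b c) (u₁ ∷ u₂ ∷ []) 3≤
    ... | u₃ , u₃∈@(_ , cu₃) , u₃≢u₁ ∷ u₃≢u₂ ∷ [] = start
      (choose (W ∩ g u₃) 2 (neighbours u₃∈ (Any.there (Any.there (Any.there (Any.here refl))))))
      where
      W : Sub N
      W = Q ∖ (c ∷ u₁ ∷ u₂ ∷ u₃ ∷ [])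
      missed : ∀ {x} → x ∈ Q → B c x → x ∈ˡ (u₁ ∷ u₂ ∷ u₃ ∷ [])
      missed {x} x∈ cx = decidable-stable (any? (x Fin.≟_) (u₁ ∷ u₂ ∷ u₃ ∷ [])) λ x∉ →
        no-four-misses c∈ (≢-all x∉ ∷ (G-≢ u₁u₂ ∷ ≢-sym u₃≢u₁ ∷ []) ∷ (≢-sym u₃≢u₂ ∷ []) ∷ [] ∷ [])
          ((x∈ , cx) ∷ u₁∈ ∷ u₂∈ ∷ u₃∈ ∷ [])
      c-W : ∀ {x} → x ∈ W → G c x
      c-W (x∈ , x≢c ∷ x∉) = ¬B⇒G (≢-sym x≢c) (λ cx → All.lookup x∉ (missed x∈ cx) refl)
      neighbours : ∀ {u} → u ∈ Q ∩ b c → u ∈ˡ (c ∷ u₁ ∷ u₂ ∷ u₃ ∷ []) → 2 ≤ # (W ∩ g u)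
      neighbours {u} (u∈ , cu) u∈l = ≮⇒≥ λ neg → refute
        (m ∷ # Q ∷ # W ∷ # (W ∩ g u) ∷ # (W ∩ b u) ∷ # (single c) ∷ # (Q ∩ b u) ∷ [])
          (1 · lit 7 ⊕ var 0 ≼ var 1 ∷ 1 · lit 1 ≼ var 0 ∷ 1 · var 1 ≼ var 2 ⊕ lit 4 ∷
            1 · var 2 ≼ var 3 ⊕ var 4 ∷ 1 · var 6 ≼ lit 3 ∷ 1 · lit 1 ≼ var 5 ∷ 1 · var 5 ⊕ var 4 ≼ var 6 ∷
            1 · lit 1 ⊕ var 3 ≼ lit 2 ∷ [])
          7+m≤Q 1≤m (#-∖ Q (c ∷ u₁ ∷ u₂ ∷ u₃ ∷ []))
            (≤-reflexive (#-split W u (λ (_ , u∉) → All.lookup u∉ u∈l refl))) (misses u∈)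
            (≤-reflexive (sym (#-single c))) (#-disjoint (single c) (W ∩ b u) (Q ∩ b u)
            (λ { _ refl → c∈ , B-sym cu }) (λ _ ((x∈ , _) , ux) → x∈ , ux)
            (λ { _ refl ((_ , c≢c ∷ _) , _) → c≢c refl })) neg
      ≢c : ∀ {x} → x ∈ W → c ≢ x
      ≢c (_ , x≢c ∷ _) = ≢-sym x≢c
      ≢₁ : ∀ {x} → x ∈ W → x ≢ u₁
      ≢₁ (_ , _ ∷ x≢ ∷ _) = x≢
      ≢₂ : ∀ {x} → x ∈ W → x ≢ u₂
      ≢₂ (_ , _ ∷ _ ∷ x≢ ∷ _) = x≢
      ≢₃ : ∀ {x} → x ∈ W → x ≢ u₃
      ≢₃ (_ , _ ∷ _ ∷ _ ∷ x≢ ∷ _) = x≢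
      -- Lets a leg enter the edge u₁u₂ at either end.
      record Orientation (u u′ : Fin N) : Set where
        field
          edge  : G u u′
          cu    : B c u
          cu′   : B c u′
          ≢u₃   : u ≢ u₃
          ′≢u₃  : u′ ≢ u₃
          ≢u    : ∀ {x} → x ∈ W → x ≢ u
          ≢u′   : ∀ {x} → x ∈ W → x ≢ u′
          cover : ∀ {l} → u ∈ˡ l → u′ ∈ˡ l → u₃ ∈ˡ l → ∀ {x} → x ∈ˡ (u₁ ∷ u₂ ∷ u₃ ∷ []) → x ∈ˡ l
      forwards : Orientation u₁ u₂
      forwards = record
        { edge = u₁u₂ ; cu = cu₁ ; cu′ = cu₂ ; ≢u₃ = ≢-sym u₃≢u₁ ; ′≢u₃ = ≢-sym u₃≢u₂ ; ≢u = ≢₁ ; ≢u′ = ≢₂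
        ; cover = λ { a b d (Any.here refl) → a ; a b d (Any.there (Any.here refl)) → b ; a b d
          (Any.there (Any.there (Any.here refl))) → d } }
      backwards : Orientation u₂ u₁
      backwards = record
        { edge = G-sym u₁u₂ ; cu = cu₂ ; cu′ = cu₁ ; ≢u₃ = ≢-sym u₃≢u₂ ; ′≢u₃ = ≢-sym u₃≢u₁ ; ≢u = ≢₂ ; ≢u′ =
          ≢₁
        ; cover = λ { a b d (Any.here refl) → b ; a b d (Any.there (Any.here refl)) → a ; a b d
          (Any.there (Any.there (Any.here refl))) → d } }
      module _ {u u′ : Fin N} (o : Orientation u u′) {γ₁ γ₂ w : Fin N} (∈₁ : γ₁ ∈ W) (∈₂ : γ₂ ∈ W)
        (w∈ : w ∈ W)
               (γ₁≢γ₂ : γ₁ ≢ γ₂) (γ₁≢w : γ₁ ≢ w) (γ₂≢w : γ₂ ≢ w) (γ₁u : G γ₁ u) (u₃w : G u₃ w) where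
        open Orientation o
        via-u₃ : ¬ G γ₂ u₃
        via-u₃ γ₂u₃ = spanning Q c γ₁ u u′ γ₂ u₃ w 7+m≤Q
          ((≢c ∈₁ ∷ B-≢ cu ∷ B-≢ cu′ ∷ ≢c ∈₂ ∷ B-≢ cu₃ ∷ ≢c w∈ ∷ []) ∷
            (≢u ∈₁ ∷ ≢u′ ∈₁ ∷ γ₁≢γ₂ ∷ ≢₃ ∈₁ ∷ γ₁≢w ∷ []) ∷
           (G-≢ edge ∷ ≢-sym (≢u ∈₂) ∷ ≢u₃ ∷ ≢-sym (≢u w∈) ∷ []) ∷
             (≢-sym (≢u′ ∈₂) ∷ ′≢u₃ ∷ ≢-sym (≢u′ w∈) ∷ []) ∷
           (≢₃ ∈₂ ∷ γ₂≢w ∷ []) ∷ (≢-sym (≢₃ w∈) ∷ []) ∷ [] ∷ [])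
          (c-W ∈₁) γ₁u edge (c-W ∈₂) γ₂u₃ u₃w
          (λ x∈ cx → cover (Any.there (Any.here refl)) (Any.there (Any.there (Any.here refl)))
            (Any.there (Any.there (Any.there (Any.there (Any.here refl))))) (missed x∈ cx))
        via-w : ¬ G γ₂ w
        via-w γ₂w = spanning Q c γ₁ u u′ γ₂ w u₃ 7+m≤Q
          ((≢c ∈₁ ∷ B-≢ cu ∷ B-≢ cu′ ∷ ≢c ∈₂ ∷ ≢c w∈ ∷ B-≢ cu₃ ∷ []) ∷
            (≢u ∈₁ ∷ ≢u′ ∈₁ ∷ γ₁≢γ₂ ∷ γ₁≢w ∷ ≢₃ ∈₁ ∷ []) ∷
           (G-≢ edge ∷ ≢-sym (≢u ∈₂) ∷ ≢-sym (≢u w∈) ∷ ≢u₃ ∷ []) ∷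
             (≢-sym (≢u′ ∈₂) ∷ ≢-sym (≢u′ w∈) ∷ ′≢u₃ ∷ []) ∷
           (γ₂≢w ∷ ≢₃ ∈₂ ∷ []) ∷ (≢₃ w∈ ∷ []) ∷ [] ∷ [])
          (c-W ∈₁) γ₁u edge (c-W ∈₂) γ₂w (G-sym u₃w)
          (λ x∈ cx → cover (Any.there (Any.here refl)) (Any.there (Any.there (Any.here refl)))
            (Any.there (Any.there (Any.there (Any.there (Any.there (Any.here refl)))))) (missed x∈ cx))
      start : ¬ ∃ λ l → length l ≡ 2 × Unique l × All (_∈ (W ∩ g u₃)) l
      start (w₁ ∷ w₂ ∷ [] , _ , (w₁≢w₂ ∷ []) ∷ _ , (∈₁ , e₁) ∷ (∈₂ , e₂) ∷ []) = first
        (Fin.any? (dec ((W ∖ (w₁ ∷ w₂ ∷ [])) ∩ (g u₁ ∪ g u₂))))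
        where
        first : Dec (∃ (_∈ ((W ∖ (w₁ ∷ w₂ ∷ [])) ∩ (g u₁ ∪ g u₂)))) → ⊥
        first (yes (γ , (γ∈ , γ≢w₁ ∷ γ≢w₂ ∷ []) , inj₁ e)) = via-u₃ forwards γ∈ ∈₂ ∈₁ γ≢w₂ γ≢w₁ (≢-sym w₁≢w₂)
          (G-sym e) e₁ (G-sym e₂)
        first (yes (γ , (γ∈ , γ≢w₁ ∷ γ≢w₂ ∷ []) , inj₂ e)) = via-u₃ backwards γ∈ ∈₂ ∈₁ γ≢w₂ γ≢w₁ (≢-sym w₁≢w₂)
          (G-sym e) e₁ (G-sym e₂)
        -- Only n = 8 is left: u₁ and u₂ are then G-adjacent to w₁ and w₂ alone among W.
        first (no ¬γ) with pick W (w₁ ∷ w₂ ∷ []) (≮⇒≥ λ neg → refute (m ∷ # Q ∷ # W ∷ [])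
            (1 · lit 7 ⊕ var 0 ≼ var 1 ∷ 1 · var 1 ≼ var 2 ⊕ lit 4 ∷ 1 · lit 1 ⊕ var 2 ≼ lit 3 ∷ [])
            7+m≤Q (#-∖ Q (c ∷ u₁ ∷ u₂ ∷ u₃ ∷ [])) neg)
        ... | w₃ , ∈₃ , w₃≢w₁ ∷ w₃≢w₂ ∷ [] = second (dec (g u₃) w₃)
          where
          u₁w₂ : G u₁ w₂
          u₁w₂ = decidable-stable (dec (g u₁) w₂) λ ¬e → <⇒≱ (neighbours u₁∈ (Any.there (Any.here refl)))
            (≤-trans (#-mono (W ∩ g u₁) (single w₁) (λ x (x∈ , e) → only ¬e x x∈ e))
              (≤-reflexive (#-single w₁)))
            where
            only : ¬ G u₁ w₂ → ∀ x → x ∈ W → G u₁ x → x ≡ w₁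
            only ¬e x x∈ e = decidable-stable (x Fin.≟ w₁) λ x≢w₁ → ¬γ
              (x , (x∈ , x≢w₁ ∷ (λ { refl → ¬e e }) ∷ []) , inj₁ e)
          second : Dec (G u₃ w₃) → ⊥
          second (yes e₃) = via-u₃ forwards ∈₂ ∈₁ ∈₃ (≢-sym w₁≢w₂) (≢-sym w₃≢w₂) (≢-sym w₃≢w₁) (G-sym u₁w₂) e₃
            (G-sym e₁)
          second (no ¬e₃) = via-w forwards ∈₂ ∈₃ ∈₁ (≢-sym w₃≢w₂) (≢-sym w₁≢w₂) w₃≢w₁ (G-sym u₁w₂) e₁
            (¬B⇒G w₃≢w₁ λ w₃w₁ → no-four-misses (proj₁ ∈₃)
              ((G-≢ u₁u₂ ∷ ≢-sym u₃≢u₁ ∷ ≢-sym (≢₁ ∈₁) ∷ []) ∷ (≢-sym u₃≢u₂ ∷ ≢-sym (≢₂ ∈₁) ∷ []) ∷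
                (≢-sym (≢₃ ∈₁) ∷ []) ∷ [] ∷ [])
              ((proj₁ u₁∈ , ¬G⇒B (≢₁ ∈₃) (λ e → ¬γ (w₃ , (∈₃ , w₃≢w₁ ∷ w₃≢w₂ ∷ []) , inj₁ (G-sym e)))) ∷
               (proj₁ u₂∈ , ¬G⇒B (≢₂ ∈₃) (λ e → ¬γ (w₃ , (∈₃ , w₃≢w₁ ∷ w₃≢w₂ ∷ []) , inj₂ (G-sym e)))) ∷
               (proj₁ u₃∈ , ¬G⇒B (≢₃ ∈₃) (λ e → ¬e₃ (G-sym e))) ∷ (proj₁ ∈₁ , w₃w₁) ∷ []))

    -- By `no-edge-missed` y misses the other two vertices missed by x, and x itself.
    mates : ∀ {x y} → x ∈ Q → 3 ≤ # (Q ∩ b x) → y ∈ Q ∩ b x → 3 ≤ # (Q ∩ b y)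
    mates {x} {y} x∈ 3≤ y∈@(_ , xy) = ≮⇒≥ λ neg → refute
      (# (Q ∩ b x) ∷ # (Q ∩ b y) ∷ # ((Q ∩ b x) ∖ (y ∷ [])) ∷ # (single x) ∷ [])
        (1 · lit 3 ≼ var 0 ∷ 1 · var 0 ≼ var 2 ⊕ lit 1 ∷ 1 · lit 1 ≼ var 3 ∷ 1 · var 3 ⊕ var 2 ≼ var 1 ∷
          1 · lit 1 ⊕ var 1 ≼ lit 3 ∷ [])
        3≤ (#-∖ (Q ∩ b x) (y ∷ [])) (≤-reflexive (sym (#-single x)))
          (#-disjoint (single x) ((Q ∩ b x) ∖ (y ∷ [])) (Q ∩ b y) (λ { _ refl → x∈ , B-sym xy })
          (λ { z (z∈@(z∈Q , _) , z≢y ∷ []) → z∈Q , ¬G⇒B (≢-sym z≢y) (no-edge-missed x∈ 3≤ y∈ z∈) })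
          (λ { _ refl ((_ , xx) , _) → B-≢ xx refl })) neg

    module _ {c u₁ u₂ : Fin N} (c≢u₁ : c ≢ u₁) (c≢u₂ : c ≢ u₂) (u₁≢u₂ : u₁ ≢ u₂) where

      rest : Sub N
      rest = Q ∖ (c ∷ u₁ ∷ u₂ ∷ [])

      rest-neighbours : ∀ k {u} → u ∈ˡ (c ∷ u₁ ∷ u₂ ∷ []) → # (rest ∩ b u) ≤ k → 4 + m ≤ # (rest ∩ g u) + k
      rest-neighbours k {u} u∈l h = ≮⇒≥ λ neg → refute
        (m ∷ k ∷ # Q ∷ # rest ∷ # (rest ∩ g u) ∷ # (rest ∩ b u) ∷ [])
          (1 · lit 7 ⊕ var 0 ≼ var 2 ∷ 1 · var 2 ≼ var 3 ⊕ lit 3 ∷ 1 · var 3 ≼ var 4 ⊕ var 5 ∷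
            1 · var 5 ≼ var 1 ∷ 1 · lit 1 ⊕ (var 4 ⊕ var 1) ≼ lit 4 ⊕ var 0 ∷ [])
          7+m≤Q (#-∖ Q (c ∷ u₁ ∷ u₂ ∷ [])) (≤-reflexive
            (#-split rest u (λ (_ , u∉) → All.lookup u∉ u∈l refl))) h neg

      rest-misses : ∀ {u} → u ∈ Q → # (rest ∩ b u) ≤ 3
      rest-misses {u} u∈ = ≤-trans (#-mono (rest ∩ b u) (Q ∩ b u) λ _ ((x∈ , _) , e) → x∈ , e) (misses u∈)

      rest-misses-1 : ∀ {u w} → # (Q ∩ b u) < 3 → w ∈ Q ∩ b u → w ∈ˡ (c ∷ u₁ ∷ u₂ ∷ []) → # (rest ∩ b u) ≤ 1
      rest-misses-1 {u} {w} <3 w∈ w∈l = ≮⇒≥ λ neg → refute (# (rest ∩ b u) ∷ # (single w) ∷ # (Q ∩ b u) ∷ [])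
          (1 · lit 1 ⊕ var 2 ≼ lit 3 ∷ 1 · lit 1 ≼ var 1 ∷ 1 · var 1 ⊕ var 0 ≼ var 2 ∷ 1 · lit 2 ≼ var 0 ∷ [])
          <3 (≤-reflexive (sym (#-single w))) (#-disjoint (single w) (rest ∩ b u) (Q ∩ b u)
            (λ { _ refl → w∈ }) (λ _ ((x∈ , _) , e) → x∈ , e)
            (λ { _ refl ((_ , w∉) , _) → All.lookup w∉ w∈l refl })) neg

      -- The vertices u₁ and u₂ become the middles of the legs; two of the four neighbours of u₁
      -- survive the choice of γ₂ and y₂.
      two-legs : (∀ {x} → x ∈ Q → B c x → x ≡ u₁ ⊎ x ≡ u₂) → 4 ≤ # (rest ∩ g u₁) → ¬ 2 ≤ # (rest ∩ g u₂)
      two-legs covered 4≤ 2≤ with choose (rest ∩ g u₂) 2 2≤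
      ... | γ₂ ∷ y₂ ∷ [] , _ , (γ₂≢y₂ ∷ []) ∷ _ , (∈₁@(_ , γ₂c ∷ γ₂u₁ ∷ γ₂u₂ ∷ []) , e₁) ∷
        ((_ , y₂c ∷ y₂u₁ ∷ y₂u₂ ∷ []) , e₂) ∷ []
        with choose ((rest ∩ g u₁) ∖ (γ₂ ∷ y₂ ∷ [])) 2
          (≮⇒≥ λ neg → refute (# (rest ∩ g u₁) ∷ # ((rest ∩ g u₁) ∖ (γ₂ ∷ y₂ ∷ [])) ∷ [])
            (1 · lit 4 ≼ var 0 ∷ 1 · var 0 ≼ var 1 ⊕ lit 2 ∷ 1 · lit 1 ⊕ var 1 ≼ lit 2 ∷ [])
            4≤ (#-∖ (rest ∩ g u₁) (γ₂ ∷ y₂ ∷ [])) neg)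
      ... | γ₁ ∷ y₁ ∷ [] , _ , (γ₁≢y₁ ∷ []) ∷ _ , ((∈₃@(_ , γ₁c ∷ γ₁u₁ ∷ γ₁u₂ ∷ []) , e₃) , γ₁γ₂ ∷ γ₁y₂ ∷ [])
        ∷ (((_ , y₁c ∷ y₁u₁ ∷ y₁u₂ ∷ []) , e₄) , y₁γ₂ ∷ y₁y₂ ∷ []) ∷ [] =
        spanning Q c γ₁ u₁ y₁ γ₂ u₂ y₂ 7+m≤Q
          ((≢-sym γ₁c ∷ c≢u₁ ∷ ≢-sym y₁c ∷ ≢-sym γ₂c ∷ c≢u₂ ∷ ≢-sym y₂c ∷ []) ∷
            (γ₁u₁ ∷ γ₁≢y₁ ∷ γ₁γ₂ ∷ γ₁u₂ ∷ γ₁y₂ ∷ []) ∷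
           (≢-sym y₁u₁ ∷ ≢-sym γ₂u₁ ∷ u₁≢u₂ ∷ ≢-sym y₂u₁ ∷ []) ∷ (y₁γ₂ ∷ y₁u₂ ∷ y₁y₂ ∷ []) ∷
             (γ₂u₂ ∷ γ₂≢y₂ ∷ []) ∷ (≢-sym y₂u₂ ∷ []) ∷ [] ∷ [])
          (c-rest ∈₃) (G-sym e₃) e₄ (c-rest ∈₁) (G-sym e₁) e₂
          (λ x∈ cx → [ (λ { refl → Any.there (Any.here refl) }) ,
            (λ { refl → Any.there (Any.there (Any.there (Any.there (Any.here refl)))) }) ]′ (covered x∈ cx))
        where
        c-rest : ∀ {x} → x ∈ rest → G c x
        c-rest (x∈ , x≢c ∷ x≢u₁ ∷ x≢u₂ ∷ []) = ¬B⇒G (≢-sym x≢c) (λ cx → [ x≢u₁ , x≢u₂ ]′ (covered x∈ cx))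

    module _ {c : Fin N} (c∈ : c ∈ Q) (few : # (Q ∩ b c) < 3) where

      -- By `mates` u₁ has at most two misses, and c is one, so it keeps 4 + m - 1 ≥ 4 neighbours in
      -- `rest`. The second missed vertex, or any other vertex if there is none, keeps 4 + m - 3 ≥
      -- 2.
      some-missed : ∀ {u₁} → u₁ ∉ Q ∩ b c
      some-missed {u₁} u₁∈@(u₁∈Q , cu₁) = second (Fin.any? (dec ((Q ∩ b c) ∖ (u₁ ∷ []))))
        where
        few₁ : # (Q ∩ b u₁) < 3
        few₁ = ≰⇒> λ 3≤ → <⇒≱ few (mates u₁∈Q 3≤ (c∈ , B-sym cu₁))
        finish : ∀ u₂ → u₂ ∈ Q → c ≢ u₂ → u₁ ≢ u₂ → (∀ {x} → x ∈ Q → B c x → x ≡ u₁ ⊎ x ≡ u₂) → ⊥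
        finish u₂ u₂∈ c≢u₂ u₁≢u₂ covered = two-legs c≢u₁ c≢u₂ u₁≢u₂ covered
          (≮⇒≥ λ neg → refute (m ∷ # (rest c≢u₁ c≢u₂ u₁≢u₂ ∩ g u₁) ∷ [])
              (1 · lit 4 ⊕ var 0 ≼ var 1 ⊕ lit 1 ∷ 1 · lit 1 ≼ var 0 ∷ 1 · lit 1 ⊕ var 1 ≼ lit 4 ∷ [])
              (rest-neighbours c≢u₁ c≢u₂ u₁≢u₂ 1 (Any.there (Any.here refl))
                (rest-misses-1 c≢u₁ c≢u₂ u₁≢u₂ few₁ (c∈ , B-sym cu₁) (Any.here refl))) 1≤m neg)
          (≮⇒≥ λ neg → refute (m ∷ # (rest c≢u₁ c≢u₂ u₁≢u₂ ∩ g u₂) ∷ [])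
              (1 · lit 4 ⊕ var 0 ≼ var 1 ⊕ lit 3 ∷ 1 · lit 1 ≼ var 0 ∷ 1 · lit 1 ⊕ var 1 ≼ lit 2 ∷ [])
              (rest-neighbours c≢u₁ c≢u₂ u₁≢u₂ 3 (Any.there (Any.there (Any.here refl)))
                (rest-misses c≢u₁ c≢u₂ u₁≢u₂ u₂∈)) 1≤m neg)
          where
          c≢u₁ : c ≢ u₁
          c≢u₁ = B-≢ cu₁
        second : Dec (∃ (_∈ ((Q ∩ b c) ∖ (u₁ ∷ [])))) → ⊥
        second (yes (u₂ , u₂∈@(u₂∈Q , cu₂) , u₂≢u₁ ∷ [])) = finish u₂ u₂∈Q (B-≢ cu₂) (≢-sym u₂≢u₁) covered
          where
          covered : ∀ {x} → x ∈ Q → B c x → x ≡ u₁ ⊎ x ≡ u₂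
          covered {x} x∈ cx with x Fin.≟ u₁ | x Fin.≟ u₂
          ... | yes p | _ = inj₁ p
          ... | _ | yes p = inj₂ p
          ... | no x≢u₁ | no x≢u₂ = contradiction
            (#-unique (Q ∩ b c) (x ∷ u₁ ∷ u₂ ∷ []) ((x≢u₁ ∷ x≢u₂ ∷ []) ∷ (≢-sym u₂≢u₁ ∷ []) ∷ [] ∷ [])
              ((x∈ , cx) ∷ u₁∈ ∷ u₂∈ ∷ [])) (<⇒≱ few)
        second (no ¬u₂) with pick Q (c ∷ u₁ ∷ []) (≤-trans (m≤m+n 3 (4 + m)) 7+m≤Q)
        ... | u₂ , u₂∈ , u₂≢c ∷ u₂≢u₁ ∷ [] = finish u₂ u₂∈ (≢-sym u₂≢c) (≢-sym u₂≢u₁)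
          (λ {x} x∈ cx → inj₁ (decidable-stable (x Fin.≟ u₁) (λ x≢u₁ → ¬u₂ (x , (x∈ , cx) , x≢u₁ ∷ []))))

      c-all : ∀ {x} → x ∈ Q → x ≢ c → G c x
      c-all x∈ x≢c = ¬B⇒G (≢-sym x≢c) (λ cx → some-missed (x∈ , cx))

      impossible : ⊥
      impossible with pick Q (c ∷ []) (≤-trans (m≤m+n 2 (5 + m)) 7+m≤Q)
      ... | u₁ , u₁∈ , u₁≢c ∷ [] = cases (3 ≤? # (Q ∩ b u₁)) (Fin.any? (dec (Q ∩ b u₁)))
        where
        finish : ∀ u₂ → u₂ ∈ Q → (c≢u₂ : c ≢ u₂) (u₁≢u₂ : u₁ ≢ u₂)
          → # (rest (≢-sym u₁≢c) c≢u₂ u₁≢u₂ ∩ b u₁) ≤ 1 → ⊥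
        finish u₂ u₂∈ c≢u₂ u₁≢u₂ h = two-legs (≢-sym u₁≢c) c≢u₂ u₁≢u₂
          (λ x∈ cx → ⊥-elim (some-missed (x∈ , cx)))
          (≮⇒≥ λ neg → refute (m ∷ # (rest (≢-sym u₁≢c) c≢u₂ u₁≢u₂ ∩ g u₁) ∷ [])
              (1 · lit 4 ⊕ var 0 ≼ var 1 ⊕ lit 1 ∷ 1 · lit 1 ≼ var 0 ∷ 1 · lit 1 ⊕ var 1 ≼ lit 4 ∷ [])
              (rest-neighbours (≢-sym u₁≢c) c≢u₂ u₁≢u₂ 1 (Any.there (Any.here refl)) h) 1≤m neg)
          (≮⇒≥ λ neg → refute (m ∷ # (rest (≢-sym u₁≢c) c≢u₂ u₁≢u₂ ∩ g u₂) ∷ [])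
              (1 · lit 4 ⊕ var 0 ≼ var 1 ⊕ lit 3 ∷ 1 · lit 1 ≼ var 0 ∷ 1 · lit 1 ⊕ var 1 ≼ lit 2 ∷ [])
              (rest-neighbours (≢-sym u₁≢c) c≢u₂ u₁≢u₂ 3 (Any.there (Any.there (Any.here refl)))
                (rest-misses (≢-sym u₁≢c) c≢u₂ u₁≢u₂ u₂∈)) 1≤m neg)
        cases : Dec (3 ≤ # (Q ∩ b u₁)) → Dec (∃ (_∈ (Q ∩ b u₁))) → ⊥
        cases (no ¬3≤) (yes (u₂ , u₂∈@(u₂∈Q , u₁u₂))) = finish u₂ u₂∈Q c≢u₂ (B-≢ u₁u₂)
          (rest-misses-1 (≢-sym u₁≢c) c≢u₂ (B-≢ u₁u₂) (≰⇒> ¬3≤) u₂∈ (Any.there (Any.there (Any.here refl))))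
          where
          c≢u₂ : c ≢ u₂
          c≢u₂ refl = some-missed (u₁∈ , B-sym u₁u₂)
        cases (no ¬3≤) (no ¬u₂) with pick Q (c ∷ u₁ ∷ []) (≤-trans (m≤m+n 3 (4 + m)) 7+m≤Q)
        ... | u₂ , u₂∈ , u₂≢c ∷ u₂≢u₁ ∷ [] = finish u₂ u₂∈ (≢-sym u₂≢c) (≢-sym u₂≢u₁)
          (≤-trans (≤-reflexive (#-empty (rest (≢-sym u₁≢c) (≢-sym u₂≢c) (≢-sym u₂≢u₁) ∩ b u₁)
            (λ { x ((x∈ , _) , e) → ¬u₂ (x , x∈ , e) }))) z≤n)
        -- Here u₁ may have only two neighbours in `rest`. The other leg m₁u₂m₂ avoids them, since
        -- its ends are missed by u₁; and u₂ is joined to both ends, since the K₄ of u₁ uses up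
        -- their misses.
        cases (yes 3≤) _ with choose (Q ∩ b u₁) 3 3≤
        ... | m₁ ∷ m₂ ∷ m₃ ∷ [] , _ , (m₁₂ ∷ m₁₃ ∷ []) ∷ (m₂₃ ∷ []) ∷ _ , ∈₁@(_ , e₁) ∷ ∈₂@(_ , e₂) ∷
          ∈₃@(_ , e₃) ∷ []
          with pick (Q ∩ g u₁) (c ∷ []) (≮⇒≥ λ neg → refute (m ∷ # Q ∷ # (Q ∩ g u₁) ∷ # (Q ∩ b u₁) ∷ [])
              (1 · lit 7 ⊕ var 0 ≼ var 1 ∷ 1 · var 1 ≼ lit 1 ⊕ (var 2 ⊕ var 3) ∷ 1 · var 3 ≼ lit 3 ∷
                1 · lit 1 ⊕ var 2 ≼ lit 2 ∷ [])
              7+m≤Q (#-split-∈ Q u₁) (misses u₁∈) neg)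
        ... | u₂ , (u₂∈ , u₁u₂) , u₂≢c ∷ []
          with choose (rest (≢-sym u₁≢c) (≢-sym u₂≢c) (G-≢ u₁u₂) ∩ g u₁) 2
            (≮⇒≥ λ neg → refute (m ∷ # (rest (≢-sym u₁≢c) (≢-sym u₂≢c) (G-≢ u₁u₂) ∩ g u₁) ∷ [])
              (1 · lit 4 ⊕ var 0 ≼ var 1 ⊕ lit 3 ∷ 1 · lit 1 ≼ var 0 ∷ 1 · lit 1 ⊕ var 1 ≼ lit 2 ∷ [])
              (rest-neighbours (≢-sym u₁≢c) (≢-sym u₂≢c) (G-≢ u₁u₂) 3 (Any.there (Any.here refl))
                (rest-misses (≢-sym u₁≢c) (≢-sym u₂≢c) (G-≢ u₁u₂) u₁∈)) 1≤m neg)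
        ... | γ ∷ y ∷ [] , _ , (γ≢y ∷ []) ∷ _ , ((γ∈ , γc ∷ γu₁ ∷ γu₂ ∷ []) , u₁γ) ∷
          ((_ , yc ∷ yu₁ ∷ yu₂ ∷ []) , u₁y) ∷ [] =
          spanning Q c γ u₁ y m₁ u₂ m₂ 7+m≤Q
            ((≢-sym γc ∷ ≢-sym u₁≢c ∷ ≢-sym yc ∷ ≢-sym (mate≢c ∈₁) ∷ ≢-sym u₂≢c ∷ ≢-sym (mate≢c ∈₂) ∷ []) ∷
             (γu₁ ∷ γ≢y ∷ GB≢ u₁γ e₁ ∷ γu₂ ∷ GB≢ u₁γ e₂ ∷ []) ∷
               (≢-sym yu₁ ∷ B-≢ e₁ ∷ G-≢ u₁u₂ ∷ B-≢ e₂ ∷ []) ∷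
             (GB≢ u₁y e₁ ∷ yu₂ ∷ GB≢ u₁y e₂ ∷ []) ∷ (≢-sym (GB≢ u₁u₂ e₁) ∷ m₁₂ ∷ []) ∷ (GB≢ u₁u₂ e₂ ∷ []) ∷
               [] ∷ [])
            (c-all γ∈ γc) (G-sym u₁γ) u₁y (c-all (proj₁ ∈₁) (mate≢c ∈₁))
            (mate-G ∈₁ (m₁₂ ∷ m₁₃ ∷ []) ∈₂ ∈₃ m₂₃) (G-sym (mate-G ∈₂ (≢-sym m₁₂ ∷ m₂₃ ∷ []) ∈₁ ∈₃ m₁₃))
            (λ x∈ cx → ⊥-elim (some-missed (x∈ , cx)))
          where
          mate≢c : ∀ {x} → x ∈ Q ∩ b u₁ → x ≢ c
          mate≢c (_ , e) refl = some-missed (u₁∈ , B-sym e)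
          GB≢ : ∀ {u x y} → G u x → B u y → x ≢ y
          GB≢ e e′ refl = B⇒¬G e′ e
          mate-G : ∀ {x y z} → x ∈ Q ∩ b u₁ → All (x ≢_) (y ∷ z ∷ []) → y ∈ Q ∩ b u₁ → z ∈ Q ∩ b u₁ → y ≢ z →
            G x u₂
          mate-G {x} {y} {z} x∈@(x∈Q , ex) (x≢y ∷ x≢z ∷ []) y∈@(y∈Q , ey) z∈@(z∈Q , ez) y≢z = ¬B⇒G
            (≢-sym (GB≢ u₁u₂ ex)) λ xu₂ →
            no-four-misses x∈Q ((B-≢ ey ∷ B-≢ ez ∷ G-≢ u₁u₂ ∷ []) ∷ (y≢z ∷ ≢-sym (GB≢ u₁u₂ ey) ∷ []) ∷
              (≢-sym (GB≢ u₁u₂ ez) ∷ []) ∷ [] ∷ [])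
              ((u₁∈ , B-sym ex) ∷ (y∈Q , ¬G⇒B x≢y (no-edge-missed u₁∈ 3≤ x∈ y∈)) ∷
                (z∈Q , ¬G⇒B x≢z (no-edge-missed u₁∈ 3≤ x∈ z∈)) ∷ (u₂∈ , xu₂) ∷ [])

    three-misses : ∀ {c} → c ∈ Q → 3 ≤ # (Q ∩ b c)
    three-misses c∈ = ≮⇒≥ (impossible c∈)

  -- The vertex p supplies the missing n-th vertex. One leg ends in qp, and the middle of the other
  -- is the vertex that c misses, if it misses one besides q.
  pendant : ∀ (Q : Sub N) {p q} → 6 + m ≤ # Q → (∀ {q} → q ∈ Q → # (Q ∩ b q) ≤ 1) → p ∉ Q → q ∈ Q → ¬ G q p
  pendant Q {p} {q} 6+m≤Q misses p∉ q∈ qp with pick Q (q ∷ []) (≤-trans (m≤m+n 2 (4 + m)) 6+m≤Q)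
  ... | c , c∈ , c≢q ∷ [] = cases (Fin.any? (dec ((Q ∩ b c) ∖ (q ∷ []))))
    where
    ≢p : ∀ {x} → x ∈ Q → x ≢ p
    ≢p x∈ refl = p∉ x∈
    7+m≤R : 7 + m ≤ # (Q ∪ single p)
    7+m≤R = ≮⇒≥ λ neg → refute (m ∷ # Q ∷ # (single p) ∷ # (Q ∪ single p) ∷ [])
        (1 · lit 6 ⊕ var 0 ≼ var 1 ∷ 1 · lit 1 ≼ var 2 ∷ 1 · var 1 ⊕ var 2 ≼ var 3 ∷
          1 · lit 1 ⊕ var 3 ≼ lit 7 ⊕ var 0 ∷ [])
        6+m≤Q (≤-reflexive (sym (#-single p))) (#-disjoint Q (single p) (Q ∪ single p) (λ _ → inj₁)
          (λ _ → inj₂) (λ _ x∈ x≡p → ≢p x∈ x≡p)) neg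
    finish : ∀ z → z ∈ Q → z ≢ c → z ≢ q → (∀ {x} → x ∈ Q → B c x → x ≡ q ⊎ x ≡ z) → ⊥
    finish z z∈ z≢c z≢q covered = legs (choose (W ∩ g z) 2
      (≤-trans (n≤1+n 2) (neighbours z∈ (Any.there (Any.there (Any.here refl))))))
      where
      W : Sub N
      W = Q ∖ (c ∷ q ∷ z ∷ [])
      neighbours : ∀ {u} → u ∈ Q → u ∈ˡ (c ∷ q ∷ z ∷ []) → 3 ≤ # (W ∩ g u)
      neighbours {u} u∈ u∈l = ≮⇒≥ λ neg → refute (m ∷ # Q ∷ # W ∷ # (W ∩ g u) ∷ # (W ∩ b u) ∷ # (Q ∩ b u) ∷
        [])
          (1 · lit 6 ⊕ var 0 ≼ var 1 ∷ 1 · lit 1 ≼ var 0 ∷ 1 · var 1 ≼ var 2 ⊕ lit 3 ∷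
            1 · var 2 ≼ var 3 ⊕ var 4 ∷ 1 · var 4 ≼ var 5 ∷ 1 · var 5 ≼ lit 1 ∷ 1 · lit 1 ⊕ var 3 ≼ lit 3 ∷
            [])
          6+m≤Q 1≤m (#-∖ Q (c ∷ q ∷ z ∷ [])) (≤-reflexive (#-split W u (λ (_ , u∉) → All.lookup u∉ u∈l refl)))
            (#-mono (W ∩ b u) (Q ∩ b u) (λ _ ((x∈ , _) , e) → x∈ , e)) (misses u∈) neg
      c-W : ∀ {x} → x ∈ W → G c x
      c-W (x∈ , x≢c ∷ x≢q ∷ x≢z ∷ []) = ¬B⇒G (≢-sym x≢c) (λ cx → [ x≢q , x≢z ]′ (covered x∈ cx))
      legs : ¬ ∃ λ l → length l ≡ 2 × Unique l × All (_∈ (W ∩ g z)) l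
      legs (γ₂ ∷ y₂ ∷ [] , _ , (γ₂≢y₂ ∷ []) ∷ _ , (∈₂@(γ₂∈ , γ₂c ∷ γ₂q ∷ γ₂z ∷ []) , e₁) ∷
        ((y₂∈ , y₂c ∷ y₂q ∷ y₂z ∷ []) , e₂) ∷ [])
        with pick (W ∩ g q) (γ₂ ∷ y₂ ∷ []) (neighbours q∈ (Any.there (Any.here refl)))
      ... | γ₁ , (∈₁@(γ₁∈ , γ₁c ∷ γ₁q ∷ γ₁z ∷ []) , e₃) , γ₁γ₂ ∷ γ₁y₂ ∷ [] =
        spanning (Q ∪ single p) c γ₁ q p γ₂ z y₂ 7+m≤R
          ((≢-sym γ₁c ∷ c≢q ∷ ≢p c∈ ∷ ≢-sym γ₂c ∷ ≢-sym z≢c ∷ ≢-sym y₂c ∷ []) ∷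
            (γ₁q ∷ ≢p γ₁∈ ∷ γ₁γ₂ ∷ γ₁z ∷ γ₁y₂ ∷ []) ∷
           (≢p q∈ ∷ ≢-sym γ₂q ∷ ≢-sym z≢q ∷ ≢-sym y₂q ∷ []) ∷
             (≢-sym (≢p γ₂∈) ∷ ≢-sym (≢p z∈) ∷ ≢-sym (≢p y₂∈) ∷ []) ∷
           (γ₂z ∷ γ₂≢y₂ ∷ []) ∷ (≢-sym y₂z ∷ []) ∷ [] ∷ [])
          (c-W ∈₁) (G-sym e₃) qp (c-W ∈₂) (G-sym e₁) e₂
          (λ { (inj₂ refl) cx → Any.there (Any.there (Any.here refl))
             ; (inj₁ x∈) cx → [ (λ { refl → Any.there (Any.here refl) }) ,
               (λ { refl → Any.there (Any.there (Any.there (Any.there (Any.here refl)))) }) ]′ (covered x∈ cx)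
               })
    cases : Dec (∃ (_∈ ((Q ∩ b c) ∖ (q ∷ [])))) → ⊥
    cases (yes (z , z∈@(z∈Q , cz) , z≢q ∷ [])) = finish z z∈Q (≢-sym (B-≢ cz)) z≢q
      (λ {x} x∈ cx → inj₂ (decidable-stable (x Fin.≟ z) λ x≢z → <⇒≱ (s≤s (misses c∈))
        (#-unique (Q ∩ b c) (x ∷ z ∷ []) ((x≢z ∷ []) ∷ [] ∷ []) ((x∈ , cx) ∷ z∈ ∷ []))))
    cases (no ¬z) with pick Q (c ∷ q ∷ []) (≤-trans (m≤m+n 3 (3 + m)) 6+m≤Q)
    ... | z , z∈ , z≢c ∷ z≢q ∷ [] = finish z z∈ z≢c z≢q
      (λ {x} x∈ cx → inj₁ (decidable-stable (x Fin.≟ q) λ x≢q → ¬z (x , (x∈ , cx) , x≢q ∷ [])))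

  -- The complement of F induces a disjoint union of copies of K₄ on Q.
  record K₄s (Q : Sub N) : Set where
    field
      upper  : ∀ {c} → c ∈ Q → # (Q ∩ b c) ≤ 3
      lower  : ∀ {c} → c ∈ Q → 3 ≤ # (Q ∩ b c)
      clique : ∀ {c x y} → c ∈ Q → x ∈ Q ∩ b c → y ∈ Q ∩ b c → x ≢ y → B x y

    component : ∀ {c} → c ∈ Q → ∃ λ x → ∃₂ λ y z → let l = c ∷ x ∷ y ∷ z ∷ [] in
      Unique l × All (_∈ Q) l × All (B c) (x ∷ y ∷ z ∷ []) × (∀ {u w} → u ∈ˡ l → w ∈ Q → All (w ≢_) l → G u w)
    component {c} c∈ with choose (Q ∩ b c) 3 (lower c∈)
    ... | x ∷ y ∷ z ∷ [] , _ , (xy ∷ xz ∷ []) ∷ (yz ∷ []) ∷ _ , x∈ ∷ y∈ ∷ z∈ ∷ [] =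
      x , y , z , (B-≢ (proj₂ x∈) ∷ B-≢ (proj₂ y∈) ∷ B-≢ (proj₂ z∈) ∷ []) ∷ (xy ∷ xz ∷ []) ∷ (yz ∷ []) ∷ [] ∷
        [] ,
      c∈ ∷ proj₁ x∈ ∷ proj₁ y∈ ∷ proj₁ z∈ ∷ [] , proj₂ x∈ ∷ proj₂ y∈ ∷ proj₂ z∈ ∷ [] , joined
      where
      own : ∀ {u} → u ∈ Q ∩ b c → c ∈ Q ∩ b u
      own (_ , cu) = c∈ , B-sym cu
      mate : ∀ {u w} → u ∈ Q ∩ b c → w ∈ Q ∩ b c → u ≢ w → w ∈ Q ∩ b u
      mate u∈ w∈ u≢w = proj₁ w∈ , clique c∈ u∈ w∈ u≢w
      full-up : ∀ {u p q r w} → u ∈ Q → Unique (p ∷ q ∷ r ∷ []) → All (_∈ (Q ∩ b u)) (p ∷ q ∷ r ∷ []) →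
        w ∈ Q → w ≢ u → All (w ≢_) (p ∷ q ∷ r ∷ []) → G u w
      full-up {u} u∈ uniq all w∈ w≢u w∉ = ¬B⇒G (≢-sym w≢u) λ uw → <⇒≱ (s≤s (upper u∈))
        (#-unique (Q ∩ b u) _ (w∉ ∷ uniq) ((w∈ , uw) ∷ all))
      joined : ∀ {u w} → u ∈ˡ (c ∷ x ∷ y ∷ z ∷ []) → w ∈ Q → All (w ≢_) (c ∷ x ∷ y ∷ z ∷ []) → G u w
      joined (Any.here refl) w∈ (wc ∷ wx ∷ wy ∷ wz ∷ []) =
        full-up c∈ ((xy ∷ xz ∷ []) ∷ (yz ∷ []) ∷ [] ∷ []) (x∈ ∷ y∈ ∷ z∈ ∷ []) w∈ wc (wx ∷ wy ∷ wz ∷ [])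
      joined (Any.there (Any.here refl)) w∈ (wc ∷ wx ∷ wy ∷ wz ∷ []) =
        full-up (proj₁ x∈) ((B-≢ (proj₂ y∈) ∷ B-≢ (proj₂ z∈) ∷ []) ∷ (yz ∷ []) ∷ [] ∷ [])
          (own x∈ ∷ mate x∈ y∈ xy ∷ mate x∈ z∈ xz ∷ []) w∈ wx (wc ∷ wy ∷ wz ∷ [])
      joined (Any.there (Any.there (Any.here refl))) w∈ (wc ∷ wx ∷ wy ∷ wz ∷ []) =
        full-up (proj₁ y∈) ((B-≢ (proj₂ x∈) ∷ B-≢ (proj₂ z∈) ∷ []) ∷ (xz ∷ []) ∷ [] ∷ [])
          (own y∈ ∷ mate y∈ x∈ (≢-sym xy) ∷ mate y∈ z∈ yz ∷ []) w∈ wy (wc ∷ wx ∷ wz ∷ [])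
      joined (Any.there (Any.there (Any.there (Any.here refl)))) w∈ (wc ∷ wx ∷ wy ∷ wz ∷ []) =
        full-up (proj₁ z∈) ((B-≢ (proj₂ x∈) ∷ B-≢ (proj₂ y∈) ∷ []) ∷ (xy ∷ []) ∷ [] ∷ [])
          (own z∈ ∷ mate z∈ x∈ (≢-sym xz) ∷ mate z∈ y∈ (≢-sym yz) ∷ []) w∈ wz (wc ∷ wx ∷ wy ∷ [])

  open K₄s

  -- Induction on the bound k: no complement edge inside Q leaves the K₄ of c, so removing it leaves
  -- a union of K₄s.
  four-divides : ∀ k (Q : Sub N) → # Q ≤ k → K₄s Q → 4 ∣ # Q
  four-divides k Q Q≤k K with 1 ≤? # Q
  four-divides k Q Q≤k K | no ¬1≤ = subst (4 ∣_) (sym (n<1⇒n≡0 (≰⇒> ¬1≤))) (4 ∣0)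
  four-divides zero Q Q≤0 K | yes 1≤ = contradiction (≤-trans 1≤ Q≤0) 1+n≰n
  four-divides (suc k) Q Q≤k K | yes 1≤ with nonempty Q 1≤
  ... | c , c∈ with component K c∈
  ... | x , y , z , uniq , l⊆Q , _ , joined = subst (4 ∣_) (sym Q≡) (∣m∣n⇒∣m+n ∣-refl (four-divides k R
      (≮⇒≥ λ neg → refute (k ∷ # Q ∷ # R ∷ [])
          (1 · lit 4 ⊕ var 2 ≼ var 1 ∷ 1 · var 1 ≼ lit 1 ⊕ var 0 ∷ 1 · lit 1 ⊕ var 0 ≼ var 2 ∷ [])
          (≤-reflexive (sym Q≡)) Q≤k neg) K′))
    where
    l : List (Fin N)
    l = c ∷ x ∷ y ∷ z ∷ []
    R : Sub N
    R = Q ∖ l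
    Q≡ : # Q ≡ 4 + # R
    Q≡ = ≤-antisym (≤-trans (#-∖ Q l) (≤-reflexive (+-comm (# R) 4)))
      (≤-trans (+-monoˡ-≤ (# R) (#-unique (elements l) l uniq (All.tabulate id)))
        (#-disjoint (elements l) R Q (λ _ → All.lookup l⊆Q) (λ _ → proj₁)
          (λ _ w∈l (_ , w∉l) → All.lookup w∉l w∈l refl)))
    outside : ∀ {w u} → w ∈ R → u ∈ Q → B w u → u ∈ R
    outside (w∈ , w∉l) u∈ wu = u∈ , ≢-all (λ u∈l → B⇒¬G wu (G-sym (joined u∈l w∈ w∉l)))
    K′ : K₄s R
    K′ .upper {w} (w∈ , _) = ≤-trans (#-mono (R ∩ b w) (Q ∩ b w) λ _ ((u∈ , _) , e) → u∈ , e) (upper K w∈)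
    K′ .lower {w} w∈R = ≤-trans (lower K (proj₁ w∈R))
      (#-mono (Q ∩ b w) (R ∩ b w) λ _ (u∈ , e) → outside w∈R u∈ e , e)
    K′ .clique (w∈ , _) ((u∈ , _) , e) ((u′∈ , _) , e′) = clique K w∈ (u∈ , e) (u′∈ , e′)

  saturated : ∀ (Q : Sub N) → 7 + m ≤ # Q → (∀ {q} → q ∈ Q → # (Q ∩ b q) ≤ 3) → K₄s Q
  saturated Q 7+m≤Q misses = record
    { upper = misses
    ; lower = three-misses Q 7+m≤Q misses
    ; clique = λ c∈ x∈ y∈ x≢y → ¬G⇒B x≢y (no-edge-missed Q 7+m≤Q misses c∈ (three-misses Q 7+m≤Q misses c∈) x∈
      y∈)
    }

  -- Exchanging t in the K₄ on q, c, u, t for p keeps the size. Then c can miss only q, u and p,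
  -- which the legs γ₁qp and γ₂uw cover.
  isolated-K₄s : ∀ (Q : Sub N) → 7 + m ≤ # Q → K₄s Q → ∀ {p q} → p ∉ Q → q ∈ Q → ¬ G q p
  isolated-K₄s Q 7+m≤Q K {p} {q} p∉ q∈ qp with component K q∈
  ... | c , u , t , (qc ∷ qu ∷ qt ∷ []) ∷ (cu ∷ ct ∷ []) ∷ (ut ∷ []) ∷ _ , _ ∷ c∈ ∷ u∈ ∷ t∈ ∷ [] , Bqc ∷ _ ,
    joined
    with choose (Q ∖ (q ∷ c ∷ u ∷ t ∷ [])) 3 (≮⇒≥ λ neg → refute (m ∷ # Q ∷ # (Q ∖ (q ∷ c ∷ u ∷ t ∷ [])) ∷ [])
        (1 · lit 7 ⊕ var 0 ≼ var 1 ∷ 1 · var 1 ≼ var 2 ⊕ lit 4 ∷ 1 · lit 1 ⊕ var 2 ≼ lit 3 ∷ [])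
        7+m≤Q (#-∖ Q (q ∷ c ∷ u ∷ t ∷ [])) neg)
  ... | γ₁ ∷ γ₂ ∷ w ∷ [] , _ , (γ₁γ₂ ∷ γ₁w ∷ []) ∷ (γ₂w ∷ []) ∷ _ ,
      (∈₁ , ∉₁@(γ₁q ∷ γ₁c ∷ γ₁u ∷ _)) ∷ (∈₂ , ∉₂@(γ₂q ∷ γ₂c ∷ γ₂u ∷ _)) ∷ (w∈ , w∉@(wq ∷ wc ∷ wu ∷ _)) ∷ [] =
    spanning (Q ∖ (t ∷ []) ∪ single p) c γ₁ q p γ₂ u w
      (≮⇒≥ λ neg → refute (m ∷ # Q ∷ # (Q ∖ (t ∷ [])) ∷ # (single p) ∷ # (Q ∖ (t ∷ []) ∪ single p) ∷ [])
          (1 · lit 7 ⊕ var 0 ≼ var 1 ∷ 1 · var 1 ≼ var 2 ⊕ lit 1 ∷ 1 · lit 1 ≼ var 3 ∷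
            1 · var 2 ⊕ var 3 ≼ var 4 ∷ 1 · lit 1 ⊕ var 4 ≼ lit 7 ⊕ var 0 ∷ [])
          7+m≤Q (#-∖ Q (t ∷ [])) (≤-reflexive (sym (#-single p)))
            (#-disjoint (Q ∖ (t ∷ [])) (single p) (Q ∖ (t ∷ []) ∪ single p) (λ _ → inj₁) (λ _ → inj₂)
            (λ { _ (x∈ , _) refl → p∉ x∈ })) neg)
      ((≢-sym γ₁c ∷ ≢-sym qc ∷ ≢p c∈ ∷ ≢-sym γ₂c ∷ cu ∷ ≢-sym wc ∷ []) ∷
        (γ₁q ∷ ≢p ∈₁ ∷ γ₁γ₂ ∷ γ₁u ∷ γ₁w ∷ []) ∷
       (≢p q∈ ∷ ≢-sym γ₂q ∷ qu ∷ ≢-sym wq ∷ []) ∷ (≢-sym (≢p ∈₂) ∷ ≢-sym (≢p u∈) ∷ ≢-sym (≢p w∈) ∷ []) ∷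
         (γ₂u ∷ γ₂w ∷ []) ∷ (≢-sym wu ∷ []) ∷ [] ∷ [])
      (joined (Any.there (Any.here refl)) ∈₁ ∉₁) (G-sym (joined (Any.here refl) ∈₁ ∉₁)) qp
      (joined (Any.there (Any.here refl)) ∈₂ ∉₂) (G-sym
        (joined (Any.there (Any.there (Any.here refl))) ∈₂ ∉₂))
        (joined (Any.there (Any.there (Any.here refl))) w∈ w∉)
      covered
    where
    ≢p : ∀ {x} → x ∈ Q → x ≢ p
    ≢p x∈ refl = p∉ x∈
    covered : ∀ {x} → x ∈ Q ∖ (t ∷ []) ∪ single p → B c x → x ∈ˡ (γ₁ ∷ q ∷ p ∷ γ₂ ∷ u ∷ w ∷ [])
    covered (inj₂ refl) cx = Any.there (Any.there (Any.here refl))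
    covered {x} (inj₁ (x∈ , x≢t ∷ [])) cx with x Fin.≟ q | x Fin.≟ u
    ... | yes refl | _ = Any.there (Any.here refl)
    ... | _ | yes refl = Any.there (Any.there (Any.there (Any.there (Any.here refl))))
    ... | no x≢q | no x≢u = contradiction (joined (Any.there (Any.here refl)) x∈
      (x≢q ∷ ≢-sym (B-≢ cx) ∷ x≢u ∷ x≢t ∷ [])) (B⇒¬G cx)

-- The upper bound

module Upper {N : ℕ} (F : Graph N) (m : ℕ) (1≤m : 1 ≤ m)
  (noTree : ¬ (S22 (7 + m) ⊆ F)) (noWheel : ¬ (W8 ⊆ complement F)) where

  open Coloured F
  open Blocks F noWheel
  open Extension F m 1≤m noTree noWheel
  open Dense F m 1≤m noTree
  open K₄s

  extend : ∀ v Γ (Γ⊆ : ∀ x → x ∈ Γ → G v x) → 3 + m ≤ # Γ →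
    (5 ≤ # Γ × 9 + m ≤ # (Z v Γ Γ⊆)) ⊎ ((∀ {x} → x ∈ Z v Γ Γ⊆ → B v x) × 10 + m ≤ # (Z v Γ Γ⊆)) → Block ⊎ Thin
  extend v Γ Γ⊆ 3+m≤Γ spare = cases spare (Path? v Γ Γ⊆)
    where
    cases : (5 ≤ # Γ × 9 + m ≤ # (Z v Γ Γ⊆)) ⊎ ((∀ {x} → x ∈ Z v Γ Γ⊆ → B v x) × 10 + m ≤ # (Z v Γ Γ⊆)) →
      Dec (∃ λ γ → ∃₂ (Path v Γ Γ⊆ γ)) → Block ⊎ Thin
    cases (inj₁ (5≤Γ , 9+m≤Z)) (yes (_ , _ , _ , γ∈ , z∈ , y∈ , γz , zy)) =
      OnePath.block-or-thin v Γ Γ⊆ (≤-trans (n≤1+n _) 3+m≤Γ) γ∈ z∈ y∈ γz zy 3+m≤Γ 5≤Γ 9+m≤Z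
    cases (inj₂ (vZ , 10+m≤Z)) (yes (_ , _ , _ , γ∈ , z∈ , y∈ , γz , zy)) =
      inj₁ (OnePath.block v Γ Γ⊆ (≤-trans (n≤1+n _) 3+m≤Γ) γ∈ z∈ y∈ γz zy vZ 3+m≤Γ 10+m≤Z)
    cases (inj₁ (5≤Γ , 9+m≤Z)) (no ¬p) = inj₁ (NoPath.block v Γ Γ⊆ ¬p 3+m≤Γ 9+m≤Z (inj₁ 5≤Γ))
    cases (inj₂ (vZ , 10+m≤Z)) (no ¬p) = inj₁ (NoPath.block v Γ Γ⊆ ¬p 3+m≤Γ (≤-trans (n≤1+n _) 10+m≤Z)
      (inj₂ vZ))

  leaving-edge? : ∀ Q → Dec (∃₂ λ q p → q ∈ Q × p ∉ Q × G q p)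
  leaving-edge? Q = Fin.any? λ q → Fin.any? λ p → dec Q q ×-dec dec (∁ Q) p ×-dec dec (g q) p

  no-leaving-edge : ∀ {Q} → ¬ (∃₂ λ q p → q ∈ Q × p ∉ Q × G q p) → Complete Q (∁ Q)
  no-leaving-edge {Q} ¬e q∈ p∉ = ¬G⇒B (λ { refl → p∉ q∈ }) (λ qp → ¬e (_ , _ , q∈ , p∉ , qp))

  -- Without an edge leaving Q, the complement joins Q to all other vertices; since N ≥ 2n - 1, one
  -- of the two sides has n vertices.
  thicken : 13 + 2 * m ≤ N → Thin → Block
  thicken 13+2m≤N (Q , X , 6+m≤Q , 4≤X , complete , misses) = cases (leaving-edge? Q) (7 + m ≤? # Q)
    where
    cases : Dec (∃₂ λ q p → q ∈ Q × p ∉ Q × G q p) → Dec (7 + m ≤ # Q) → Block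
    cases (yes (_ , _ , q∈ , p∉ , qp)) _ = ⊥-elim (pendant Q 6+m≤Q misses p∉ q∈ qp)
    cases (no ¬e) (yes 7+m≤Q) = Q , X , 7+m≤Q , 4≤X , complete
    cases (no ¬e) (no ¬7+m≤Q) = ∁ Q , Q ,
      (≮⇒≥ λ neg → refute (m ∷ N ∷ # Q ∷ # (∁ Q) ∷ [])
          (1 · lit 13 ⊕ 2 ⊛ var 0 ≼ var 1 ∷ 1 · var 1 ≼ var 2 ⊕ var 3 ∷ 1 · lit 1 ⊕ var 2 ≼ lit 7 ⊕ var 0 ∷
            1 · lit 1 ⊕ var 3 ≼ lit 7 ⊕ var 0 ∷ [])
          13+2m≤N (≤-reflexive (#-∁ Q)) (≰⇒> ¬7+m≤Q) neg) ,
      ≤-trans (m≤m+n 4 (2 + m)) 6+m≤Q , no-leaving-edge {Q} ¬e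

  module _ {Q X : Sub N} (complete : Complete X Q) (4≤X : 4 ≤ # X) where

    -- The bound on misses passes to subsets, so Q may be cut down to exactly k vertices.
    subset-K₄s : ∀ k → 7 + m ≤ k → k ≤ # Q → 4 ∣ k
    subset-K₄s k 7+m≤k k≤Q with subset Q k k≤Q
    ... | R , refl , R⊆Q = four-divides (# R) R ≤-refl (saturated R 7+m≤k λ {q} q∈ →
      ≤-trans (#-mono (R ∩ b q) (Q ∩ b q) (λ x (x∈ , e) → R⊆Q x x∈ , e))
        (few-misses {X} {Q} complete 4≤X (R⊆Q q q∈)))

    balanced : 14 + 2 * m ≡ N → 4 ∣ 7 + m → ¬ 7 + m ≤ # Q
    balanced N≡ 4∣n 7+m≤Q = cases (8 + m ≤? # Q) (leaving-edge? Q)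
      where
      K : K₄s Q
      K = saturated Q 7+m≤Q (few-misses {X} {Q} complete 4≤X)
      cases : Dec (8 + m ≤ # Q) → Dec (∃₂ λ q p → q ∈ Q × p ∉ Q × G q p) → ⊥
      -- A larger Q would make 4 divide both n and n + 1.
      cases (yes 8+m≤Q) _ = >⇒∤ (s≤s (s≤s z≤n)) (∣m+n∣m⇒∣n
        (subst (4 ∣_) (+-comm 1 (7 + m)) (subset-K₄s (8 + m) (n≤1+n _) 8+m≤Q)) 4∣n)
      cases (no _) (yes (_ , _ , q∈ , p∉ , qp)) = isolated-K₄s Q 7+m≤Q K p∉ q∈ qp
      cases (no ¬8+m≤Q) (no ¬e) = finish (nonempty Q (≤-trans (s≤s z≤n) 7+m≤Q))
        (nonempty (∁ Q) (≤-trans (s≤s z≤n) 7+m≤P))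
        where
        7+m≤P : 7 + m ≤ # (∁ Q)
        7+m≤P = ≮⇒≥ λ neg → refute (m ∷ N ∷ # Q ∷ # (∁ Q) ∷ [])
            (1 · lit 14 ⊕ 2 ⊛ var 0 ≼ var 1 ∷ 1 · var 1 ≼ var 2 ⊕ var 3 ∷ 1 · lit 1 ⊕ var 2 ≼ lit 8 ⊕ var 0 ∷
              1 · lit 1 ⊕ var 3 ≼ lit 7 ⊕ var 0 ∷ [])
            (≤-reflexive N≡) (≤-reflexive (#-∁ Q)) (≰⇒> ¬8+m≤Q) neg
        join : ∀ {p} → p ∉ Q → ∀ {q} → q ∈ Q → B p q
        join p∉ q∈ = B-sym (no-leaving-edge {Q} ¬e q∈ p∉)
        -- A K₄ in Q contains a path of three vertices; three misses of p would complete it to the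
        -- wheel of `no-path` with hub p. This contradicts the K₄s that ∁ Q must contain as well.
        two-misses : ∃ (_∈ Q) → ∀ {p} → p ∈ ∁ Q → # (∁ Q ∩ b p) < 3
        two-misses (q , q∈) {p} p∈ = ≰⇒> λ 3≤ → three (component K q∈) (choose (∁ Q ∩ b p) 3 3≤)
          where
          three : (∃ λ x → ∃₂ λ y z → let l = q ∷ x ∷ y ∷ z ∷ [] in
              Unique l × All (_∈ Q) l × All (B q) (x ∷ y ∷ z ∷
                []) × (∀ {u w} → u ∈ˡ l → w ∈ Q → All (w ≢_) l → G u w)) →
            ¬ ∃ λ l → length l ≡ 3 × Unique l × All (_∈ (∁ Q ∩ b p)) l
          three (q₁ , q₂ , _ , (_ ∷ _ ∷ _ ∷ []) ∷ (q₁≢q₂ ∷ _) ∷ _ , _ ∷ ∈₁ ∷ ∈₂ ∷ _ , qq₁ ∷ qq₂ ∷ _ , _)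
            (x₁ ∷ x₂ ∷ x₃ ∷ [] , _ , uniq , all@(a₁ ∷ a₂ ∷ a₃ ∷ [])) =
            no-path Q p x₁ x₂ x₃ q₁ q q₂ uniq (All.map proj₂ all)
              (join p∈ ∷ join (proj₁ a₁) ∷ join (proj₁ a₂) ∷ join (proj₁ a₃) ∷ [])
              ∈₁ q∈ ∈₂ q₁≢q₂ qq₁ qq₂ (≤-trans (m≤m+n 5 (2 + m)) 7+m≤Q)
        finish : ∃ (_∈ Q) → ∃ (_∈ ∁ Q) → ⊥
        finish q (p , p∈) = <⇒≱ (two-misses q p∈) (lower
          (saturated (∁ Q) 7+m≤P (λ p∈ → ≤-trans (n≤1+n _) (two-misses q p∈))) p∈)

  #Z : ∀ v Γ (Γ⊆ : ∀ x → x ∈ Γ → G v x) → N ≤ # Γ + # (Z v Γ Γ⊆) + 1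
  #Z v Γ Γ⊆ = ≮⇒≥ λ neg → refute (N ∷ # Γ ∷ # (∁ Γ) ∷ # (Z v Γ Γ⊆) ∷ [])
      (1 · var 0 ≼ var 1 ⊕ var 2 ∷ 1 · var 2 ≼ var 3 ⊕ lit 1 ∷ 1 · lit 1 ⊕ (var 1 ⊕ var 3 ⊕ lit 1) ≼ var 0 ∷
        [])
      (≤-reflexive (#-∁ Γ)) (#-∖ (∁ Γ) (v ∷ [])) neg

  -- The first 5 neighbours suffice when n = 8, and n − 4 of them for larger n.
  from-neighbours : ∀ v k → 3 + m ≤ k → 5 ≤ k → k ≤ # (g v) → 10 + m + k ≤ N → Block
  from-neighbours v k 3+m≤k 5≤k k≤g h = finish (subset (g v) k k≤g)
    where
    finish : (∃ λ Γ → # Γ ≡ k × (∀ x → x ∈ Γ → G v x)) → Block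
    finish (Γ , refl , Γ⊆) = [ id , thicken (≮⇒≥ λ neg → refute (m ∷ N ∷ # Γ ∷ [])
        (1 · lit 10 ⊕ var 0 ⊕ var 2 ≼ var 1 ∷ 1 · lit 3 ⊕ var 0 ≼ var 2 ∷
          1 · lit 1 ⊕ var 1 ≼ lit 13 ⊕ 2 ⊛ var 0 ∷ [])
        h 3+m≤k neg) ]′
      (extend v Γ Γ⊆ 3+m≤k (inj₁ (5≤k , (≮⇒≥ λ neg → refute (m ∷ N ∷ # Γ ∷ # (Z v Γ Γ⊆) ∷ [])
          (1 · var 1 ≼ var 2 ⊕ var 3 ⊕ lit 1 ∷ 1 · lit 10 ⊕ var 0 ⊕ var 2 ≼ var 1 ∷
            1 · lit 1 ⊕ var 3 ≼ lit 9 ⊕ var 0 ∷ [])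
          (#Z v Γ Γ⊆) h neg))))

  odd-impossible : 13 + 2 * m ≡ N → ¬ 4 ∣ 7 + m → ⊥
  odd-impossible N≡ 4∤n = cases (Fin.any? λ u → 3 + m ≤? # (g u))
    where
    2≤m : 2 ≤ m
    -- The value m = 1 belongs to n = 8, a multiple of 4.
    2≤m = ≤∧≢⇒< 1≤m λ { refl → 4∤n (divides 2 refl) }
    finish : Block → ⊥
    finish (Q , X , 7+m≤Q , 4≤X , complete) = 4∤n (subset-K₄s {Q} {X} complete 4≤X (7 + m) ≤-refl 7+m≤Q)
    no-large : ¬ (∃ λ u → 3 + m ≤ # (g u)) → (∃ λ v → 1 + m < # (g v)) → ⊥
    no-large ¬u (v , 2+m≤v) = LowDegree.no-vertex F m 2≤m N≡ noTree noWheel (λ x → ≮⇒≥ λ lt → ¬u (x , lt)) v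
      2+m≤v
    cases : Dec (∃ λ u → 3 + m ≤ # (g u)) → ⊥
    cases (yes (u , 3+m≤u)) = finish (from-neighbours u (3 + m) ≤-refl (+-monoʳ-≤ 3 2≤m) 3+m≤u
      (≮⇒≥ λ neg → refute (m ∷ N ∷ [])
        (1 · lit 13 ⊕ 2 ⊛ var 0 ≼ var 1 ∷ 1 · lit 1 ⊕ var 1 ≼ lit 10 ⊕ var 0 ⊕ (lit 3 ⊕ var 0) ∷ [])
        (≤-reflexive N≡) neg))
    cases (no ¬u) = no-large ¬u (LargeDegree.large-degree F noWheel (1 + m) (s≤s z≤n)
      (≮⇒≥ λ neg → refute (m ∷ N ∷ [])
        (1 · lit 13 ⊕ 2 ⊛ var 0 ≼ var 1 ∷ 1 · lit 1 ⊕ var 1 ≼ 2 ⊛ (lit 1 ⊕ var 0) ⊕ lit 10 ∷ [])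
        (≤-reflexive N≡) neg))

  even-impossible : 14 + 2 * m ≡ N → 4 ∣ 7 + m → ⊥
  even-impossible N≡ 4∣n = finish (block (LargeDegree.large-degree F noWheel (2 + m) (s≤s z≤n)
    (≮⇒≥ λ neg → refute (m ∷ N ∷ [])
      (1 · lit 14 ⊕ 2 ⊛ var 0 ≼ var 1 ∷ 1 · lit 1 ⊕ var 1 ≼ 2 ⊛ (lit 2 ⊕ var 0) ⊕ lit 10 ∷ [])
      (≤-reflexive N≡) neg)))
    where
    finish : Block → ⊥
    finish (Q , X , 7+m≤Q , 4≤X , complete) = balanced {Q} {X} complete 4≤X N≡ 4∣n 7+m≤Q
    cases : ∀ v → 3 + m ≤ # (g v) → Dec (2 ≤ m) → Dec (5 ≤ # (g v)) → Block
    cases v 3+m≤v (yes 2≤m) _ = from-neighbours v (3 + m) ≤-refl (+-monoʳ-≤ 3 2≤m) 3+m≤v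
      (≮⇒≥ λ neg → refute (m ∷ N ∷ [])
        (1 · lit 14 ⊕ 2 ⊛ var 0 ≼ var 1 ∷ 1 · lit 1 ⊕ var 1 ≼ lit 10 ⊕ var 0 ⊕ (lit 3 ⊕ var 0) ∷ [])
        (≤-reflexive N≡) neg)
    cases v 3+m≤v (no ¬2≤m) (yes 5≤v) = from-neighbours v 5 (+-monoʳ-≤ 3 (m≤n⇒m≤1+n (≤-pred (≰⇒> ¬2≤m))))
      ≤-refl 5≤v
      (≮⇒≥ λ neg → refute (m ∷ N ∷ [])
          (1 · lit 14 ⊕ 2 ⊛ var 0 ≼ var 1 ∷ 1 · lit 1 ≼ var 0 ∷ 1 · lit 1 ⊕ var 1 ≼ lit 10 ⊕ var 0 ⊕ lit 5 ∷
            [])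
          (≤-reflexive N≡) 1≤m neg)
    -- Here n = 8 and v has exactly four neighbours. Γ takes them all, so the complement joins v to
    -- the whole of Z.
    cases v 3+m≤v (no ¬2≤m) (no ¬5≤v) = [ id , thicken (≮⇒≥ λ neg → refute (m ∷ N ∷ [])
        (1 · lit 14 ⊕ 2 ⊛ var 0 ≼ var 1 ∷ 1 · lit 1 ⊕ var 1 ≼ lit 13 ⊕ 2 ⊛ var 0 ∷ [])
        (≤-reflexive N≡) neg) ]′
      (extend v (g v) (λ _ → id) 3+m≤v (inj₂ ((λ (¬vx , x≢v) → ¬G⇒B (≢-sym (All.head x≢v)) ¬vx) ,
        (≮⇒≥ λ neg → refute (m ∷ N ∷ # (g v) ∷ # (Z v (g v) (λ _ → id)) ∷ [])
            (1 · var 1 ≼ var 2 ⊕ var 3 ⊕ lit 1 ∷ 1 · lit 14 ⊕ 2 ⊛ var 0 ≼ var 1 ∷ 1 · lit 1 ⊕ var 2 ≼ lit 5 ∷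
              1 · lit 1 ≼ var 0 ∷ 1 · lit 1 ⊕ var 3 ≼ lit 10 ⊕ var 0 ∷ [])
            (#Z v (g v) (λ _ → id)) (≤-reflexive N≡) (≰⇒> ¬5≤v) 1≤m neg))))
    block : (∃ λ v → 2 + m < # (g v)) → Block
    block (v , 3+m≤v) = cases v 3+m≤v (2 ≤? m) (5 ≤? # (g v))

by-contradiction : ∀ {k N} (H : Graph k) (F : Graph N) →
  (¬ (H ⊆ F) → ¬ (W8 ⊆ complement F) → ⊥) → (H ⊆ F) ⊎ (W8 ⊆ complement F)
by-contradiction H F h = cases (⊆-dec H F) (⊆-dec W8 (complement F))
  where
  cases : Dec (H ⊆ F) → Dec (W8 ⊆ complement F) → (H ⊆ F) ⊎ (W8 ⊆ complement F)
  cases (yes t) _       = inj₁ t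
  cases (no _)  (yes w) = inj₂ w
  cases (no ¬t) (no ¬w) = ⊥-elim (h ¬t ¬w)

upper-odd : ∀ m N → 1 ≤ m → ¬ 4 ∣ 7 + m → 13 + 2 * m ≡ N → RamseyProperty (S22 (7 + m)) W8 N
upper-odd m N 1≤m 4∤n N≡ F = by-contradiction (S22 (7 + m)) F λ ¬t ¬w → Upper.odd-impossible F m 1≤m ¬t ¬w N≡
  4∤n

upper-even : ∀ m N → 1 ≤ m → 4 ∣ 7 + m → 14 + 2 * m ≡ N → RamseyProperty (S22 (7 + m)) W8 N
upper-even m N 1≤m 4∣n N≡ F = by-contradiction (S22 (7 + m)) F λ ¬t ¬w → Upper.even-impossible F m 1≤m ¬t ¬w
  N≡ 4∣n

-- The lower bound

-- A clique on the vertices below k, and a complete multipartite graph with parts of size 4 on the others.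
module Lower (m M : ℕ) where

  k : ℕ
  k = 6 + m

  block : ℕ → ℕ
  block u = (u ∸ k) / 4

  E : ℕ → ℕ → Bool
  E u v = (u <ᵇ k) ∧ (v <ᵇ k) ∨ not (u <ᵇ k) ∧ not (v <ᵇ k) ∧ not (block u ≡ᵇ block v)

  F : Graph M
  F = fromEdges M E

  low high : Fin M → Set
  low  u = toℕ u < k
  high u = k ≤ toℕ u

  E-sides : ∀ u v → T (E u v) → (u < k × v < k) ⊎ (k ≤ u × k ≤ v × block u ≢ block v)
  E-sides u v e with u <ᵇ k in p | v <ᵇ k in q
  ... | true  | true  = inj₁ (<ᵇ⇒< u k (subst T (sym p) tt) , <ᵇ⇒< v k (subst T (sym q) tt))
  ... | false | false = inj₂ (≮⇒≥ (λ lt → subst T p (<⇒<ᵇ lt)) , ≮⇒≥ (λ lt → subst T q (<⇒<ᵇ lt)) ,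
    λ eq → T-not⁻ e (≡⇒≡ᵇ _ _ eq))

  ¬E-sides : ∀ u v → ¬ T (E u v) → (u < k × k ≤ v) ⊎ (k ≤ u × v < k) ⊎ (k ≤ u × k ≤ v × block u ≡ block v)
  ¬E-sides u v ¬e with u <ᵇ k in p | v <ᵇ k in q
  ... | true  | true  = contradiction tt ¬e
  ... | true  | false = inj₁ (<ᵇ⇒< u k (subst T (sym p) tt) , ≮⇒≥ (λ lt → subst T q (<⇒<ᵇ lt)))
  ... | false | true  = inj₂ (inj₁ (≮⇒≥ (λ lt → subst T p (<⇒<ᵇ lt)) , <ᵇ⇒< v k (subst T (sym q) tt)))
  ... | false | false = inj₂ (inj₂ (≮⇒≥ (λ lt → subst T p (<⇒<ᵇ lt)) , ≮⇒≥ (λ lt → subst T q (<⇒<ᵇ lt)) ,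
    decidable-stable (block u ≟ⁿ block v) λ ne → ¬e (T-not⁺ (ne ∘ ≡ᵇ⇒≡ _ _))))

  adjacent : ∀ {u v} → T (adj F u v) → (low u × low v) ⊎ (high u × high v × block (toℕ u) ≢ block (toℕ v))
  adjacent {u} {v} e with Equivalence.to T-∨ (proj₂ (Equivalence.to (T-∧ {not (toℕ u ≡ᵇ toℕ v)}) e))
  ... | inj₁ uv = E-sides (toℕ u) (toℕ v) uv
  ... | inj₂ vu with E-sides (toℕ v) (toℕ u) vu
  ... | inj₁ (lv , lu) = inj₁ (lu , lv)
  ... | inj₂ (hv , hu , ne) = inj₂ (hu , hv , ≢-sym ne)

  co-adjacent : ∀ {u v} → T (adj (complement F) u v) →
    (low u × high v) ⊎ (high u × low v) ⊎ (high u × high v × block (toℕ u) ≡ block (toℕ v))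
  co-adjacent {u} {v} e with Equivalence.to (T-∧ {not (toℕ u ≡ᵇ toℕ v)}) e
  ... | u≠v , ¬uv = ¬E-sides (toℕ u) (toℕ v) λ uv → T-not⁻ ¬uv
    (Equivalence.from T-∧ (u≠v , Equivalence.from T-∨ (inj₁ uv)))

  high-injective : ∀ {u v : Fin M} → high u → high v → toℕ u ∸ k ≡ toℕ v ∸ k → u ≡ v
  high-injective hu hv eq = Fin.toℕ-injective (∸-cancelʳ-≡ hu hv eq)

  same-part : ∀ {u v : Fin M} → high u → high v → block (toℕ u) ≡ block (toℕ v) → (toℕ u ∸ k)
    % 4 ≡ (toℕ v ∸ k) % 4 → u ≡ v
  same-part {u} {v} hu hv q r = high-injective hu hv
    (trans (m≡m%n+[m/n]*n (toℕ u ∸ k) 4) (trans (cong₂ (λ a c → a + c * 4) r q)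
      (sym (m≡m%n+[m/n]*n (toℕ v ∸ k) 4))))

  -- Offsets in one part share their quotient by 4, and two of any five share the remainder too.
  parts-small : ∀ p (h : Fin 5 → Fin M) → Injective _≡_ _≡_ h → ¬ (∀ i → high (h i) × block (toℕ (h i)) ≡ p)
  parts-small p h inj in-part with Fin.pigeonhole {4} {5} ≤-refl (λ i → fromℕ< (m%n<n (toℕ (h i) ∸ k) 4))
  ... | i , j , i<j , eq = Fin.<⇒≢ i<j (inj (same-part (proj₁ (in-part i)) (proj₁ (in-part j))
    (trans (proj₂ (in-part i)) (sym (proj₂ (in-part j))))
      (trans (sym (Fin.toℕ-fromℕ< _)) (trans (cong toℕ eq) (Fin.toℕ-fromℕ< _)))))

  no-wheel : ¬ W8 ⊆ complement F
  no-wheel (f , inj , hom) = cases (toℕ (f 0F) <? k)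
    where
    cases : Dec (low (f 0F)) → ⊥
    -- A low hub forces a high rim, whose consecutive vertices then share a part; five of them are
    -- enough.
    cases (yes hub-low) = parts-small (block (toℕ (f 1F))) (λ i → f (rim i)) (λ eq → rim-injective (inj eq))
      in-part
      where
      rim : Fin 5 → Fin 9
      rim 0F = 1F
      rim 1F = 2F
      rim 2F = 3F
      rim 3F = 4F
      rim 4F = 5F
      rim-injective : ∀ {i j} → rim i ≡ rim j → i ≡ j
      rim-injective {i} {j} = from-yes (Fin.all? λ i → Fin.all? λ j → (rim i Fin.≟ rim j) →-dec (i Fin.≟ j)) i
        j
      rim-high : ∀ i → high (f (rim i))
      rim-high i with co-adjacent (hom 0F (rim i) (spoke i))
        where
        spoke : ∀ i → T (adj W8 0F (rim i))
        spoke = from-yes (Fin.all? λ i → T? (adj W8 0F (rim i)))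
      ... | inj₁ (_ , h) = h
      ... | inj₂ (inj₁ (h , _)) = contradiction hub-low (≤⇒≯ h)
      ... | inj₂ (inj₂ (h , _)) = contradiction hub-low (≤⇒≯ h)
      step : ∀ i j → T (adj W8 (rim i) (rim j)) → block (toℕ (f (rim i))) ≡ block (toℕ (f (rim j)))
      step i j e with co-adjacent (hom (rim i) (rim j) e)
      ... | inj₁ (l , _) = contradiction l (≤⇒≯ (rim-high i))
      ... | inj₂ (inj₁ (_ , l)) = contradiction l (≤⇒≯ (rim-high j))
      ... | inj₂ (inj₂ (_ , _ , eq)) = eq
      in-part : ∀ i → high (f (rim i)) × block (toℕ (f (rim i))) ≡ block (toℕ (f 1F))
      in-part i = rim-high i , same i
        where
        same₂ : block (toℕ (f 3F)) ≡ block (toℕ (f 1F))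
        same₂ = trans (step 2F 1F tt) (step 1F 0F tt)
        same₃ : block (toℕ (f 4F)) ≡ block (toℕ (f 1F))
        same₃ = trans (step 3F 2F tt) same₂
        same : ∀ i → block (toℕ (f (rim i))) ≡ block (toℕ (f 1F))
        same 0F = refl
        same 1F = step 1F 0F tt
        same 2F = same₂
        same 3F = same₃
        same 4F = trans (step 4F 3F tt) same₃
    -- High neighbours of a high hub lie in its part. Low vertices are not adjacent in the
    -- complement, so each of the rim edges 12, 34, 56, 78 has a high end; with the hub this makes
    -- five, told apart by `class`.
    cases (no hub-high) = parts-small (block (toℕ (f 0F))) (λ i → f (proj₁ (chosen i)))
      (λ {i} {j} eq → trans (sym (proj₁ (proj₂ (chosen i))))
        (trans (cong class (inj eq)) (proj₁ (proj₂ (chosen j)))))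
      (λ i → proj₂ (proj₂ (chosen i)))
      where
      class : Fin 9 → Fin 5
      class 0F = 0F
      class 1F = 1F
      class 2F = 1F
      class 3F = 2F
      class 4F = 2F
      class 5F = 3F
      class 6F = 3F
      class 7F = 4F
      class 8F = 4F
      Good : Fin 9 → Set
      Good p = high (f p) × block (toℕ (f p)) ≡ block (toℕ (f 0F))
      good : ∀ p → T (adj W8 0F p) → high (f p) → Good p
      good p e h with co-adjacent (hom 0F p e)
      ... | inj₁ (l , _) = contradiction l hub-high
      ... | inj₂ (inj₁ (_ , l)) = contradiction l (≤⇒≯ h)
      ... | inj₂ (inj₂ (_ , _ , eq)) = h , sym eq
      one-of : ∀ p q → T (adj W8 0F p) → T (adj W8 0F q) → T (adj W8 p q) → Good p ⊎ Good q
      one-of p q sp sq e with co-adjacent (hom p q e)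
      ... | inj₁ (_ , h) = inj₂ (good q sq h)
      ... | inj₂ (inj₁ (h , _)) = inj₁ (good p sp h)
      ... | inj₂ (inj₂ (h , _)) = inj₁ (good p sp h)
      choice : ∀ i p q → class p ≡ i → class q ≡ i → Good p ⊎ Good q → ∃ λ r → class r ≡ i × Good r
      choice i p q cp cq (inj₁ gp) = p , cp , gp
      choice i p q cp cq (inj₂ gq) = q , cq , gq
      chosen : ∀ i → ∃ λ r → class r ≡ i × Good r
      chosen 0F = 0F , refl , ≮⇒≥ hub-high , refl
      chosen 1F = choice 1F 1F 2F refl refl (one-of 1F 2F tt tt tt)
      chosen 2F = choice 2F 3F 4F refl refl (one-of 3F 4F tt tt tt)
      chosen 3F = choice 3F 5F 6F refl refl (one-of 5F 6F tt tt tt)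
      chosen 4F = choice 4F 7F 8F refl refl (one-of 7F 8F tt tt tt)

  module Tree (sub : S22 (7 + m) ⊆ F) where

    f : Fin (7 + m) → Fin M
    f = proj₁ sub

    f-injective : Injective _≡_ _≡_ f
    f-injective = proj₁ (proj₂ sub)

    data Edge : ℕ → ℕ → Set where
      leaf : ∀ {t} → 1 ≤ t → t ≤ m → Edge 0 t
      e₁ : Edge 0 (1 + m)
      e₂ : Edge (1 + m) (2 + m)
      e₃ : Edge (2 + m) (3 + m)
      e₄ : Edge 0 (4 + m)
      e₅ : Edge (4 + m) (5 + m)
      e₆ : Edge (5 + m) (6 + m)

    edge : ∀ {i j} → Edge (toℕ i) (toℕ j) → T (adj F (f i) (f j))
    edge {i} {j} e = proj₂ (proj₂ sub) i j (Equivalence.from T-∧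
      (T-not⁺ (λ i≡j → <⇒≢ (ends e) (≡ᵇ⇒≡ (toℕ i) (toℕ j) i≡j)) , Equivalence.from T-∨ (inj₁ (spider e))))
      where
      ends : ∀ {u v} → Edge u v → u < v
      ends (leaf 1≤t _) = 1≤t
      ends e₁ = s≤s z≤n
      ends e₂ = ≤-refl
      ends e₃ = ≤-refl
      ends e₄ = s≤s z≤n
      ends e₅ = ≤-refl
      ends e₆ = ≤-refl
      both : ∀ a b → T ((a ≡ᵇ a) ∧ (b ≡ᵇ b))
      both a b = Equivalence.from T-∧ (≡⇒≡ᵇ a a refl , ≡⇒≡ᵇ b b refl)
      inl : ∀ {a b} → T a → T (a ∨ b)
      inl {a} h = Equivalence.from (T-∨ {a}) (inj₁ h)
      inr : ∀ a {b} → T b → T (a ∨ b)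
      inr a h = Equivalence.from (T-∨ {a}) (inj₂ h)
      spider : ∀ {u v} → Edge u v → T (spiderEdges (7 + m) u v)
      spider {_} {v} (leaf 1≤t t≤m) = inl (Equivalence.from T-∧ (≤⇒≤ᵇ 1≤t , ≤⇒≤ᵇ t≤m))
      spider {u} {v} e₁ = inr ((u ≡ᵇ 0) ∧ (1 ≤ᵇ v) ∧ (v ≤ᵇ m)) (inl (both 0 (1 + m)))
      spider {u} {v} e₂ = inl (both (1 + m) (2 + m))
      spider {u} {v} e₃ = inr ((u ≡ᵇ 1 + m) ∧ (v ≡ᵇ 2 + m)) (inl (both (2 + m) (3 + m)))
      spider {u} {v} e₄ = inr ((u ≡ᵇ 0) ∧ (1 ≤ᵇ v) ∧ (v ≤ᵇ m)) (inr (v ≡ᵇ 1 + m) (inl (both 0 (4 + m))))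
      spider {u} {v} e₅ = inr ((u ≡ᵇ 1 + m) ∧ (v ≡ᵇ 2 + m))
        (inr ((u ≡ᵇ 2 + m) ∧ (v ≡ᵇ 3 + m)) (inl (both (4 + m) (5 + m))))
      spider {u} {v} e₆ = inr ((u ≡ᵇ 1 + m) ∧ (v ≡ᵇ 2 + m))
        (inr ((u ≡ᵇ 2 + m) ∧ (v ≡ᵇ 3 + m)) (inr ((u ≡ᵇ 4 + m) ∧ (v ≡ᵇ 5 + m)) (both (5 + m) (6 + m))))

    -- Leaves and first leg vertices are merged into `near`: only their adjacency to the centre
    -- matters.
    data Position : ℕ → Set where
      centre : Position 0
      near   : ∀ {t} → Edge 0 t → Position t
      p₂ : Position (2 + m)
      p₃ : Position (3 + m)
      p₅ : Position (5 + m)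
      p₆ : Position (6 + m)

    position : ∀ t → t < 7 + m → Position t
    position zero    _ = centre
    position (suc t) t<n with suc t ≤? m
    ... | yes t≤m = near (leaf (s≤s z≤n) t≤m)
    ... | no t≰m = far (t ∸ m) (sym (m∸n+n≡m (≤-pred (≰⇒> t≰m))))
      where
      far : ∀ r → t ≡ r + m → Position (suc t)
      far 0 refl = near e₁
      far 1 refl = p₂
      far 2 refl = p₃
      far 3 refl = near e₄
      far 4 refl = p₅
      far 5 refl = p₆
      far (suc (suc (suc (suc (suc (suc r)))))) refl = contradiction t<n
        (≤⇒≯ (m≤n+m (7 + m) r ⟨≤⟩ ≤-reflexive (shift r)))
        where
        _⟨≤⟩_ = ≤-trans
        shift : ∀ r → r + (7 + m) ≡ suc (suc (suc (suc (suc (suc (suc r))))) + m)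
        shift r = trans (sym (+-assoc r 7 m)) (cong (_+ m) (+-comm r 7))

    spread : (Q : Fin M → Set) → (∀ {u v} → T (adj F u v) → Q u → Q v) → Q (f zero) → ∀ i → Q (f i)
    spread Q closed Q₀ i = at-position (position (toℕ i) (Fin.toℕ<n i)) i refl
      where
      At : ℕ → Set
      At t = ∀ i → toℕ i ≡ t → Q (f i)
      step : ∀ {s t} → Edge s t → s < 7 + m → At s → At t
      step {s} e s<n at-s i refl = closed (edge (subst (λ s → Edge s (toℕ i)) (sym (Fin.toℕ-fromℕ< s<n)) e))
        (at-s (fromℕ< s<n) (Fin.toℕ-fromℕ< s<n))
      at-0 : At 0
      at-0 zero refl = Q₀
      at-2 : At (2 + m)
      at-2 = step e₂ (m≤n+m (2 + m) 5) (step e₁ (s≤s z≤n) at-0)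
      at-5 : At (5 + m)
      at-5 = step e₅ (m≤n+m (5 + m) 2) (step e₄ (s≤s z≤n) at-0)
      at-position : ∀ {t} → Position t → At t
      at-position centre   = at-0
      at-position (near e) = step e (s≤s z≤n) at-0
      at-position p₂       = at-2
      at-position p₃       = step e₃ (m≤n+m (3 + m) 4) at-2
      at-position p₅       = at-5
      at-position p₆       = step e₆ (m≤n+m (6 + m) 1) at-5

    -- F has no edge between the two sides, and a spider on the low side would put 7 + m vertices
    -- into 6 + m places.
    all-high : ∀ i → high (f i)
    all-high = spread high closed (≮⇒≥ not-low)
      where
      closed : ∀ {u v} → T (adj F u v) → high u → high v
      closed e hu with adjacent e
      ... | inj₁ (lu , _) = contradiction lu (≤⇒≯ hu)
      ... | inj₂ (_ , hv , _) = hv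
      low-closed : ∀ {u v} → T (adj F u v) → low u → low v
      low-closed e lu with adjacent e
      ... | inj₁ (_ , lv) = lv
      ... | inj₂ (hu , _) = contradiction lu (≤⇒≯ hu)
      not-low : ¬ low (f zero)
      not-low l = 1+n≰n (Fin.injective⇒≤ {f = λ i → fromℕ< (spread low low-closed l i)} λ {i} {j} eq →
        f-injective (Fin.toℕ-injective (trans (sym (Fin.toℕ-fromℕ< (spread low low-closed l i)))
          (trans (cong toℕ eq) (Fin.toℕ-fromℕ< (spread low low-closed l j))))))

    index : Fin (7 + m) → Fin (M ∸ k)
    index i = fromℕ< (∸-monoˡ-< (Fin.toℕ<n (f i)) (all-high i))

    toℕ-index : ∀ i → toℕ (index i) ≡ toℕ (f i) ∸ k
    toℕ-index i = Fin.toℕ-fromℕ< _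

    index-injective : Injective _≡_ _≡_ index
    index-injective {i} {j} eq = f-injective (high-injective (all-high i) (all-high j)
      (trans (sym (toℕ-index i)) (trans (cong toℕ eq) (toℕ-index j))))

    n≤M∸k : 7 + m ≤ M ∸ k
    n≤M∸k = Fin.injective⇒≤ index-injective

    module _ (4∣n : 4 ∣ 7 + m) (M∸k≤n : M ∸ k ≤ 7 + m) where

      -- There are just n places above the clique, so the spider spans them.
      surjective : ∀ y → ∃ λ i → index i ≡ y
      surjective y = decidable-stable (Fin.any? λ i → index i Fin.≟ y) λ missed →
        1+n≰n (≤-trans (missing (M ∸ k) index index-injective y (λ i eq → missed (i , eq))) M∸k≤n)
        where
        missing : ∀ l (h : Fin (7 + m) → Fin l) → Injective _≡_ _≡_ h → ∀ y → (∀ i → h i ≢ y) → suc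
          (7 + m) ≤ l
        missing (suc l) h inj y h≢y = s≤s (Fin.injective⇒≤ {f = λ i → punchOut (≢-sym (h≢y i))} λ eq →
          inj (Fin.punchOut-injective (≢-sym (h≢y _)) (≢-sym (h≢y _)) eq))

      part : Fin (7 + m) → ℕ
      part i = block (toℕ (f i))

      different-parts : ∀ {i j} → Edge (toℕ i) (toℕ j) → part i ≢ part j
      different-parts {i} {j} e with adjacent (edge {i} {j} e)
      ... | inj₁ (l , _) = contradiction l (≤⇒≯ (all-high i))
      ... | inj₂ (_ , _ , ne) = ne

      p : ℕ
      p = part zero

      -- Since 4 divides n, no part is cut off at the end, and the part of the centre has all four
      -- vertices.
      part-fits : ∀ (r : Fin 4) → toℕ r + p * 4 < M ∸ k
      part-fits r = ≤-trans (+-monoˡ-≤ (p * 4) (Fin.toℕ<n r))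
        (≤-trans (*-monoˡ-≤ 4 p<d) (≤-trans (≤-reflexive (sym n≡)) n≤M∸k))
        where
        d : ℕ
        d = quotient 4∣n
        n≡ : 7 + m ≡ d * 4
        n≡ = _∣_.equality 4∣n
        p<d : p < d
        p<d = *-cancelʳ-< 4 p d (≤-<-trans (≤-trans (m≤n+m _ _)
          (≤-reflexive (sym (m≡m%n+[m/n]*n (toℕ (f zero) ∸ k) 4))))
          (subst₂ _<_ (toℕ-index zero) n≡ (≤-trans (Fin.toℕ<n (index zero)) M∸k≤n)))

      member : Fin 4 → Fin (7 + m)
      member r = proj₁ (surjective (fromℕ< (part-fits r)))

      member-index : ∀ r → toℕ (f (member r)) ∸ k ≡ toℕ r + p * 4
      member-index r = trans (sym (toℕ-index (member r)))
        (trans (cong toℕ (proj₂ (surjective (fromℕ< (part-fits r))))) (Fin.toℕ-fromℕ< _))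

      member-part : ∀ r → part (member r) ≡ p
      member-part r = trans (cong (_/ 4) (member-index r)) (trans (+-distrib-/-∣ʳ (toℕ r) (divides p refl))
        (cong₂ _+_ (m<n⇒m/n≡0 (Fin.toℕ<n r)) (m*n/n≡m p 4)))

      member-injective : ∀ {r s} → member r ≡ member s → r ≡ s
      member-injective {r} {s} eq = Fin.toℕ-injective (+-cancelʳ-≡ (p * 4) (toℕ r) (toℕ s)
        (trans (sym (member-index r)) (trans (cong (λ i → toℕ (f i) ∸ k) eq) (member-index s))))

      -- The vertices of the part of the centre are the centre and at most one from each of two edges.
      Class : Fin 3 → ℕ → Set
      Class 0F t = t ≡ 0
      Class 1F t = t ≡ 2 + m ⊎ t ≡ 3 + m
      Class 2F t = t ≡ 5 + m ⊎ t ≡ 6 + m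

      classify : ∀ i → part i ≡ p → ∃ λ q → Class q (toℕ i)
      classify i eq = by (position (toℕ i) (Fin.toℕ<n i)) refl
        where
        by : ∀ {t} → Position t → t ≡ toℕ i → ∃ λ q → Class q t
        by centre   _ = 0F , refl
        by (near e) refl = contradiction (sym eq) (different-parts {zero} {i} e)
        by p₂       _ = 1F , inj₁ refl
        by p₃       _ = 1F , inj₂ refl
        by p₅       _ = 2F , inj₁ refl
        by p₆       _ = 2F , inj₂ refl

      class-unique : ∀ q {i j} → part i ≡ p → part j ≡ p → Class q (toℕ i) → Class q (toℕ j) → i ≡ j
      class-unique 0F _ _ a b = Fin.toℕ-injective (trans a (sym b))
      class-unique 1F _ _ (inj₁ a) (inj₁ b) = Fin.toℕ-injective (trans a (sym b))
      class-unique 1F _ _ (inj₂ a) (inj₂ b) = Fin.toℕ-injective (trans a (sym b))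
      class-unique 1F {i} {j} u v (inj₁ a) (inj₂ b) = contradiction (trans u (sym v))
        (different-parts {i} {j} (subst₂ Edge (sym a) (sym b) e₃))
      class-unique 1F {i} {j} u v (inj₂ a) (inj₁ b) = contradiction (trans v (sym u))
        (different-parts {j} {i} (subst₂ Edge (sym b) (sym a) e₃))
      class-unique 2F _ _ (inj₁ a) (inj₁ b) = Fin.toℕ-injective (trans a (sym b))
      class-unique 2F _ _ (inj₂ a) (inj₂ b) = Fin.toℕ-injective (trans a (sym b))
      class-unique 2F {i} {j} u v (inj₁ a) (inj₂ b) = contradiction (trans u (sym v))
        (different-parts {i} {j} (subst₂ Edge (sym a) (sym b) e₆))
      class-unique 2F {i} {j} u v (inj₂ a) (inj₁ b) = contradiction (trans v (sym u))
        (different-parts {j} {i} (subst₂ Edge (sym b) (sym a) e₆))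

      impossible : ⊥
      impossible = clash (Fin.pigeonhole ≤-refl (proj₁ ∘ classified))
        where
        classified : ∀ r → ∃ λ q → Class q (toℕ (member r))
        classified r = classify (member r) (member-part r)
        clash : ¬ ∃₂ λ r s → toℕ r < toℕ s × proj₁ (classified r) ≡ proj₁ (classified s)
        clash (r , s , r<s , eq) = Fin.<⇒≢ r<s (member-injective
          (class-unique (proj₁ (classified s)) (member-part r) (member-part s)
          (subst (λ q → Class q (toℕ (member r))) eq (proj₂ (classified r))) (proj₂ (classified s))))

-- At most n - 1 vertices lie above the clique, too few for a spider.
lower-odd : ∀ m M → M < 13 + 2 * m → ¬ RamseyProperty (S22 (7 + m)) W8 M
lower-odd m M M<N ramsey = [ (λ t → 1+n≰n (≤-trans (Tree.n≤M∸k t) (m≤n+o⇒m∸n≤o M (6 + m)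
    (≤-trans (≤-pred M<N) (≤-reflexive (double m)))))) , no-wheel ]′ (ramsey F)
  where
  open Lower m M
  double : ∀ m → 12 + 2 * m ≡ 6 + m + (6 + m)
  double = solve-∀

lower-even : ∀ m M → 4 ∣ 7 + m → M < 14 + 2 * m → ¬ RamseyProperty (S22 (7 + m)) W8 M
lower-even m M 4∣n M<N ramsey = [ (λ t → Tree.impossible t 4∣n (m≤n+o⇒m∸n≤o M (6 + m)
    (≤-trans (≤-pred M<N) (≤-reflexive (double m))))) , no-wheel ]′ (ramsey F)
  where
  open Lower m M
  double : ∀ m → 13 + 2 * m ≡ 6 + m + (7 + m)
  double = solve-∀

theorem21 : (n : ℕ) → 8 ≤ n →
    (n % 4 ≢ 0 → IsRamseyNumber (S22 n) W8 (2 * n ∸ 1))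
    × (n % 4 ≡ 0 → IsRamseyNumber (S22 n) W8 (2 * n))
theorem21 n 8≤n = subst Statement (m+[n∸m]≡n (≤-trans (n≤1+n 7) 8≤n)) (at-least-8 (n ∸ 7) (∸-monoˡ-≤ 7 8≤n))
  where
  Statement : ℕ → Set
  Statement n = (n % 4 ≢ 0 → IsRamseyNumber (S22 n) W8 (2 * n ∸ 1)) ×
    (n % 4 ≡ 0 → IsRamseyNumber (S22 n) W8 (2 * n))
  double : ∀ m → 14 + 2 * m ≡ 2 * (7 + m)
  double = solve-∀
  at-least-8 : ∀ m → 1 ≤ m → Statement (7 + m)
  at-least-8 m 1≤m =
    (λ ≢0 → upper-odd m (2 * (7 + m) ∸ 1) 1≤m (≢0 ∘ n∣m⇒m%n≡0 (7 + m) 4) (cong (_∸ 1) (double m)) ,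
            λ M M< → lower-odd m M (≤-trans M< (≤-reflexive (sym (cong (_∸ 1) (double m)))))) ,
    (λ ≡0 → let 4∣n = m%n≡0⇒n∣m (7 + m) 4 ≡0 in
            upper-even m (2 * (7 + m)) 1≤m 4∣n (double m) ,
            λ M M< → lower-even m M 4∣n (≤-trans M< (≤-reflexive (sym (double m)))))
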